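{- The $\mathcal I^{\mathrm{mb}}$-interpretation (majorizability upon the bounding interpretation) is a sound type-informative base interpretation of $\mathrm{HA}^\omega$.
   Context: $\mathrm{HA}^\omega$: intuitionistic theory with finite types generated by $\sigma\to\tau$ from ground types $\mathbb N$, $\mathbb B$; constants: combinators $\Pi,\Sigma$, zero $0^{\mathbb N}$, successor $\mathsf S^{\mathbb N\to\mathbb N}$, recursors $\mathsf R_\sigma:\mathbb N\to\sigma\to(\mathbb N\to\sigma\to\sigma)\to\sigma$ (simultaneous recursion allowed), Booleans $0^{\mathbb B},1^{\mathbb B}$, conditionals $\mathrm{Cond}_\sigma:\mathbb B\to\sigma\to\sigma\to\sigma$; relation symbols: only logical equality $\equiv_\sigma$ at every type. Formulas use $\bot,\wedge,\to,\forall x^\sigma,\exists x^\sigma$; $A\vee B$ abbreviates $\exists i^{\mathbb B}((i\equiv0\to A)\wedge(i\equiv1\to B))$. Axioms: equality and combinator axioms ($\Pi xy\equiv x$, $\Sigma xyz\equiv xz(yz)$); $\mathsf S$ injective, $0\notin\mathrm{range}(\mathsf S)$; $\mathsf R0wf\equiv w$, $\mathsf R(\mathsf Sn)wf\equiv fn(\mathsf Rnwf)$; $\neg(0\equiv_{\mathbb B}1)$; $D(0)\wedge D(1)\to\forall i^{\mathbb B}D(i)$ for all formulas $D$; $\mathrm{Cond}(0,x,y)\equiv x$, $\mathrm{Cond}(1,x,y)\equiv y$; induction for all formulas. Target language: the language of $\mathrm{HA}^\omega$ with the extra type constructor $\sigma\mapsto\sigma^*$ (non-empty finite subsets) and constants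 for singleton, union, indexed union $\bigcup_{w\in t}qw$, membership, combinators and recursors for all these types, and $\mathrm m:\mathbb N^*\to\mathbb N$ (maximum). $\mathcal S^\omega_*$ is the structure with $\mathcal S_{\mathbb N}=\mathbb N$, $\mathcal S_{\mathbb B}=\{0,1\}$, $\mathcal S_{\rho\to\sigma}$ all functions from $\mathcal S_\rho$ to $\mathcal S_\sigma$, $\mathcal S_{\sigma^*}$ all non-empty finite subsets of $\mathcal S_\sigma$. The target theory $T$ is the set of sentences true in $\mathcal S^\omega_*$. Strong majorizability on arithmetical star types (generated from $\mathbb N$ by $\to$ and $*$): $x\le^B_{\mathbb N}y$ iff $x\le y$; $f\le^B_{\sigma\to\tau}g$ iff $\forall x,y(x\le^B_\sigma y\to fx\le^B_\tau gy\wedge gx\le^B_\tau gy)$; $a\le^B_{\sigma^*}b$ iff $\forall u\in a\,\exists v\in b\,(u\le^B_\sigma v)\wedge\forall v\in b\,(v\le^B_\sigma v)$. An element $a$ is monotone if $a\le^B a$. For finite types over $\mathbb N,\mathbb B$: $\mathbb N^\dagger=\mathbb N$, $\mathbb B^\dagger$ is empty, $(\sigma\to\tau)^\dagger=\sigma^\dagger\to\tau^\dagger$, understood as $\tau^\dagger$ if $\sigma^\dagger$ is empty and as empty if $\tau^\dagger$ is empty. $\sigma$ is bounded if $\sigma^\dagger$ is empty, otherwise unbounded. For unbounded $\rho$, $x\le^B_\rho a$ ($x:\rho$, $a:\rho^\dagger$) is: $x\le a$ if $\rho=\mathbb N$; for $\sigma,\tau$ unbounded, $f\le^B_{\sigma\to\tau}g$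 is $\forall x^\sigma,a^{\sigma^\dagger}(x\le^B_\sigma a\to fx\le^B_\tau ga)\wedge\forall z^{\sigma^\dagger},a^{\sigma^\dagger}(z\le^B_{\sigma^\dagger}a\to gz\le^B_{\tau^\dagger}ga)$; for $\sigma$ bounded, $\tau$ unbounded, $f\le^B_{\sigma\to\tau}c$ is $\forall x^\sigma(fx\le^B_\tau c)\wedge c\le^B_{\tau^\dagger}c$. $\mathcal L^{\mathcal I}$ adds to the language of $\mathrm{HA}^\omega$ a unary predicate $\mathcal I_\sigma(x^\sigma)$ for each type. $\mathcal I^{\mathrm{mb}}$: if $\sigma$ is unbounded, $\mathcal I_\sigma(x)$ has one positive witness $a$ of type $\sigma^\dagger$, no negative ones, and $\langle\mathcal I_\sigma(x)\rangle^a$ is $x\le^B_\sigma a$; if $\sigma$ is bounded, $\mathcal I_\sigma(x)$ has no witnesses and $\langle\mathcal I_\sigma(x)\rangle$ is true. The witnessing types are the arithmetical star types and their elements are, by definition, the monotone elements; thus all quantifiers over witnesses and counter-witnesses range over monotone elements, and witnessing terms must be monotone. $\mathcal U$-interpretation (boldface letters are possibly empty tuples; $\forall\boldsymbol b\in\boldsymbol B$ is componentwise): $\langle x\equiv_\sigma y\rangle$ is $x=y$; $\langle\bot\rangle:\equiv\bot$; $\langle A\wedge B\rangle^{\boldsymbol a,\boldsymbol c}_{\boldsymbol b,\boldsymbol d}:\equiv\langle A\rangle^{\boldsymbol a}_{\boldsymbol b}\wedge\langle B\rangle^{\boldsymbol c}_{\boldsymbol d}$; $\langle A\to B\rangle^{\boldsymbol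 f,\boldsymbol g}_{\boldsymbol a,\boldsymbol d}:\equiv\forall\boldsymbol b\in\boldsymbol g\boldsymbol a\boldsymbol d\,\langle A\rangle^{\boldsymbol a}_{\boldsymbol b}\to\langle B\rangle^{\boldsymbol f\boldsymbol a}_{\boldsymbol d}$; $\langle\forall xA\rangle^{\boldsymbol a}_{\boldsymbol b}:\equiv\forall x\langle A\rangle^{\boldsymbol a}_{\boldsymbol b}$; $\langle\exists xA\rangle^{\boldsymbol a}_{\boldsymbol B}:\equiv\exists x\forall\boldsymbol b\in\boldsymbol B\langle A\rangle^{\boldsymbol a}_{\boldsymbol b}$. $A(\boldsymbol x)$ is $\mathcal U$-interpretable if there are closed (monotone) witnessing terms $\boldsymbol t$ such that $T$ proves $\langle A(\boldsymbol x)\rangle^{\boldsymbol t}_{\boldsymbol b}$ for all (monotone) $\boldsymbol b$ and all $\boldsymbol x$. $A^{\mathcal I}$ replaces $\forall x^\sigma(\dots)$ by $\forall x^\sigma(\mathcal I_\sigma(x)\to\dots)$ and $\exists x^\sigma(\dots)$ by $\exists x^\sigma(\mathcal I_\sigma(x)\wedge\dots)$. $A(\boldsymbol x)$ is $\mathcal I$-interpretable if $\forall\boldsymbol x(\mathcal I(\boldsymbol x)\to A^{\mathcal I}(\boldsymbol x))$ is $\mathcal U$-interpretable. A base interpretation is a sound type-informative base interpretation of $\mathrm{HA}^\omega$ if all $\mathcal I_\sigma(c)$ ($c^\sigma$ a constant of $\mathrm{HA}^\omega$) and all $\forall x^\sigma\forall f^{\sigma\to\tau}(\mathcal I_\sigma(x)\wedge\mathcal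 I_{\sigma\to\tau}(f)\to\mathcal I_\tau(fx))$ are $\mathcal U$-interpretable, and all non-logical axioms of $\mathrm{HA}^\omega$ are $\mathcal I$-interpretable. -}

module Defs where

open import Data.Bool.Base using (Bool; true; false; if_then_else_)
open import Data.Empty using (⊥)
open import Data.List.Base using (List; []; _∷_; _++_; map; foldr)
open import Data.List.Membership.Propositional using (_∈_)
import Data.List.Membership.Setoid as SetoidMembership
import Data.List.Membership.Setoid.Properties as SetoidMembershipₚ
open import Data.List.NonEmpty.Base as List⁺ using (List⁺; toList; _⁺++⁺_; foldr₁)
import Data.List.Relation.Binary.Subset.Setoid as SetoidSubset
open import Data.List.Relation.Unary.All as All using (All; []; _∷_)
open import Data.List.Relation.Unary.All.Properties using (++⁻ˡ; ++⁻ʳ; map⁺; map⁻)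
open import Data.List.Relation.Unary.Any as Any using (here; there)
open import Data.List.Relation.Unary.Any.Properties as Anyₚ using ()
open import Data.Maybe.Base using (Maybe; just; nothing)
open import Data.Nat.Base using (ℕ; zero; suc; _⊔_; _≤_)
open import Data.Nat.Properties
  using (≤-antisym; ≤-reflexive; ≤-trans; m≤m⊔n; m≤n⊔m; ⊔-sel)
open import Data.Product.Base using (Σ; _×_; _,_; proj₁; proj₂)
open import Data.Product.Function.NonDependent.Setoid using (proj₁ₛ)
open import Data.Product.Relation.Binary.Pointwise.NonDependent using (_×ₛ_)
open import Data.Sum.Base using (inj₁; inj₂)
open import Data.Unit.Base using (⊤; tt)
open import Function.Base using (_∘_; id)
open import Function.Bundles using (Func; _⟨$⟩_)
open import Function.Relation.Binary.Setoid.Equality using (_⇨_)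
open import Level using (0ℓ)
open import Relation.Binary.Bundles using (Setoid)
open import Relation.Binary.PropositionalEquality as ≡ using (_≡_; refl)

open Func using (to; cong)

infixr 7 _⇒_ _⇛_ _⇛ᵃ_
infix  8 _⋆

data Ty : Set where
  N B : Ty
  _⇒_ : Ty → Ty → Ty
  _⋆  : Ty → Ty

Ctx : Set
Ctx = List Ty

-- The types of HAω, i.e. those without _⋆.
data Finite : Ty → Set where
  N   : Finite N
  B   : Finite B
  _⇒_ : ∀ {σ τ} → Finite σ → Finite τ → Finite (σ ⇒ τ)

-- The arithmetical star types, i.e. those without B.
data ATy : Set where
  N   : ATy
  _⇒_ : ATy → ATy → ATy
  _⋆  : ATy → ATy

⌊_⌋ : ATy → Ty
⌊ N ⌋     = N
⌊ ρ ⇒ κ ⌋ = ⌊ ρ ⌋ ⇒ ⌊ κ ⌋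
⌊ ρ ⋆ ⌋   = ⌊ ρ ⌋ ⋆

_⇛_ : List Ty → Ty → Ty
σs ⇛ τ = foldr _⇒_ τ σs

_⇛ᵃ_ : List ATy → ATy → ATy
ρs ⇛ᵃ κ = foldr _⇒_ κ ρs

-- Step functions and recursors for simultaneous recursion on the tuple σs;
-- the case of a one-element list is the ordinary recursor.
StepTy : List Ty → Ty → Ty
StepTy σs τ = N ⇒ (σs ⇛ τ)

RecTy : List Ty → Ty → Ty
RecTy σs τ = N ⇒ (σs ⇛ (map (StepTy σs) σs ⇛ τ))

private variable
  σ τ ρ : Ty
  Γ Δ : Ctx

-- P is the predicate selecting the types of the language.
data Const (P : Ty → Set) : Ty → Set where
  Πᶜ    : P σ → P τ → Const P (σ ⇒ τ ⇒ σ)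
  Σᶜ    : P σ → P τ → P ρ → Const P ((σ ⇒ τ ⇒ ρ) ⇒ (σ ⇒ τ) ⇒ σ ⇒ ρ)
  0ᴺ    : Const P N
  Sᴺ    : Const P (N ⇒ N)
  Rᶜ    : ∀ {σs} → All P σs → σ ∈ σs → Const P (RecTy σs σ)
  0ᴮ 1ᴮ : Const P B
  Condᶜ : P σ → Const P (B ⇒ σ ⇒ σ ⇒ σ)

HAConst : Ty → Set
HAConst = Const Finite

data TConst : Ty → Set where
  base : Const (λ _ → ⊤) σ → TConst σ
  sing : TConst (σ ⇒ σ ⋆)
  ∪ᶜ   : TConst (σ ⋆ ⇒ σ ⋆ ⇒ σ ⋆)
  -- ⋃ᶜ · t · q is the union of all q w with w ∈ t.
  ⋃ᶜ   : TConst (σ ⋆ ⇒ (σ ⇒ τ ⋆) ⇒ τ ⋆)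
  maxᶜ : TConst (N ⋆ ⇒ N)

infixl 9 _·_ _·*_ _·ᵃ_

data Tm (C : Ty → Set) (Γ : Ctx) : Ty → Set where
  var : σ ∈ Γ → Tm C Γ σ
  con : C σ → Tm C Γ σ
  _·_ : Tm C Γ (σ ⇒ τ) → Tm C Γ σ → Tm C Γ τ

HATm TTm : Ctx → Ty → Set
HATm = Tm HAConst
TTm  = Tm TConst

_·*_ : ∀ {C σs} → Tm C Γ (σs ⇛ τ) → All (Tm C Γ) σs → Tm C Γ τ
t ·* []       = t
t ·* (s ∷ ss) = (t · s) ·* ss

Ren : Ctx → Ctx → Set
Ren Γ Δ = ∀ {σ} → σ ∈ Γ → σ ∈ Δ

lift : Ren Γ Δ → Ren (σ ∷ Γ) (σ ∷ Δ)
lift r (here eq) = here eq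
lift r (there i) = there (r i)

ren : ∀ {C} → Ren Γ Δ → Tm C Γ σ → Tm C Δ σ
ren r (var i) = var (r i)
ren r (con c) = con c
ren r (s · t) = ren r s · ren r t

wk : ∀ {C} → Tm C Γ σ → Tm C (τ ∷ Γ) σ
wk = ren there

v₀ : ∀ {C} → Tm C (σ ∷ Γ) σ
v₀ = var (here refl)

v₁ : ∀ {C} → Tm C (σ ∷ τ ∷ Γ) τ
v₁ = var (there (here refl))

Sub : (Ty → Set) → Ctx → Ctx → Set
Sub C Γ Δ = ∀ {σ} → σ ∈ Γ → Tm C Δ σ

liftSub : ∀ {C} → Sub C Γ Δ → Sub C (σ ∷ Γ) (σ ∷ Δ)
liftSub s (here eq) = var (here eq)
liftSub s (there i) = wk (s i)

subTm : ∀ {C} → Sub C Γ Δ → Tm C Γ σ → Tm C Δ σ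
subTm s (var i) = s i
subTm s (con c) = con c
subTm s (t · u) = subTm s t · subTm s u

extend : ∀ {C} → Tm C Δ σ → Sub C Γ Δ → Sub C (σ ∷ Γ) Δ
extend t s (here refl) = t
extend t s (there i)   = s i

embedConst : HAConst σ → TConst σ
embedConst (Πᶜ _ _)   = base (Πᶜ _ _)
embedConst (Σᶜ _ _ _) = base (Σᶜ _ _ _)
embedConst 0ᴺ         = base 0ᴺ
embedConst Sᴺ         = base Sᴺ
embedConst (Rᶜ ps i)  = base (Rᶜ (All.map (λ _ → tt) ps) i)
embedConst 0ᴮ         = base 0ᴮ
embedConst 1ᴮ         = base 1ᴮ
embedConst (Condᶜ _)  = base (Condᶜ _)

embed : HATm Γ σ → TTm Γ σ
embed (var i) = var i
embed (con c) = con (embedConst c)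
embed (s · t) = embed s · embed t

infix  6 _≐_ _∈ᶠ_
infixr 5 _∧_
infixr 4 _⟶_

-- HA is the language of HAω, HA+𝓘 that of HAω with the predicates 𝓘_σ.
data Lang : Set where
  HA HA+𝓘 : Lang

data Form : Lang → Ctx → Set where
  _≐_ : ∀ {l} → HATm Γ σ → HATm Γ σ → Form l Γ
  𝓘   : Finite σ → HATm Γ σ → Form HA+𝓘 Γ
  ⊥ᶠ  : ∀ {l} → Form l Γ
  _∧_ : ∀ {l} → Form l Γ → Form l Γ → Form l Γ
  _⟶_ : ∀ {l} → Form l Γ → Form l Γ → Form l Γ
  ∀ᶠ  : ∀ {l} → Finite σ → Form l (σ ∷ Γ) → Form l Γ
  ∃ᶠ  : ∀ {l} → Finite σ → Form l (σ ∷ Γ) → Form l Γ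

sub : ∀ {l} → Sub HAConst Γ Δ → Form l Γ → Form l Δ
sub s (t ≐ u)  = subTm s t ≐ subTm s u
sub s (𝓘 p t)  = 𝓘 p (subTm s t)
sub s ⊥ᶠ       = ⊥ᶠ
sub s (A ∧ C)  = sub s A ∧ sub s C
sub s (A ⟶ C)  = sub s A ⟶ sub s C
sub s (∀ᶠ p A) = ∀ᶠ p (sub (liftSub s) A)
sub s (∃ᶠ p A) = ∃ᶠ p (sub (liftSub s) A)

_[_] : ∀ {l} → Form l (σ ∷ Γ) → HATm Γ σ → Form l Γ
A [ t ] = sub (extend t var) A

-- Membership is a relation symbol, as it is not decidable constructively.
data TForm : Ctx → Set where
  _≐_  : TTm Γ σ → TTm Γ σ → TForm Γ
  _∈ᶠ_ : TTm Γ σ → TTm Γ (σ ⋆) → TForm Γ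
  ⊥ᶠ   : TForm Γ
  _∧_  : TForm Γ → TForm Γ → TForm Γ
  _⟶_  : TForm Γ → TForm Γ → TForm Γ
  ∀ᶠ   : (σ : Ty) → TForm (σ ∷ Γ) → TForm Γ
  ∃ᶠ   : (σ : Ty) → TForm (σ ∷ Γ) → TForm Γ

⊤ᶠ : TForm Γ
⊤ᶠ = ⊥ᶠ ⟶ ⊥ᶠ

closure : (Γ : Ctx) → TForm Γ → TForm []
closure []      φ = φ
closure (σ ∷ Γ) φ = closure Γ (∀ᶠ σ φ)

module _ {Γ : Ctx} where

  zeroᵗ : HATm Γ N
  zeroᵗ = con 0ᴺ

  sucᵗ : HATm Γ N → HATm Γ N
  sucᵗ t = con Sᴺ · t

  recᵗ : ∀ {σs} → All Finite σs → σ ∈ σs → HATm Γ N → All (HATm Γ) σs →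
         All (HATm Γ) (map (StepTy σs) σs) → HATm Γ σ
  recᵗ ps i n ws fs = ((con (Rᶜ ps i) · n) ·* ws) ·* fs

data Axiom {Γ : Ctx} : Form HA Γ → Set where
  ≐-refl  : (t : HATm Γ σ) → Axiom (t ≐ t)
  ≐-subst : (t u : HATm Γ σ) (A : Form HA (σ ∷ Γ)) →
            Axiom (t ≐ u ⟶ A [ t ] ⟶ A [ u ])
  Π-ax    : (p : Finite σ) (q : Finite τ) (x : HATm Γ σ) (y : HATm Γ τ) →
            Axiom (con (Πᶜ p q) · x · y ≐ x)
  Σ-ax    : (p : Finite σ) (q : Finite τ) (r : Finite ρ)
            (x : HATm Γ (σ ⇒ τ ⇒ ρ)) (y : HATm Γ (σ ⇒ τ)) (z : HATm Γ σ) →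
            Axiom (con (Σᶜ p q r) · x · y · z ≐ x · z · (y · z))
  S-inj   : (s t : HATm Γ N) → Axiom (sucᵗ s ≐ sucᵗ t ⟶ s ≐ t)
  S≢0     : (t : HATm Γ N) → Axiom (sucᵗ t ≐ zeroᵗ ⟶ ⊥ᶠ)
  R-zero  : ∀ {σs} (ps : All Finite σs) (i : σ ∈ σs) (ws : All (HATm Γ) σs)
            (fs : All (HATm Γ) (map (StepTy σs) σs)) →
            Axiom (recᵗ ps i zeroᵗ ws fs ≐ All.lookup ws i)
  R-suc   : ∀ {σs} (ps : All Finite σs) (i : σ ∈ σs) (n : HATm Γ N)
            (ws : All (HATm Γ) σs) (fs : All (HATm Γ) (map (StepTy σs) σs)) →
            Axiom (recᵗ ps i (sucᵗ n) ws fs ≐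
                   (All.lookup (map⁻ fs) i · n) ·* All.tabulate (λ j → recᵗ ps j n ws fs))
  0≢1     : Axiom (con 0ᴮ ≐ con 1ᴮ ⟶ ⊥ᶠ)
  B-cases : (D : Form HA (B ∷ Γ)) →
            Axiom (D [ con 0ᴮ ] ∧ D [ con 1ᴮ ] ⟶ ∀ᶠ B D)
  Cond-0  : (p : Finite σ) (x y : HATm Γ σ) →
            Axiom (con (Condᶜ p) · con 0ᴮ · x · y ≐ x)
  Cond-1  : (p : Finite σ) (x y : HATm Γ σ) →
            Axiom (con (Condᶜ p) · con 1ᴮ · x · y ≐ y)
  ind     : (A : Form HA (N ∷ Γ)) →
            Axiom (A [ zeroᵗ ] ∧
                   ∀ᶠ N (A ⟶ sub (extend (sucᵗ v₀) (var ∘ there)) A) ⟶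
                   ∀ᶠ N A)

-- Every type is interpreted as a setoid, whose equality interprets ≐.
-- Function types consist of all equality-preserving functions, compared
-- pointwise; σ ⋆ consists of non-empty finite subsets, represented by
-- non-empty lists and compared extensionally.

FinSubset : Setoid 0ℓ 0ℓ → Setoid 0ℓ 0ℓ
FinSubset A = record
  { Carrier       = List⁺ (Setoid.Carrier A)
  ; _≈_           = λ a b → toList a ⊆ toList b × toList b ⊆ toList a
  ; isEquivalence = record
    { refl  = id , id
    ; sym   = λ (p , q) → q , p
    ; trans = λ (p , q) (p′ , q′) → (λ x → p′ (p x)) , (λ x → q (q′ x))
    }
  }
  where open SetoidSubset A using (_⊆_)

𝒮 : Ty → Setoid 0ℓ 0ℓ
𝒮 N       = ≡.setoid ℕ
𝒮 B       = ≡.setoid Bool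
𝒮 (σ ⇒ τ) = 𝒮 σ ⇨ 𝒮 τ
𝒮 (σ ⋆)   = FinSubset (𝒮 σ)

∣_∣ : Ty → Set
∣ σ ∣ = Setoid.Carrier (𝒮 σ)

⊤ₛ : Setoid 0ℓ 0ℓ
⊤ₛ = ≡.setoid ⊤

𝒮* : List Ty → Setoid 0ℓ 0ℓ
𝒮* []       = ⊤ₛ
𝒮* (σ ∷ σs) = 𝒮 σ ×ₛ 𝒮* σs

Env : Ctx → Set
Env Γ = Setoid.Carrier (𝒮* Γ)

module _ {A C D : Setoid 0ℓ 0ℓ} where

  curryₛ : Func (A ×ₛ C) D → Func A (C ⇨ D)
  curryₛ f = record
    { to   = λ a → record
      { to   = λ c → f ⟨$⟩ (a , c)
      ; cong = λ c≈ → cong f (Setoid.refl A , c≈)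
      }
    ; cong = λ a≈ c → cong f (a≈ , Setoid.refl C)
    }

lookupₛ : σ ∈ Γ → Func (𝒮* Γ) (𝒮 σ)
lookupₛ (here refl) = proj₁ₛ
lookupₛ (there i)   = record
  { to   = λ (_ , η) → lookupₛ i ⟨$⟩ η
  ; cong = λ (_ , e) → cong (lookupₛ i) e
  }

curry*ₛ : (X : Setoid 0ℓ 0ℓ) (σs : List Ty) →
          Func (X ×ₛ 𝒮* σs) (𝒮 τ) → Func X (𝒮 (σs ⇛ τ))
curry*ₛ X []       f = record
  { to   = λ x → f ⟨$⟩ (x , tt)
  ; cong = λ x≈ → cong f (x≈ , refl)
  }
curry*ₛ X (σ ∷ σs) f = curryₛ (curry*ₛ (X ×ₛ 𝒮 σ) σs record
  { to   = λ ((x , a) , as) → f ⟨$⟩ (x , a , as)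
  ; cong = λ ((x≈ , a≈) , as≈) → cong f (x≈ , a≈ , as≈)
  })

module _ {A C : Setoid 0ℓ 0ℓ} where

  app-cong : {f g : Func A C} {x y : Setoid.Carrier A} →
             Setoid._≈_ (A ⇨ C) f g → Setoid._≈_ A x y →
             Setoid._≈_ C (f ⟨$⟩ x) (g ⟨$⟩ y)
  app-cong {f} {g} {x} {y} f≈g x≈y = Setoid.trans C (cong f x≈y) (f≈g y)

app* : (σs : List Ty) → ∣ σs ⇛ τ ∣ → Env σs → ∣ τ ∣
app* []       f _        = f
app* (σ ∷ σs) f (a , as) = app* σs (f ⟨$⟩ a) as

app*-cong : (σs : List Ty) {f g : ∣ σs ⇛ τ ∣} {as bs : Env σs} →
            Setoid._≈_ (𝒮 (σs ⇛ τ)) f g → Setoid._≈_ (𝒮* σs) as bs →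
            Setoid._≈_ (𝒮 τ) (app* σs f as) (app* σs g bs)
app*-cong []       f≈g _              = f≈g
app*-cong (σ ∷ σs) {f} {g} f≈g (a≈b , as≈bs) =
  app*-cong σs (app-cong {𝒮 σ} {𝒮 (σs ⇛ _)} {f} {g} f≈g a≈b) as≈bs

module _ (σs : List Ty) where

  step : (τs : List Ty) → Env (map (StepTy σs) τs) → ℕ → Env σs → Env τs
  step []       _        n as = tt
  step (τ ∷ τs) (f , fs) n as = app* σs (f ⟨$⟩ n) as , step τs fs n as

  step-cong : (τs : List Ty) {fs gs : Env (map (StepTy σs) τs)} (n : ℕ) {as bs : Env σs} →
              Setoid._≈_ (𝒮* (map (StepTy σs) τs)) fs gs → Setoid._≈_ (𝒮* σs) as bs →
              Setoid._≈_ (𝒮* τs) (step τs fs n as) (step τs gs n bs)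
  step-cong []       n _               as≈bs = refl
  step-cong (τ ∷ τs) n (f≈g , fs≈gs) as≈bs =
    app*-cong σs (f≈g n) as≈bs , step-cong τs n fs≈gs as≈bs

  simRec : ℕ → Env σs → Env (map (StepTy σs) σs) → Env σs
  simRec zero    ws fs = ws
  simRec (suc n) ws fs = step σs fs n (simRec n ws fs)

  simRec-cong : (n : ℕ) {ws ws′ : Env σs} {fs fs′ : Env (map (StepTy σs) σs)} →
                Setoid._≈_ (𝒮* σs) ws ws′ → Setoid._≈_ (𝒮* (map (StepTy σs) σs)) fs fs′ →
                Setoid._≈_ (𝒮* σs) (simRec n ws fs) (simRec n ws′ fs′)
  simRec-cong zero    ws≈ fs≈ = ws≈
  simRec-cong (suc n) ws≈ fs≈ = step-cong σs n fs≈ (simRec-cong n ws≈ fs≈)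

⟦_⟧ᶜ : ∀ {P} → Const P σ → ∣ σ ∣
⟦ Πᶜ _ _ ⟧ᶜ = curryₛ proj₁ₛ
⟦ Σᶜ {σ} {τ} {ρ} _ _ _ ⟧ᶜ = curryₛ (curryₛ record
  { to   = λ ((f , g) , x) → (f ⟨$⟩ x) ⟨$⟩ (g ⟨$⟩ x)
  ; cong = λ { {(f , g) , x} {(f′ , g′) , x′} ((f≈ , g≈) , x≈) →
      app-cong {𝒮 τ} {𝒮 ρ} {f ⟨$⟩ x} {f′ ⟨$⟩ x′}
        (app-cong {𝒮 σ} {𝒮 (τ ⇒ ρ)} {f} {f′} f≈ x≈)
        (app-cong {𝒮 σ} {𝒮 τ} {g} {g′} g≈ x≈) }
  })
⟦ 0ᴺ ⟧ᶜ = zero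
⟦ Sᴺ ⟧ᶜ = record { to = suc ; cong = ≡.cong suc }
⟦ Rᶜ {σs = σs} _ i ⟧ᶜ = curry*ₛ (𝒮 N) σs (curry*ₛ (𝒮 N ×ₛ 𝒮* σs) (map (StepTy σs) σs) record
  { to   = λ ((n , ws) , fs) → lookupₛ i ⟨$⟩ simRec σs n ws fs
  ; cong = λ { {(n , _) , _} ((refl , ws≈) , fs≈) →
      cong (lookupₛ i) (simRec-cong σs n ws≈ fs≈) }
  })
⟦ 0ᴮ ⟧ᶜ = false
⟦ 1ᴮ ⟧ᶜ = true
⟦ Condᶜ _ ⟧ᶜ = curryₛ (curryₛ record
  { to   = λ ((b , x) , y) → if b then y else x
  ; cong = λ { {(false , _) , _} ((refl , x≈) , y≈) → x≈
             ; {(true  , _) , _} ((refl , x≈) , y≈) → y≈ }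
  })

module _ (A : Setoid 0ℓ 0ℓ) where
  open Setoid A using (_≈_) renaming (Carrier to ∣A∣; trans to ≈-trans; sym to ≈-sym)
  open SetoidMembership A using () renaming (_∈_ to _∈ₛ_)
  open SetoidSubset A using (_⊆_)

  ++-mono : {as bs as′ bs′ : List ∣A∣} → as ⊆ as′ → bs ⊆ bs′ → (as ++ bs) ⊆ (as′ ++ bs′)
  ++-mono {as} {as′ = as′} p q x∈ with Anyₚ.++⁻ as x∈
  ... | inj₁ x∈as = Anyₚ.++⁺ˡ (p x∈as)
  ... | inj₂ x∈bs = Anyₚ.++⁺ʳ as′ (q x∈bs)

  singₛ : Func A (FinSubset A)
  singₛ = record
    { to   = λ x → x List⁺.∷ []
    ; cong = λ x≈y → (λ { (here z≈x) → here (≈-trans z≈x x≈y) })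
                   , (λ { (here z≈y) → here (≈-trans z≈y (≈-sym x≈y)) })
    }

  ∪ₛ : Func (FinSubset A ×ₛ FinSubset A) (FinSubset A)
  ∪ₛ = record
    { to   = λ (a , b) → a ⁺++⁺ b
    ; cong = λ ((p , p′) , (q , q′)) → ++-mono p q , ++-mono p′ q′
    }

module _ (A C : Setoid 0ℓ 0ℓ) where
  open Setoid A using (_≈_) renaming (Carrier to ∣A∣; refl to ≈-refl; sym to ≈-sym)
  open Setoid C using () renaming (Carrier to ∣C∣)
  open SetoidMembership A using () renaming (_∈_ to _∈₁_)
  open SetoidMembership C using () renaming (_∈_ to _∈₂_)

  Any⇒∈-concatMap : (q : ∣A∣ → List⁺ ∣C∣) (a : List⁺ ∣A∣) {y : ∣C∣} →
                    Any.Any (λ x → y ∈₂ toList (q x)) (toList a) →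
                    y ∈₂ toList (List⁺.concatMap q a)
  Any⇒∈-concatMap q (x List⁺.∷ xs) (here y∈)  = Anyₚ.++⁺ˡ y∈
  Any⇒∈-concatMap q (x List⁺.∷ xs) (there y∈) =
    Anyₚ.++⁺ʳ (toList (q x)) (Anyₚ.concat⁺ (Anyₚ.map⁺ (Anyₚ.map⁺ y∈)))

  ∈-concatMap⇒Any : (q : ∣A∣ → List⁺ ∣C∣) (a : List⁺ ∣A∣) {y : ∣C∣} →
                    y ∈₂ toList (List⁺.concatMap q a) →
                    Any.Any (λ x → y ∈₂ toList (q x)) (toList a)
  ∈-concatMap⇒Any q (x List⁺.∷ xs) y∈ with Anyₚ.++⁻ (toList (q x)) y∈
  ... | inj₁ y∈q = here y∈q
  ... | inj₂ y∈r = there (Anyₚ.map⁻ (Anyₚ.map⁻ (Anyₚ.concat⁻ _ y∈r)))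

  ⋃-mono : (q q′ : Func A (FinSubset C)) (a a′ : List⁺ ∣A∣) →
           Setoid._≈_ (A ⇨ FinSubset C) q q′ →
           (∀ {x} → x ∈₁ toList a → x ∈₁ toList a′) →
           ∀ {y} → y ∈₂ toList (List⁺.concatMap (to q) a) →
                   y ∈₂ toList (List⁺.concatMap (to q′) a′)
  ⋃-mono q q′ a a′ q≈ a⊆ y∈ =
    let x , x∈a , y∈qx = SetoidMembership.find A (∈-concatMap⇒Any (to q) a y∈)
    in Any⇒∈-concatMap (to q′) a′
         (Any.map (λ x≈z → proj₁ (cong q′ x≈z) (proj₁ (q≈ x) y∈qx)) (a⊆ x∈a))

  ⋃ₛ : Func (FinSubset A ×ₛ (A ⇨ FinSubset C)) (FinSubset C)
  ⋃ₛ = record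
    { to   = λ (a , q) → List⁺.concatMap (to q) a
    ; cong = λ { {a , q} {a′ , q′} ((a⊆ , a⊇) , q≈) →
        ⋃-mono q q′ a a′ q≈ a⊆
      , ⋃-mono q′ q a′ a (λ x → proj₂ (q≈ x) , proj₁ (q≈ x)) a⊇ }
    }

max⁺ : List⁺ ℕ → ℕ
max⁺ = foldr₁ _⊔_

max⁺-upper : (a : List⁺ ℕ) {x : ℕ} → x ∈ toList a → x ≤ max⁺ a
max⁺-upper (x List⁺.∷ [])     (here refl) = ≤-reflexive refl
max⁺-upper (x List⁺.∷ y ∷ ys) (here refl) = m≤m⊔n x _
max⁺-upper (x List⁺.∷ y ∷ ys) (there i)   =
  ≤-trans (max⁺-upper (y List⁺.∷ ys) i) (m≤n⊔m x _)

max⁺-∈ : (x : ℕ) (xs : List ℕ) → max⁺ (x List⁺.∷ xs) ∈ x ∷ xs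
max⁺-∈ x []       = here refl
max⁺-∈ x (y ∷ ys) with ⊔-sel x (max⁺ (y List⁺.∷ ys))
... | inj₁ eq = here eq
... | inj₂ eq = there (≡.subst (_∈ (y ∷ ys)) (≡.sym eq) (max⁺-∈ y ys))

maxₛ : Func (FinSubset (𝒮 N)) (𝒮 N)
maxₛ = record
  { to   = max⁺
  ; cong = λ { {x List⁺.∷ xs} {y List⁺.∷ ys} (a⊆b , b⊆a) →
      ≤-antisym (max⁺-upper (y List⁺.∷ ys) (a⊆b (max⁺-∈ x xs)))
                (max⁺-upper (x List⁺.∷ xs) (b⊆a (max⁺-∈ y ys))) }
  }

⟦_⟧ᵀ : TConst σ → ∣ σ ∣
⟦ base c ⟧ᵀ         = ⟦ c ⟧ᶜ
⟦ sing {σ} ⟧ᵀ       = singₛ (𝒮 σ)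
⟦ ∪ᶜ {σ} ⟧ᵀ         = curryₛ (∪ₛ (𝒮 σ))
⟦ ⋃ᶜ {σ} {τ} ⟧ᵀ     = curryₛ (⋃ₛ (𝒮 σ) (𝒮 τ))
⟦ maxᶜ ⟧ᵀ           = maxₛ

⟦_⟧ : TTm Γ σ → Env Γ → ∣ σ ∣
⟦ var i ⟧ η = lookupₛ i ⟨$⟩ η
⟦ con c ⟧ η = ⟦ c ⟧ᵀ
⟦ s · t ⟧ η = ⟦ s ⟧ η ⟨$⟩ ⟦ t ⟧ η

infix 3 _⊨_

_⊨_ : Env Γ → TForm Γ → Set
η ⊨ _≐_ {σ = σ} s t  = Setoid._≈_ (𝒮 σ) (⟦ s ⟧ η) (⟦ t ⟧ η)
η ⊨ _∈ᶠ_ {σ = σ} s t = SetoidMembership._∈_ (𝒮 σ) (⟦ s ⟧ η) (toList (⟦ t ⟧ η))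
η ⊨ ⊥ᶠ               = ⊥
η ⊨ φ ∧ ψ            = (η ⊨ φ) × (η ⊨ ψ)
η ⊨ φ ⟶ ψ            = (η ⊨ φ) → (η ⊨ ψ)
η ⊨ ∀ᶠ σ φ           = (x : ∣ σ ∣) → (x , η) ⊨ φ
η ⊨ ∃ᶠ σ φ           = Σ ∣ σ ∣ λ x → (x , η) ⊨ φ

-- The target theory, the set of sentences true in 𝒮. The set is closed under
-- deduction, so T φ also expresses that T proves φ. Truth is the Tarskian
-- notion, with connectives and quantifiers read in the metatheory.
T : TForm [] → Set
T φ = tt ⊨ φ

-- R n x (Π S) computes x + n.
_+ᵗ_ : TTm Γ N → TTm Γ N → TTm Γ N
x +ᵗ n =
  con (base (Rᶜ {σs = N ∷ []} (tt ∷ []) (here refl))) · n · x ·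
  (con (base (Πᶜ tt tt)) · con (base Sᴺ))

_≤ᵗ_ : TTm Γ N → TTm Γ N → TForm Γ
x ≤ᵗ y = ∃ᶠ N (wk x +ᵗ v₀ ≐ wk y)

∀∈ ∃∈ : TTm Γ (σ ⋆) → TForm (σ ∷ Γ) → TForm Γ
∀∈ t φ = ∀ᶠ _ (v₀ ∈ᶠ wk t ⟶ φ)
∃∈ t φ = ∃ᶠ _ (v₀ ∈ᶠ wk t ∧ φ)

leᴮ : (ρ : ATy) → TTm Γ ⌊ ρ ⌋ → TTm Γ ⌊ ρ ⌋ → TForm Γ
leᴮ N       x y = x ≤ᵗ y
leᴮ (ρ ⇒ κ) f g =
  ∀ᶠ ⌊ ρ ⌋ (∀ᶠ ⌊ ρ ⌋ (leᴮ ρ v₁ v₀ ⟶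
    leᴮ κ (wk (wk f) · v₁) (wk (wk g) · v₀) ∧
    leᴮ κ (wk (wk g) · v₁) (wk (wk g) · v₀)))
leᴮ (ρ ⋆)   a b =
  ∀∈ a (∃∈ (wk b) (leᴮ ρ v₁ v₀)) ∧
  ∀∈ b (leᴮ ρ v₀ v₀)

Monotone : (ρ : ATy) → TTm Γ ⌊ ρ ⌋ → TForm Γ
Monotone ρ a = leᴮ ρ a a

-- σ† is empty iff the value is nothing, i.e. iff σ is bounded.
_⇒†_ : Maybe ATy → Maybe ATy → Maybe ATy
nothing ⇒† n       = n
just α  ⇒† nothing = nothing
just α  ⇒† just β  = just (α ⇒ β)

_† : Finite σ → Maybe ATy
N †       = just N
B †       = nothing
(p ⇒ q) † = (p †) ⇒† (q †)

-- Majorization of objects of type σ by objects of type σ†; for bounded σ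
-- there is nothing to define.
Maj : Ty → Maybe ATy → Set
Maj σ nothing  = ⊤
Maj σ (just α) = ∀ {Γ} → TTm Γ σ → TTm Γ ⌊ α ⌋ → TForm Γ

maj⇒ : (m n : Maybe ATy) → Maj σ m → Maj τ n → Maj (σ ⇒ τ) (m ⇒† n)
maj⇒ nothing  nothing  _ _ = tt
maj⇒ (just α) nothing  _ _ = tt
maj⇒ {σ} nothing (just β) _ le-τ f c =
  ∀ᶠ σ (le-τ (wk f · v₀) (wk c)) ∧ leᴮ β c c
maj⇒ {σ} (just α) (just β) le-σ le-τ f g =
  ∀ᶠ σ (∀ᶠ ⌊ α ⌋ (le-σ v₁ v₀ ⟶ le-τ (wk (wk f) · v₁) (wk (wk g) · v₀))) ∧
  ∀ᶠ ⌊ α ⌋ (∀ᶠ ⌊ α ⌋ (leᴮ α v₁ v₀ ⟶ leᴮ β (wk (wk g) · v₁) (wk (wk g) · v₀)))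

maj : (p : Finite σ) → Maj σ (p †)
maj N       = _≤ᵗ_
maj B       = tt
maj (p ⇒ q) = maj⇒ (p †) (q †) (maj p) (maj q)

Tms : Ctx → List ATy → Set
Tms Γ = All (λ ρ → TTm Γ ⌊ ρ ⌋)

renTms : ∀ {ρs} → Ren Γ Δ → Tms Γ ρs → Tms Δ ρs
renTms r = All.map (ren r)

_·ᵃ_ : ∀ {ρs κ} → TTm Γ ⌊ ρs ⇛ᵃ κ ⌋ → Tms Γ ρs → TTm Γ ⌊ κ ⌋
t ·ᵃ []       = t
t ·ᵃ (a ∷ as) = (t · a) ·ᵃ as

infixl 6 _▷_

_▷_ : Ctx → List ATy → Ctx
Γ ▷ []       = Γ
Γ ▷ (ρ ∷ ρs) = (⌊ ρ ⌋ ∷ Γ) ▷ ρs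

wk▷ : (ρs : List ATy) → Ren Γ (Γ ▷ ρs)
wk▷ []       i = i
wk▷ (ρ ∷ ρs) i = wk▷ ρs (there i)

vars▷ : (ρs : List ATy) → Tms (Γ ▷ ρs) ρs
vars▷ []       = []
vars▷ (ρ ∷ ρs) = var (wk▷ ρs (here refl)) ∷ vars▷ ρs

Monotone* : ∀ {ρs} → Tms Γ ρs → TForm Γ
Monotone* []               = ⊤ᶠ
Monotone* (_∷_ {x = ρ} a as) = Monotone ρ a ∧ Monotone* as

-- Quantification over all monotone tuples, and over those whose components
-- belong to the given sets.
∀mon : (ρs : List ATy) → TForm (Γ ▷ ρs) → TForm Γ
∀mon []       φ = φ
∀mon (ρ ∷ ρs) φ = ∀ᶠ ⌊ ρ ⌋ (Monotone ρ v₀ ⟶ ∀mon ρs φ)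

∀mon∈ : (ρs : List ATy) → Tms Γ (map _⋆ ρs) → TForm (Γ ▷ ρs) → TForm Γ
∀mon∈ []       []       φ = φ
∀mon∈ (ρ ∷ ρs) (t ∷ ts) φ =
  ∀∈ t (Monotone ρ v₀ ⟶ ∀mon∈ ρs (renTms there ts) φ)

-- ⟨𝓘⟩ p t a b is the interpretation of 𝓘_σ(t) with positive witnesses a and
-- negative witnesses b.
record BaseInterpretation : Set where
  field
    pos𝓘 neg𝓘 : Finite σ → List ATy
    ⟨𝓘⟩       : (p : Finite σ) → TTm Γ σ → Tms Γ (pos𝓘 p) → Tms Γ (neg𝓘 p) → TForm Γ

_^𝓘 : Form HA Γ → Form HA+𝓘 Γ
(s ≐ t) ^𝓘  = s ≐ t
⊥ᶠ ^𝓘       = ⊥ᶠ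
(A ∧ C) ^𝓘  = A ^𝓘 ∧ C ^𝓘
(A ⟶ C) ^𝓘  = A ^𝓘 ⟶ C ^𝓘
(∀ᶠ p A) ^𝓘 = ∀ᶠ p (𝓘 p v₀ ⟶ A ^𝓘)
(∃ᶠ p A) ^𝓘 = ∃ᶠ p (𝓘 p v₀ ∧ A ^𝓘)

-- ∀x (𝓘(x) → A) for the tuple x of all free variables
∀𝓘 : All Finite Γ → Form HA+𝓘 Γ → Form HA+𝓘 []
∀𝓘 []       A = A
∀𝓘 (p ∷ ps) A = ∀𝓘 ps (∀ᶠ p (𝓘 p v₀ ⟶ A))

module _ (I : BaseInterpretation) where
  open BaseInterpretation I

  pos neg : ∀ {l} → Form l Γ → List ATy
  pos (s ≐ t)  = []
  pos (𝓘 p t)  = pos𝓘 p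
  pos ⊥ᶠ       = []
  pos (A ∧ C)  = pos A ++ pos C
  pos (A ⟶ C)  = map (pos A ⇛ᵃ_) (pos C) ++ map (λ ρ → pos A ⇛ᵃ (neg C ⇛ᵃ (ρ ⋆))) (neg A)
  pos (∀ᶠ p A) = pos A
  pos (∃ᶠ p A) = pos A

  neg (s ≐ t)  = []
  neg (𝓘 p t)  = neg𝓘 p
  neg ⊥ᶠ       = []
  neg (A ∧ C)  = neg A ++ neg C
  neg (A ⟶ C)  = pos A ++ neg C
  neg (∀ᶠ p A) = neg A
  neg (∃ᶠ p A) = map _⋆ (neg A)

  -- ⟨ A ⟩ r a b is ⟨A⟩ with positive witnesses a and negative witnesses b,
  -- the free variables of A being renamed by r.
  ⟨_⟩ : ∀ {l} (A : Form l Γ) → Ren Γ Δ → Tms Δ (pos A) → Tms Δ (neg A) → TForm Δ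
  ⟨ s ≐ t ⟩  r _  _  = ren r (embed s) ≐ ren r (embed t)
  ⟨ 𝓘 p t ⟩  r a  b  = ⟨𝓘⟩ p (ren r (embed t)) a b
  ⟨ ⊥ᶠ ⟩     r _  _  = ⊥ᶠ
  ⟨ A ∧ C ⟩  r ac bd =
    ⟨ A ⟩ r (++⁻ˡ (pos A) ac) (++⁻ˡ (neg A) bd) ∧
    ⟨ C ⟩ r (++⁻ʳ (pos A) ac) (++⁻ʳ (neg A) bd)
  ⟨_⟩ {Δ = Δ} (A ⟶ C) r fg ad =
    ∀mon∈ (neg A) gad (⟨ A ⟩ (λ i → wk▷ (neg A) (r i)) (renTms (wk▷ (neg A)) a) (vars▷ (neg A))) ⟶
    ⟨ C ⟩ r fa d
    where
    a : Tms Δ (pos A)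
    a = ++⁻ˡ (pos A) ad

    d : Tms Δ (neg C)
    d = ++⁻ʳ (pos A) ad

    fa : Tms Δ (pos C)
    fa = All.map (_·ᵃ a) (map⁻ (++⁻ˡ (map (pos A ⇛ᵃ_) (pos C)) fg))

    gad : Tms Δ (map _⋆ (neg A))
    gad = map⁺ (All.map (λ g → g ·ᵃ a ·ᵃ d) (map⁻ (++⁻ʳ (map (pos A ⇛ᵃ_) (pos C)) fg)))
  ⟨ ∀ᶠ {σ} p A ⟩ r a b = ∀ᶠ σ (⟨ A ⟩ (lift r) (renTms there a) (renTms there b))
  ⟨ ∃ᶠ {σ} p A ⟩ r a b =
    ∃ᶠ σ (∀mon∈ (neg A) (renTms there b)
      (⟨ A ⟩ (λ i → wk▷ (neg A) (lift r i))
             (renTms (wk▷ (neg A)) (renTms there a)) (vars▷ (neg A))))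

  record UInterpretable {Γ l} (A : Form l Γ) : Set where
    field
      witnesses : Tms [] (pos A)
      monotone  : T (Monotone* witnesses)
      holds     : T (closure Γ (∀mon (neg A)
                    (⟨ A ⟩ (wk▷ (neg A)) (renTms (λ ()) witnesses) (vars▷ (neg A)))))

  IInterpretable : All Finite Γ → Form HA Γ → Set
  IInterpretable ps A = UInterpretable (∀𝓘 ps (A ^𝓘))

  record SoundTypeInformative : Set where
    field
      constants   : (p : Finite σ) (c : HAConst σ) →
                    UInterpretable {[]} (𝓘 p (con c))
      application : (p : Finite σ) (q : Finite τ) →
                    UInterpretable {[]} (∀ᶠ p (∀ᶠ (p ⇒ q)
                      (𝓘 p v₁ ∧ 𝓘 (p ⇒ q) v₀ ⟶ 𝓘 q (v₀ · v₁))))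
      axioms      : (ps : All Finite Γ) {A : Form HA Γ} → Axiom A → IInterpretable ps A

posᵐᵇ : Maybe ATy → List ATy
posᵐᵇ nothing  = []
posᵐᵇ (just α) = α ∷ []

⟨𝓘ᵐᵇ⟩ : (m : Maybe ATy) → Maj σ m → TTm Γ σ → Tms Γ (posᵐᵇ m) → TForm Γ
⟨𝓘ᵐᵇ⟩ nothing  _  x _        = ⊤ᶠ
⟨𝓘ᵐᵇ⟩ (just α) le x (a ∷ []) = le x a

𝓘ᵐᵇ : BaseInterpretation
𝓘ᵐᵇ = record
  { pos𝓘 = λ p → posᵐᵇ (p †)
  ; neg𝓘 = λ _ → []
  ; ⟨𝓘⟩  = λ p x a _ → ⟨𝓘ᵐᵇ⟩ (p †) (maj p) x a
  }

{-# OPTIONS --safe #-}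

-- A term built by application from monotone constants is monotone, so the
-- witnesses are written as λ-terms over such constants. The only constant that
-- needs care is the recursor, which is not monotone in its first argument; it is
-- replaced by λ n w f → R n w (λ k v → v ⊔ f v), where ⊔ is max on N, union on
-- σ ⋆, and is taken pointwise on function types.
--
-- ⟨A⟩ is preserved when its positive witnesses are increased in the pointwise
-- order given by ≤ on N and ⊆ on σ ⋆ (for ≤ᴮ this fails at implications, whose
-- premises are quantified over the sets in question). Hence joins realize case
-- distinctions. For induction up to m, let a₀ realize A(0) and let (F, G) realize
-- the step. Then A(l) is realized by the l-th iterate of F m at a₀ for l ≤ m, and
-- the join of these iterates realizes A(l) for all l ≤ m. To obtain it at the
-- counterwitness b, the premises are needed only at the counterwitnesses reached
-- from b in at most m steps d ↦ G m a d, where a ranges over the iterates. These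
-- counterwitnesses form a finite set given by a term.
--
-- The interpretation of A(t) depends on t only through its value, so the other
-- axioms are realized uniformly, the equational ones without any witnesses.

module Submission where

open import Defs

open import Data.Bool.Base using (Bool; true; false)
open import Data.Empty using (⊥)
open import Data.List.Base using (List; []; _∷_; _++_; map)
open import Data.List.Membership.Propositional using (_∈_)
import Data.List.Membership.Setoid as SetoidMembership
open import Data.List.NonEmpty.Base as List⁺ using (toList)
open import Data.List.Relation.Unary.All as All using (All; []; _∷_)
open import Data.List.Relation.Unary.All.Properties using (++⁺; ++⁻ˡ; ++⁻ʳ; map⁺; map⁻)
open import Data.List.Relation.Unary.Any as Any using (here; there)
open import Data.List.Relation.Unary.Any.Properties as Anyₚ using ()
open import Data.Maybe.Base using (Maybe; just; nothing)
open import Data.Nat.Base using (ℕ; zero; suc; _+_; _∸_; _≤_; z≤n; s≤s)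
open import Data.Nat.Properties
  using (≤-refl; ≤-trans; +-comm; +-suc; m≤m+n; m+[n∸m]≡n; m≤m⊔n; m≤n⊔m; n≤1+n; suc-injective)
open import Data.Product.Base using (Σ; ∃; _×_; _,_; proj₁; proj₂)
open import Data.Product.Function.NonDependent.Propositional using (_×-⇔_)
open import Data.Product.Relation.Binary.Pointwise.NonDependent using (_×ₛ_)
open import Data.Sum.Base using (_⊎_; inj₁; inj₂)
open import Data.Unit.Base using (⊤; tt)
open import Function.Base using (_∘_; case_of_; case_returning_of_)
open import Function.Bundles using (Func; _⟨$⟩_; _⇔_; mk⇔; module Equivalence)
open import Function.Construct.Composition using (_⇔-∘_)
open import Function.Construct.Identity using (⇔-id)
open import Level using (0ℓ)
open import Relation.Binary.Bundles using (Setoid)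
open import Relation.Binary.PropositionalEquality
  using (_≡_; refl; cong; cong₂; sym; trans; subst; subst₂)

open Equivalence using (to; from)

private variable
  σ τ : Ty
  σs τs : List Ty
  Γ Δ : Ctx
  l : Lang
  ρ κ υ : ATy
  ρs κs K M M′ : List ATy
  E E′ X : Set

-- Equivalences, environments and renaming

→-⇔ : {A B C D : Set} → A ⇔ B → C ⇔ D → (A → C) ⇔ (B → D)
→-⇔ f g = mk⇔ (λ h → to g ∘ h ∘ from f) (λ h → from g ∘ h ∘ to f)

Π-⇔ : {A : Set} {P Q : A → Set} → (∀ x → P x ⇔ Q x) → (∀ x → P x) ⇔ (∀ x → Q x)
Π-⇔ f = mk⇔ (λ h x → to (f x) (h x)) (λ h x → from (f x) (h x))

Σ-⇔ : {A : Set} {P Q : A → Set} → (∀ x → P x ⇔ Q x) → Σ A P ⇔ Σ A Q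
Σ-⇔ f = mk⇔ (λ (x , p) → x , to (f x) p) (λ (x , q) → x , from (f x) q)

≡⇒⇔ : {A B : Set} → A ≡ B → A ⇔ B
≡⇒⇔ refl = ⇔-id _

-- Renamings and substitutions are functions, but an environment is a tuple. Tabulating them turns
-- pointwise equality into propositional equality without function extensionality.
tab : (∀ {σ} → σ ∈ Γ → ∣ σ ∣) → Env Γ
tab {[]}    f = tt
tab {σ ∷ Γ} f = f (here refl) , tab (λ i → f (there i))

tab-cong : {f g : ∀ {σ} → σ ∈ Γ → ∣ σ ∣} → (∀ {σ} (i : σ ∈ Γ) → f i ≡ g i) →
           tab f ≡ tab g
tab-cong {[]}    e = refl
tab-cong {σ ∷ Γ} e = cong₂ _,_ (e (here refl)) (tab-cong (λ i → e (there i)))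

lookup-tab : (f : ∀ {σ} → σ ∈ Γ → ∣ σ ∣) (i : σ ∈ Γ) → lookupₛ i ⟨$⟩ tab f ≡ f i
lookup-tab f (here refl) = refl
lookup-tab f (there i)   = lookup-tab (λ j → f (there j)) i

tab-lookup : (Γ : Ctx) (η : Env Γ) → tab {Γ} (λ i → lookupₛ i ⟨$⟩ η) ≡ η
tab-lookup []      tt      = refl
tab-lookup (σ ∷ Γ) (x , η) = cong (x ,_) (tab-lookup Γ η)

renEnv : Ren Γ Δ → Env Δ → Env Γ
renEnv r η = tab (λ i → lookupₛ (r i) ⟨$⟩ η)

⟦ren⟧ : (r : Ren Γ Δ) (t : TTm Γ σ) (η : Env Δ) → ⟦ ren r t ⟧ η ≡ ⟦ t ⟧ (renEnv r η)
⟦ren⟧ r (var i) η = sym (lookup-tab (λ j → lookupₛ (r j) ⟨$⟩ η) i)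
⟦ren⟧ r (con c) η = refl
⟦ren⟧ r (s · t) η = cong₂ _⟨$⟩_ (⟦ren⟧ r s η) (⟦ren⟧ r t η)

⟦wk⟧ : ∀ τ (t : TTm Γ σ) (x : ∣ τ ∣) (η : Env Γ) → ⟦ wk {τ = τ} t ⟧ (x , η) ≡ ⟦ t ⟧ η
⟦wk⟧ τ t x η = trans (⟦ren⟧ there t (x , η)) (cong ⟦ t ⟧ (tab-lookup _ η))

-- Majorizability of values

Val : ATy → Set
Val ρ = ∣ ⌊ ρ ⌋ ∣

Vals : List ATy → Set
Vals = All Val

mem : (ρ : ATy) → Val ρ → Val (ρ ⋆) → Set
mem ρ x a = SetoidMembership._∈_ (𝒮 ⌊ ρ ⌋) x (toList a)

syntax mem ρ x a = x ∈[ ρ ] a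

-- The metatheoretic reading of `leᴮ`, free of terms and weakenings; `⊨leᴮ` connects the two.
le : (ρ : ATy) → Val ρ → Val ρ → Set
syntax le ρ x y = x ≤[ ρ ] y

le N       x y = x ≤ y
le (ρ ⇒ κ) f g = ∀ x y → x ≤[ ρ ] y →
                 (f ⟨$⟩ x) ≤[ κ ] (g ⟨$⟩ y) × (g ⟨$⟩ x) ≤[ κ ] (g ⟨$⟩ y)
le (ρ ⋆)   a b = (∀ u → u ∈[ ρ ] a → ∃ λ v → v ∈[ ρ ] b × u ≤[ ρ ] v) ×
                 (∀ v → v ∈[ ρ ] b → v ≤[ ρ ] v)

Mon : (ρ : ATy) → Val ρ → Set
Mon ρ x = x ≤[ ρ ] x

-- The positive witnesses of an interpreted formula are upward closed for this
-- order, not for the majorizability order.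
sq : (ρ : ATy) → Val ρ → Val ρ → Set
syntax sq ρ x y = x ⊑[ ρ ] y

sq N       x y = x ≤ y
sq (ρ ⇒ κ) f g = ∀ x → Mon ρ x → (f ⟨$⟩ x) ⊑[ κ ] (g ⟨$⟩ x)
sq (ρ ⋆)   a b = ∀ u → u ∈[ ρ ] a → u ∈[ ρ ] b

≤-monʳ : ∀ ρ {x y} → x ≤[ ρ ] y → Mon ρ y
≤-monʳ N       x≤y = ≤-refl
≤-monʳ (ρ ⇒ κ) f≤g x y x≤y = proj₂ (f≤g x y x≤y) , proj₂ (f≤g x y x≤y)
≤-monʳ (ρ ⋆)   a≤b = (λ v v∈b → v , v∈b , proj₂ a≤b v v∈b) , proj₂ a≤b

⊑-refl : ∀ ρ {x} → x ⊑[ ρ ] x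
⊑-refl N             = ≤-refl
⊑-refl (ρ ⇒ κ) x _   = ⊑-refl κ
⊑-refl (ρ ⋆)   u u∈a = u∈a

⊑-trans : ∀ ρ {x y z} → x ⊑[ ρ ] y → y ⊑[ ρ ] z → x ⊑[ ρ ] z
⊑-trans N       p q       = ≤-trans p q
⊑-trans (ρ ⇒ κ) p q x m   = ⊑-trans κ (p x m) (q x m)
⊑-trans (ρ ⋆)   p q u u∈a = q u (p u u∈a)

-- ⊑ says nothing about majorization of `z` by itself, so this half has to come from `Mon ρ z`. In
-- `iterᵛ-mono` it absorbs surplus iterations on the right.
≤-⊑-trans : ∀ ρ {x y z} → x ≤[ ρ ] y → y ⊑[ ρ ] z → Mon ρ z → x ≤[ ρ ] z
≤-⊑-trans N       p q _ = ≤-trans p q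
≤-⊑-trans (ρ ⇒ κ) p q m x y x≤y =
  ≤-⊑-trans κ (proj₁ (p x y x≤y)) (q y (≤-monʳ ρ x≤y))
    (proj₁ (m y y (≤-monʳ ρ x≤y))) ,
  proj₁ (m x y x≤y)
≤-⊑-trans (ρ ⋆)   p q m =
  (λ u u∈a → let v , v∈b , u≤v = proj₁ p u u∈a in v , q v v∈b , u≤v) , proj₂ m

data _≤*_ : {ρs : List ATy} → Vals ρs → Vals ρs → Set where
  []  : [] ≤* []
  _∷_ : {x y : Val ρ} {xs ys : Vals ρs} → x ≤[ ρ ] y → xs ≤* ys → _≤*_ {ρ ∷ ρs} (x ∷ xs) (y ∷ ys)

data _⊑*_ : {ρs : List ATy} → Vals ρs → Vals ρs → Set where
  []  : [] ⊑* []
  _∷_ : {x y : Val ρ} {xs ys : Vals ρs} → x ⊑[ ρ ] y → xs ⊑* ys → _⊑*_ {ρ ∷ ρs} (x ∷ xs) (y ∷ ys)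

Sets : List ATy → Set
Sets = All (λ ρ → Val (ρ ⋆))

data _∈*_ : {ρs : List ATy} → Vals ρs → Sets ρs → Set where
  []  : [] ∈* []
  _∷_ : {x : Val ρ} {a : Val (ρ ⋆)} {xs : Vals ρs} {as : Sets ρs} →
        x ∈[ ρ ] a → xs ∈* as → _∈*_ {ρ ∷ ρs} (x ∷ xs) (a ∷ as)

Mon* : Vals ρs → Set
Mon* xs = xs ≤* xs

≤*-monʳ : {xs ys : Vals ρs} → xs ≤* ys → Mon* ys
≤*-monʳ []                    = []
≤*-monʳ (_∷_ {ρ = ρ} p ps) = ≤-monʳ ρ p ∷ ≤*-monʳ ps

≤*-lookup : {xs ys : Vals ρs} → xs ≤* ys → (i : ρ ∈ ρs) → All.lookup xs i ≤[ ρ ] All.lookup ys i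
≤*-lookup (p ∷ ps) (here refl) = p
≤*-lookup (p ∷ ps) (there i)   = ≤*-lookup ps i

⊑*-refl : {xs : Vals ρs} → xs ⊑* xs
⊑*-refl {xs = []}             = []
⊑*-refl {ρ ∷ _} {xs = x ∷ xs} = ⊑-refl ρ ∷ ⊑*-refl

++⁻ˡ-≤* : {xs ys : Vals (ρs ++ κs)} → xs ≤* ys → ++⁻ˡ ρs xs ≤* ++⁻ˡ ρs ys
++⁻ˡ-≤* {[]}     _        = []
++⁻ˡ-≤* {ρ ∷ ρs} (p ∷ ps) = p ∷ ++⁻ˡ-≤* {ρs} ps

++⁻ʳ-≤* : {xs ys : Vals (ρs ++ κs)} → xs ≤* ys → ++⁻ʳ ρs xs ≤* ++⁻ʳ ρs ys
++⁻ʳ-≤* {[]}     ps       = ps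
++⁻ʳ-≤* {ρ ∷ ρs} (p ∷ ps) = ++⁻ʳ-≤* {ρs} ps

++⁻ˡ-⊑* : {xs ys : Vals (ρs ++ κs)} → xs ⊑* ys → ++⁻ˡ ρs xs ⊑* ++⁻ˡ ρs ys
++⁻ˡ-⊑* {[]}     _        = []
++⁻ˡ-⊑* {ρ ∷ ρs} (p ∷ ps) = p ∷ ++⁻ˡ-⊑* {ρs} ps

++⁻ʳ-⊑* : {xs ys : Vals (ρs ++ κs)} → xs ⊑* ys → ++⁻ʳ ρs xs ⊑* ++⁻ʳ ρs ys
++⁻ʳ-⊑* {[]}     ps       = ps
++⁻ʳ-⊑* {ρ ∷ ρs} (p ∷ ps) = ++⁻ʳ-⊑* {ρs} ps

infixl 9 _·ᵛ_

_·ᵛ_ : Val (ρs ⇛ᵃ κ) → Vals ρs → Val κ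
f ·ᵛ []       = f
f ·ᵛ (x ∷ xs) = (f ⟨$⟩ x) ·ᵛ xs

·ᵛ-≤ : {f g : Val (ρs ⇛ᵃ κ)} {xs ys : Vals ρs} →
       f ≤[ ρs ⇛ᵃ κ ] g → xs ≤* ys → (f ·ᵛ xs) ≤[ κ ] (g ·ᵛ ys)
·ᵛ-≤ p []       = p
·ᵛ-≤ p (q ∷ qs) = ·ᵛ-≤ (proj₁ (p _ _ q)) qs

·ᵛ-⊑ : {f g : Val (ρs ⇛ᵃ κ)} {xs : Vals ρs} →
       f ⊑[ ρs ⇛ᵃ κ ] g → Mon* xs → (f ·ᵛ xs) ⊑[ κ ] (g ·ᵛ xs)
·ᵛ-⊑ p []       = p
·ᵛ-⊑ p (q ∷ qs) = ·ᵛ-⊑ (p _ q) qs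

-- Truth of order formulas and of bounded quantifiers in terms of values

simRec-+ : (n x : ℕ) (fs : Env (map (StepTy (N ∷ [])) (N ∷ []))) →
           (∀ k y → (proj₁ fs ⟨$⟩ k) ⟨$⟩ y ≡ suc y) →
           proj₁ (simRec (N ∷ []) n (x , tt) fs) ≡ x + n
simRec-+ zero    x fs h = sym (+-comm x 0)
simRec-+ (suc n) x fs h =
  trans (h n _) (trans (cong suc (simRec-+ n x fs h)) (sym (+-suc x n)))

⊨≤ᵗ : (s t : TTm Γ N) (η : Env Γ) → (η ⊨ s ≤ᵗ t) ⇔ (⟦ s ⟧ η ≤ ⟦ t ⟧ η)
⊨≤ᵗ s t η = mk⇔
  (λ (z , e) → subst (⟦ s ⟧ η ≤_) (trans (sym (sum z)) (trans e (⟦wk⟧ N t z η))) (m≤m+n _ z))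
  (λ p → let z = ⟦ t ⟧ η ∸ ⟦ s ⟧ η in
     z , trans (sum z) (trans (m+[n∸m]≡n p) (sym (⟦wk⟧ N t z η))))
  where
  sum : ∀ z → ⟦ wk s +ᵗ v₀ ⟧ (z , η) ≡ ⟦ s ⟧ η + z
  sum z = trans (simRec-+ z _ _ (λ _ _ → refl)) (cong (_+ z) (⟦wk⟧ N s z η))

⊨leᴮ : (ρ : ATy) (s t : TTm Γ ⌊ ρ ⌋) (η : Env Γ) →
       (η ⊨ leᴮ ρ s t) ⇔ (⟦ s ⟧ η ≤[ ρ ] ⟦ t ⟧ η)
⊨leᴮ N       s t η = ⊨≤ᵗ s t η
⊨leᴮ {Γ} (ρ ⇒ κ) f g η = Π-⇔ λ x → Π-⇔ λ y →
  →-⇔ (⊨leᴮ ρ v₁ v₀ _) (app f x y g ×-⇔ app g x y g)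
  where
  wk² : ∀ {τ} (t : TTm Γ τ) (x y : Val ρ) → ⟦ wk {τ = ⌊ ρ ⌋} (wk {τ = ⌊ ρ ⌋} t) ⟧ (y , x , η) ≡ ⟦ t ⟧ η
  wk² t x y = trans (⟦wk⟧ ⌊ ρ ⌋ (wk t) y _) (⟦wk⟧ ⌊ ρ ⌋ t x η)

  app : (f : TTm Γ ⌊ ρ ⇒ κ ⌋) (x y : Val ρ) (g : TTm Γ ⌊ ρ ⇒ κ ⌋) →
        ((y , x , η) ⊨ leᴮ κ (wk (wk f) · v₁) (wk (wk g) · v₀)) ⇔
        ((⟦ f ⟧ η ⟨$⟩ x) ≤[ κ ] (⟦ g ⟧ η ⟨$⟩ y))
  app f x y g = ≡⇒⇔ (cong₂ (le κ) (cong (_⟨$⟩ x) (wk² f x y)) (cong (_⟨$⟩ y) (wk² g x y)))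
                ⇔-∘ ⊨leᴮ κ (wk (wk f) · v₁) (wk (wk g) · v₀) (y , x , η)
⊨leᴮ (ρ ⋆)   a b η =
  (Π-⇔ λ u → →-⇔ (≡⇒⇔ (cong (mem ρ u) (⟦wk⟧ ⌊ ρ ⌋ a u η)))
    (Σ-⇔ λ v → ≡⇒⇔ (cong (mem ρ v) (trans (⟦wk⟧ ⌊ ρ ⌋ (wk b) v _) (⟦wk⟧ ⌊ ρ ⌋ b u η)))
               ×-⇔ ⊨leᴮ ρ v₁ v₀ _))
  ×-⇔
  (Π-⇔ λ v → →-⇔ (≡⇒⇔ (cong (mem ρ v) (⟦wk⟧ ⌊ ρ ⌋ b v η))) (⊨leᴮ ρ v₀ v₀ _))

push : (Γ : Ctx) → Env Γ → Vals ρs → Env (Γ ▷ ρs)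
push Γ η []                   = η
push Γ η (_∷_ {x = ρ} x xs) = push (⌊ ρ ⌋ ∷ Γ) (x , η) xs

syntax push Γ η xs = η ▷[ Γ ] xs

evs : Tms Γ ρs → Env Γ → Vals ρs
evs ts η = All.map (λ t → ⟦ t ⟧ η) ts

lookup-wk▷ : (i : σ ∈ Γ) (η : Env Γ) (xs : Vals ρs) →
             lookupₛ (wk▷ ρs i) ⟨$⟩ (η ▷[ Γ ] xs) ≡ lookupₛ i ⟨$⟩ η
lookup-wk▷ i η []       = refl
lookup-wk▷ i η (x ∷ xs) = lookup-wk▷ (there i) (x , η) xs

renEnv-wk▷ : (r : Ren Γ Δ) (η : Env Δ) (xs : Vals ρs) →
             renEnv (λ i → wk▷ ρs (r i)) (η ▷[ Δ ] xs) ≡ renEnv r η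
renEnv-wk▷ r η xs = tab-cong (λ i → lookup-wk▷ (r i) η xs)

evs-vars▷ : (η : Env Γ) (xs : Vals ρs) → evs (vars▷ ρs) (η ▷[ Γ ] xs) ≡ xs
evs-vars▷ η []       = refl
evs-vars▷ η (x ∷ xs) = cong₂ _∷_ (lookup-wk▷ (here refl) (x , η) xs) (evs-vars▷ (x , η) xs)

evs-ren : (r : Ren Γ Δ) (ts : Tms Γ ρs) (η : Env Δ) → evs (renTms r ts) η ≡ evs ts (renEnv r η)
evs-ren r []       η = refl
evs-ren r (t ∷ ts) η = cong₂ _∷_ (⟦ren⟧ r t η) (evs-ren r ts η)

evs-wk : ∀ τ (ts : Tms Γ ρs) (x : ∣ τ ∣) (η : Env Γ) → evs (renTms (there {x = τ}) ts) (x , η) ≡ evs ts η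
evs-wk τ ts x η = trans (evs-ren there ts _) (cong (evs ts) (tab-lookup _ η))

evs-wk▷ : (ts : Tms Γ κs) (η : Env Γ) (xs : Vals ρs) →
          evs (renTms (wk▷ ρs) ts) (η ▷[ Γ ] xs) ≡ evs ts η
evs-wk▷ ts η xs =
  trans (evs-ren _ ts _) (cong (evs ts) (trans (renEnv-wk▷ {Γ = _} (λ i → i) η xs) (tab-lookup _ η)))

⊨Monotone* : (ts : Tms Γ ρs) (η : Env Γ) → (η ⊨ Monotone* ts) ⇔ Mon* (evs ts η)
⊨Monotone* []                 η = mk⇔ (λ _ → []) (λ _ ())
⊨Monotone* (_∷_ {x = ρ} t ts) η = mk⇔
  (λ (p , ps) → to (⊨leᴮ ρ t t η) p ∷ to (⊨Monotone* ts η) ps)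
  λ { (p ∷ ps) → from (⊨leᴮ ρ t t η) p , from (⊨Monotone* ts η) ps }

⊨∀mon : (ρs : List ATy) {φ : TForm (Γ ▷ ρs)} (η : Env Γ) →
        (η ⊨ ∀mon ρs φ) ⇔ ((xs : Vals ρs) → Mon* xs → (η ▷[ Γ ] xs) ⊨ φ)
⊨∀mon []       η = mk⇔ (λ { h [] _ → h }) (λ h → h [] [])
⊨∀mon (ρ ∷ ρs) η = mk⇔
  (λ { h (x ∷ xs) (p ∷ ps) → to (⊨∀mon ρs _) (h x (from (⊨leᴮ ρ v₀ v₀ _) p)) xs ps })
  (λ h x p → from (⊨∀mon ρs _) (λ xs ps → h (x ∷ xs) (to (⊨leᴮ ρ v₀ v₀ _) p ∷ ps)))

⊨∀mon∈ : (ρs : List ATy) (ts : Tms Γ (map _⋆ ρs)) {φ : TForm (Γ ▷ ρs)} (η : Env Γ) →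
         (η ⊨ ∀mon∈ ρs ts φ) ⇔
         ((xs : Vals ρs) → Mon* xs → xs ∈* map⁻ (evs ts η) → (η ▷[ Γ ] xs) ⊨ φ)
⊨∀mon∈ []       []       η = mk⇔ (λ { h [] _ _ → h }) (λ h → h [] [] [])
⊨∀mon∈ (ρ ∷ ρs) (t ∷ ts) η = mk⇔
  (λ { h (x ∷ xs) (p ∷ ps) (q ∷ qs) →
    to (⊨∀mon∈ ρs (renTms there ts) _)
       (h x (subst (mem ρ x) (sym (⟦wk⟧ ⌊ ρ ⌋ t x η)) q) (from (⊨leᴮ ρ v₀ v₀ _) p)) xs ps
       (subst (λ ys → xs ∈* map⁻ ys) (sym (evs-wk ⌊ ρ ⌋ ts x η)) qs) })
  (λ h x q p → from (⊨∀mon∈ ρs (renTms there ts) _) λ xs ps qs →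
    h (x ∷ xs) (to (⊨leᴮ ρ v₀ v₀ _) p ∷ ps)
      (subst (mem ρ x) (⟦wk⟧ ⌊ ρ ⌋ t x η) q ∷ subst (λ ys → xs ∈* map⁻ ys) (evs-wk ⌊ ρ ⌋ ts x η) qs))

-- Tuples under mapping, splitting and concatenation

module _ {A : Set} {P Q : A → Set} (f : ∀ {x} → P x → Q x) where

  map-++⁻ˡ : ∀ xs {ys} (ps : All P (xs ++ ys)) → All.map f (++⁻ˡ xs ps) ≡ ++⁻ˡ xs (All.map f ps)
  map-++⁻ˡ []       ps       = refl
  map-++⁻ˡ (x ∷ xs) (p ∷ ps) = cong (f p ∷_) (map-++⁻ˡ xs ps)

  map-++⁻ʳ : ∀ xs {ys} (ps : All P (xs ++ ys)) → All.map f (++⁻ʳ xs ps) ≡ ++⁻ʳ xs (All.map f ps)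
  map-++⁻ʳ []       ps       = refl
  map-++⁻ʳ (x ∷ xs) (p ∷ ps) = map-++⁻ʳ xs ps

  map-++⁺ : ∀ {xs ys} (ps : All P xs) (qs : All P ys) →
            All.map f (++⁺ ps qs) ≡ ++⁺ (All.map f ps) (All.map f qs)
  map-++⁺ []       qs = refl
  map-++⁺ (p ∷ ps) qs = cong (f p ∷_) (map-++⁺ ps qs)

  module _ {B : Set} (g : B → A) where

    map-map⁻ : ∀ {xs} (ps : All P (map g xs)) →
               All.map {Q = Q ∘ g} f (map⁻ {xs = xs} ps) ≡ map⁻ (All.map f ps)
    map-map⁻ {[]}     []       = refl
    map-map⁻ {x ∷ xs} (p ∷ ps) = cong (f p ∷_) (map-map⁻ ps)

    map-map⁺ : ∀ {xs} (ps : All (P ∘ g) xs) →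
               All.map {Q = Q} f (map⁺ {f = g} ps) ≡ map⁺ (All.map f ps)
    map-map⁺ []       = refl
    map-map⁺ (p ∷ ps) = cong (f p ∷_) (map-map⁺ ps)

module _ {A : Set} {P : A → Set} where

  ++⁻ˡ-++⁺ : ∀ {xs ys} (ps : All P xs) (qs : All P ys) → ++⁻ˡ xs (++⁺ ps qs) ≡ ps
  ++⁻ˡ-++⁺ []       qs = refl
  ++⁻ˡ-++⁺ (p ∷ ps) qs = cong (p ∷_) (++⁻ˡ-++⁺ ps qs)

  ++⁻ʳ-++⁺ : ∀ {xs ys} (ps : All P xs) (qs : All P ys) → ++⁻ʳ xs (++⁺ ps qs) ≡ qs
  ++⁻ʳ-++⁺ []       qs = refl
  ++⁻ʳ-++⁺ (p ∷ ps) qs = ++⁻ʳ-++⁺ ps qs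

  map⁻-map⁺ : ∀ {B : Set} {g : B → A} {xs} (ps : All (P ∘ g) xs) →
              map⁻ {P = P} (map⁺ {f = g} ps) ≡ ps
  map⁻-map⁺ []       = refl
  map⁻-map⁺ (p ∷ ps) = cong (p ∷_) (map⁻-map⁺ ps)

  map-map : ∀ {Q R S : A → Set} {f : ∀ {x} → P x → Q x} {g : ∀ {x} → Q x → S x}
            {f′ : ∀ {x} → P x → R x} {g′ : ∀ {x} → R x → S x} →
            (∀ {x} (p : P x) → g (f p) ≡ g′ (f′ p)) →
            ∀ {xs} (ps : All P xs) → All.map {Q = S} g (All.map {Q = Q} f ps) ≡
                                     All.map g′ (All.map {Q = R} f′ ps)
  map-map h []       = refl
  map-map h (p ∷ ps) = cong₂ _∷_ (h p) (map-map h ps)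

⟦·ᵃ⟧ : (t : TTm Γ ⌊ ρs ⇛ᵃ κ ⌋) (as : Tms Γ ρs) (η : Env Γ) →
       ⟦ t ·ᵃ as ⟧ η ≡ ⟦ t ⟧ η ·ᵛ evs as η
⟦·ᵃ⟧ t []       η = refl
⟦·ᵃ⟧ t (a ∷ as) η = ⟦·ᵃ⟧ (t · a) as η

-- Majorizability upon bounding

SMaj : Ty → Maybe ATy → Set₁
SMaj σ m = ∣ σ ∣ → Vals (posᵐᵇ m) → Set

-- With arbitrary `m` and `n` in place of `p †` and `q †`, the distinction between bounded and
-- unbounded types is an ordinary pattern match. The lemmas on `smaj⇒` below have the same form.
smaj⇒ : ∀ σ τ (m n : Maybe ATy) → SMaj σ m → SMaj τ n → SMaj (σ ⇒ τ) (m ⇒† n)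
smaj⇒ σ τ nothing  nothing  _ _ _ _ = ⊤
smaj⇒ σ τ (just α) nothing  _ _ _ _ = ⊤
smaj⇒ σ τ nothing  (just β) _ S f (c ∷ []) = (∀ x → S (f ⟨$⟩ x) (c ∷ [])) × Mon β c
smaj⇒ σ τ (just α) (just β) R S f (g ∷ []) =
  (∀ (x : ∣ σ ∣) (a : Val α) → R x (a ∷ []) → S (f ⟨$⟩ x) ((g ⟨$⟩ a) ∷ [])) ×
  (∀ (z a : Val α) → z ≤[ α ] a → (g ⟨$⟩ z) ≤[ β ] (g ⟨$⟩ a))

smaj : (p : Finite σ) → SMaj σ (p †)
smaj N x (a ∷ []) = x ≤ a
smaj B _ _        = ⊤
smaj (_⇒_ {σ} {τ} p q) = smaj⇒ σ τ (p †) (q †) (smaj p) (smaj q)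

Agrees : (σ : Ty) (m : Maybe ATy) → Maj σ m → SMaj σ m → Set
Agrees σ m R S = ∀ {Γ} (t : TTm Γ σ) (as : Tms Γ (posᵐᵇ m)) (η : Env Γ) →
                 (η ⊨ ⟨𝓘ᵐᵇ⟩ m R t as) ⇔ S (⟦ t ⟧ η) (evs as η)

agrees-maj⇒ : ∀ σ τ (m n : Maybe ATy) (R : Maj σ m) (R′ : Maj τ n) (S : SMaj σ m) (S′ : SMaj τ n) →
              Agrees σ m R S → Agrees τ n R′ S′ →
              Agrees (σ ⇒ τ) (m ⇒† n) (maj⇒ {σ} {τ} m n R R′) (smaj⇒ σ τ m n S S′)
agrees-maj⇒ σ τ nothing  nothing  _ _ _ _ _ _ _ _ _ = mk⇔ (λ _ → tt) (λ _ ())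
agrees-maj⇒ σ τ (just α) nothing  _ _ _ _ _ _ _ _ _ = mk⇔ (λ _ → tt) (λ _ ())
agrees-maj⇒ σ τ nothing  (just β) _ R′ _ S′ _ h′ f (c ∷ []) η =
  (Π-⇔ λ x → ≡⇒⇔ (cong₂ (λ f′ c′ → S′ (f′ ⟨$⟩ x) (c′ ∷ [])) (⟦wk⟧ σ f x η) (⟦wk⟧ σ c x η))
             ⇔-∘ h′ (wk f · v₀) (wk c ∷ []) (x , η))
  ×-⇔ ⊨leᴮ β c c η
agrees-maj⇒ σ τ (just α) (just β) R R′ S S′ h h′ {Γ} f (g ∷ []) η =
  (Π-⇔ λ x → Π-⇔ λ a → →-⇔ (h v₁ (v₀ ∷ []) (a , x , η))
    (≡⇒⇔ (cong₂ (λ f′ g′ → S′ (f′ ⟨$⟩ x) ((g′ ⟨$⟩ a) ∷ []))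
           (trans (⟦wk⟧ ⌊ α ⌋ (wk f) a (x , η)) (⟦wk⟧ σ f x η))
           (trans (⟦wk⟧ ⌊ α ⌋ (wk g) a (x , η)) (⟦wk⟧ σ g x η)))
     ⇔-∘ h′ (wk (wk f) · v₁) (wk (wk g) · v₀ ∷ []) (a , x , η)))
  ×-⇔
  (Π-⇔ λ z → Π-⇔ λ a → →-⇔ (⊨leᴮ α v₁ v₀ (a , z , η))
    (≡⇒⇔ (cong₂ (λ g′ g″ → (g′ ⟨$⟩ z) ≤[ β ] (g″ ⟨$⟩ a)) (wk² z a) (wk² z a))
     ⇔-∘ ⊨leᴮ β (wk (wk g) · v₁) (wk (wk g) · v₀) (a , z , η)))
  where
  wk² : (z a : Val α) → ⟦ wk {τ = ⌊ α ⌋} (wk {τ = ⌊ α ⌋} g) ⟧ (a , z , η) ≡ ⟦ g ⟧ η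
  wk² z a = trans (⟦wk⟧ ⌊ α ⌋ (wk g) a (z , η)) (⟦wk⟧ ⌊ α ⌋ g z η)

⊨𝓘 : (p : Finite σ) → Agrees σ (p †) (maj p) (smaj p)
⊨𝓘 N s (t ∷ []) η = ⊨≤ᵗ s t η
⊨𝓘 B s []       η = mk⇔ (λ _ → tt) (λ _ ())
⊨𝓘 (_⇒_ {σ} {τ} p q) {Γ} =
  agrees-maj⇒ σ τ (p †) (q †) (maj p) (maj q) (smaj p) (smaj q) (⊨𝓘 p) (⊨𝓘 q) {Γ}

smaj-cong : (p : Finite σ) {x y : ∣ σ ∣} {as : Vals (posᵐᵇ (p †))} →
            Setoid._≈_ (𝒮 σ) x y → smaj p x as → smaj p y as
smaj-mon : (p : Finite σ) {x : ∣ σ ∣} {a : Vals (posᵐᵇ (p †))} → smaj p x a → Mon* a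
-- The case of `𝓘` in `upward`. At function types the first clause moves along ⊑ at majorants of
-- arguments, which are monotone by `smaj-mon`; the monotonicity clause is read off from `Mon* b`.
smaj-⊑ : (p : Finite σ) {x : ∣ σ ∣} {a b : Vals (posᵐᵇ (p †))} →
         smaj p x a → a ⊑* b → Mon* b → smaj p x b

smaj⇒-cong : ∀ σ τ (m n : Maybe ATy) (R : SMaj σ m) (S : SMaj τ n) →
             (∀ x y as → Setoid._≈_ (𝒮 τ) x y → S x as → S y as) →
             ∀ f g as → Setoid._≈_ (𝒮 (σ ⇒ τ)) f g →
             smaj⇒ σ τ m n R S f as → smaj⇒ σ τ m n R S g as
smaj⇒-mon : ∀ σ τ (m n : Maybe ATy) (R : SMaj σ m) (S : SMaj τ n) →
            ∀ f a → smaj⇒ σ τ m n R S f a → Mon* a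
smaj⇒-⊑ : ∀ σ τ (m n : Maybe ATy) (R : SMaj σ m) (S : SMaj τ n) →
          (∀ x a → R x a → Mon* a) →
          (∀ x a b → S x a → a ⊑* b → Mon* b → S x b) →
          ∀ f a b → smaj⇒ σ τ m n R S f a → a ⊑* b → Mon* b → smaj⇒ σ τ m n R S f b

smaj⇒-cong σ τ nothing  nothing  R S h f g as e _ = tt
smaj⇒-cong σ τ (just α) nothing  R S h f g as e _ = tt
smaj⇒-cong σ τ nothing  (just β) R S h f g (c ∷ []) e (p , q) =
  (λ x → h (f ⟨$⟩ x) (g ⟨$⟩ x) (c ∷ []) (e x) (p x)) , q
smaj⇒-cong σ τ (just α) (just β) R S h f g (c ∷ []) e (p , q) =
  (λ x a r → h (f ⟨$⟩ x) (g ⟨$⟩ x) ((c ⟨$⟩ a) ∷ []) (e x) (p x a r)) , q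

smaj⇒-mon σ τ nothing  nothing  R S f []      _       = []
smaj⇒-mon σ τ (just α) nothing  R S f []      _       = []
smaj⇒-mon σ τ nothing  (just β) R S f (c ∷ []) (_ , q) = q ∷ []
smaj⇒-mon σ τ (just α) (just β) R S f (c ∷ []) (_ , q) = (λ x y x≤y → q x y x≤y , q x y x≤y) ∷ []

smaj⇒-⊑ σ τ nothing  nothing  R S r h f a b _ _ _ = tt
smaj⇒-⊑ σ τ (just α) nothing  R S r h f a b _ _ _ = tt
smaj⇒-⊑ σ τ nothing  (just β) R S r h f (a ∷ []) (b ∷ []) (p , _) (s ∷ []) (m ∷ []) =
  (λ x → h (f ⟨$⟩ x) (a ∷ []) (b ∷ []) (p x) (s ∷ []) (m ∷ [])) , m
smaj⇒-⊑ σ τ (just α) (just β) R S r h f (a ∷ []) (b ∷ []) (p , _) (s ∷ []) (m ∷ []) =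
  (λ x c q → case r x (c ∷ []) q of λ { (n ∷ []) →
    h (f ⟨$⟩ x) ((a ⟨$⟩ c) ∷ []) ((b ⟨$⟩ c) ∷ []) (p x c q) (s c n ∷ []) (proj₁ (m c c n) ∷ []) }) ,
  λ z c z≤c → proj₁ (m z c z≤c)

smaj-cong N       refl h = h
smaj-cong B       _    _ = tt
smaj-cong (_⇒_ {σ} {τ} p q) {f} {g} {as} =
  smaj⇒-cong σ τ (p †) (q †) (smaj p) (smaj q) (λ x y a → smaj-cong q {x} {y} {a}) f g as

smaj-mon N {a = _ ∷ []} _ = ≤-refl ∷ []
smaj-mon B {a = []} _     = []
smaj-mon (_⇒_ {σ} {τ} p q) {f} {a}  = smaj⇒-mon σ τ (p †) (q †) (smaj p) (smaj q) f a

smaj-⊑ N {a = _ ∷ []} h (s ∷ []) _ = ≤-trans h s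
smaj-⊑ B       _ _ _ = tt
smaj-⊑ (_⇒_ {σ} {τ} p q) {f} {a} {b} =
  smaj⇒-⊑ σ τ (p †) (q †) (smaj p) (smaj q)
    (λ x a → smaj-mon p {x} {a}) (λ x a b → smaj-⊑ q {x} {a} {b}) f a b

-- Interpretations as families of relations between values

record Int (E : Set) : Set₁ where
  constructor int
  field
    P Q   : List ATy
    holds : E → Vals P → Vals Q → Set

open Int public

-- The semantic counterpart of substitution, as `form-sub` shows. This is why the parameters range
-- over an arbitrary set `E` and not only over environments.
reindex : (E′ → E) → Int E → Int E′
reindex f I = int (P I) (Q I) (holds I ∘ f)

atom : (E → Set) → Int E
atom φ = int [] [] (λ e _ _ → φ e)

𝓘ᴵ : (p : Finite σ) → (E → ∣ σ ∣) → Int E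
𝓘ᴵ p x = int (posᵐᵇ (p †)) [] (λ e a _ → smaj p (x e) a)

infixr 5 _∧ᴵ_
infixr 4 _⟶ᴵ_

_∧ᴵ_ : Int E → Int E → Int E
I ∧ᴵ J = int (P I ++ P J) (Q I ++ Q J) λ e ac bd →
  holds I e (++⁻ˡ (P I) ac) (++⁻ˡ (Q I) bd) × holds J e (++⁻ʳ (P I) ac) (++⁻ʳ (Q I) bd)

module _ (ρs κs ρs′ κs′ : List ATy) where

  ⟶-pos : List ATy
  ⟶-pos = map (ρs ⇛ᵃ_) ρs′ ++ map (λ ρ → ρs ⇛ᵃ (κs′ ⇛ᵃ (ρ ⋆))) κs

  apply : Vals ⟶-pos → Vals ρs → Vals ρs′
  apply fg a = All.map (_·ᵛ a) (map⁻ (++⁻ˡ (map (ρs ⇛ᵃ_) ρs′) fg))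

  counter : Vals ⟶-pos → Vals ρs → Vals κs′ → Sets κs
  counter fg a d = All.map (λ g → g ·ᵛ a ·ᵛ d) (map⁻ (++⁻ʳ (map (ρs ⇛ᵃ_) ρs′) fg))

∀∈* : Sets ρs → (Vals ρs → Set) → Set
∀∈* bs φ = ∀ b → Mon* b → b ∈* bs → φ b

_⟶ᴵ_ : Int E → Int E → Int E
I ⟶ᴵ J = int (⟶-pos (P I) (Q I) (P J) (Q J)) (P I ++ Q J) λ e fg ad →
  ∀∈* (counter (P I) (Q I) (P J) (Q J) fg (++⁻ˡ (P I) ad) (++⁻ʳ (P I) ad))
      (holds I e (++⁻ˡ (P I) ad)) →
  holds J e (apply (P I) (Q I) (P J) (Q J) fg (++⁻ˡ (P I) ad)) (++⁻ʳ (P I) ad)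

∀ᴵ : {X : Set} → Int (X × E) → Int E
∀ᴵ I = int (P I) (Q I) (λ e a b → ∀ x → holds I (x , e) a b)

∃ᴵ : {X : Set} → Int (X × E) → Int E
∃ᴵ I = int (P I) (map _⋆ (Q I)) (λ e a b → ∃ λ x → ∀∈* (map⁻ b) (holds I (x , e) a))

-- Each clause is `holds` of the corresponding operation on `Int`, so `form` commutes definitionally
-- with the connectives and quantifiers.
⟪_⟫ : (A : Form l Γ) → Env Γ → Vals (pos 𝓘ᵐᵇ A) → Vals (neg 𝓘ᵐᵇ A) → Set

form : Form l Γ → Int (Env Γ)
form A = int (pos 𝓘ᵐᵇ A) (neg 𝓘ᵐᵇ A) ⟪ A ⟫

⟪ _≐_ {σ = σ} s t ⟫ = holds (atom λ η → Setoid._≈_ (𝒮 σ) (⟦ embed s ⟧ η) (⟦ embed t ⟧ η))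
⟪ 𝓘 p t ⟫  = holds (𝓘ᴵ p ⟦ embed t ⟧)
⟪ ⊥ᶠ ⟫     = holds (atom λ _ → ⊥)
⟪ A ∧ C ⟫  = holds (form A ∧ᴵ form C)
⟪ A ⟶ C ⟫  = holds (form A ⟶ᴵ form C)
⟪ ∀ᶠ p A ⟫ = holds (∀ᴵ (form A))
⟪ ∃ᶠ p A ⟫ = holds (∃ᴵ (form A))

-- Agreement of the formal interpretation with the semantic one

cong₃ : {A B C : Set} {D : Set₁} (f : A → B → C → D) {a a′ : A} {b b′ : B} {c c′ : C} →
        a ≡ a′ → b ≡ b′ → c ≡ c′ → f a b c ≡ f a′ b′ c′
cong₃ f refl refl refl = refl

-- Reduces the task to values: witnesses are checked against `⟪_⟫` from here on, and formulas of the
-- target language return only in `interpretable`. The renaming is general because `⟨_⟩` accumulates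
-- weakenings under binders.
⊨⟨⟩ : (A : Form l Γ) (r : Ren Γ Δ) (a : Tms Δ (pos 𝓘ᵐᵇ A)) (b : Tms Δ (neg 𝓘ᵐᵇ A)) (η : Env Δ) →
      (η ⊨ ⟨_⟩ 𝓘ᵐᵇ A r a b) ⇔ ⟪ A ⟫ (renEnv r η) (evs a η) (evs b η)

-- The same bounded quantifier occurs in the premise of an implication and below ∃, so both cases of
-- `⊨⟨⟩` share this step. Pushing `b` cancels the weakenings by `wk▷`.
⊨∀mon∈⟨⟩ : (A : Form l Γ) (r : Ren Γ Δ) (a : Tms Δ (pos 𝓘ᵐᵇ A))
           (bs : Tms Δ (map _⋆ (neg 𝓘ᵐᵇ A))) (η : Env Δ) →
           (η ⊨ ∀mon∈ (neg 𝓘ᵐᵇ A) bs (⟨_⟩ 𝓘ᵐᵇ A (λ i → wk▷ (neg 𝓘ᵐᵇ A) (r i))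
             (renTms (wk▷ (neg 𝓘ᵐᵇ A)) a) (vars▷ (neg 𝓘ᵐᵇ A)))) ⇔
           ∀∈* (map⁻ (evs bs η)) (⟪ A ⟫ (renEnv r η) (evs a η))
⊨∀mon∈⟨⟩ {Δ = Δ} A r a bs η = mk⇔
  (λ h b m i → to (inner b) (to (⊨∀mon∈ (neg 𝓘ᵐᵇ A) bs η) h b m i))
  (λ h → from (⊨∀mon∈ (neg 𝓘ᵐᵇ A) bs η) λ b m i → from (inner b) (h b m i))
  where
  inner : (b : Vals (neg 𝓘ᵐᵇ A)) → _ ⇔ ⟪ A ⟫ (renEnv r η) (evs a η) b
  inner b = ≡⇒⇔ (cong₃ ⟪ A ⟫ (renEnv-wk▷ r η b) (evs-wk▷ a η b) (evs-vars▷ η b))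
            ⇔-∘ ⊨⟨⟩ A (λ i → wk▷ (neg 𝓘ᵐᵇ A) (r i)) _ _ (push Δ η b)

⊨⟨⟩ (_≐_ {σ = σ} s t) r a b η = ≡⇒⇔ (cong₂ (Setoid._≈_ (𝒮 σ)) (⟦ren⟧ r (embed s) η) (⟦ren⟧ r (embed t) η))
⊨⟨⟩ (𝓘 p t) r a b η = ≡⇒⇔ (cong (λ x → smaj p x (evs a η)) (⟦ren⟧ r (embed t) η)) ⇔-∘ ⊨𝓘 p _ a η
⊨⟨⟩ ⊥ᶠ r a b η = ⇔-id _
⊨⟨⟩ (A ∧ C) r ac bd η =
  (≡⇒⇔ (cong₂ (⟪ A ⟫ _) (map-++⁻ˡ _ (pos 𝓘ᵐᵇ A) ac) (map-++⁻ˡ _ (neg 𝓘ᵐᵇ A) bd))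
   ⇔-∘ ⊨⟨⟩ A r _ _ η)
  ×-⇔
  (≡⇒⇔ (cong₂ (⟪ C ⟫ _) (map-++⁻ʳ _ (pos 𝓘ᵐᵇ A) ac) (map-++⁻ʳ _ (neg 𝓘ᵐᵇ A) bd))
   ⇔-∘ ⊨⟨⟩ C r _ _ η)
⊨⟨⟩ {Δ = Δ} (A ⟶ C) r fg ad η = →-⇔
  (≡⇒⇔ (cong₂ (λ bs a → ∀∈* bs (⟪ A ⟫ _ a)) g-eq a-eq) ⇔-∘ ⊨∀mon∈⟨⟩ A r a _ η)
  (≡⇒⇔ (cong₂ (⟪ C ⟫ _) f-eq d-eq) ⇔-∘ ⊨⟨⟩ C r _ _ η)
  where
  P₁ = pos 𝓘ᵐᵇ A
  Q₁ = neg 𝓘ᵐᵇ A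
  P₂ = pos 𝓘ᵐᵇ C
  Q₂ = neg 𝓘ᵐᵇ C

  a : Tms Δ P₁
  a = ++⁻ˡ P₁ ad

  d : Tms Δ Q₂
  d = ++⁻ʳ P₁ ad

  ev : ∀ {ρ} → TTm Δ ⌊ ρ ⌋ → Val ρ
  ev t = ⟦ t ⟧ η

  a-eq : evs a η ≡ ++⁻ˡ P₁ (evs ad η)
  a-eq = map-++⁻ˡ ev P₁ ad

  d-eq : evs d η ≡ ++⁻ʳ P₁ (evs ad η)
  d-eq = map-++⁻ʳ ev P₁ ad

  fs : All (λ κ → TTm Δ ⌊ P₁ ⇛ᵃ κ ⌋) P₂
  fs = map⁻ (++⁻ˡ (map (P₁ ⇛ᵃ_) P₂) fg)

  gs : All (λ ρ → TTm Δ ⌊ P₁ ⇛ᵃ (Q₂ ⇛ᵃ ρ ⋆) ⌋) Q₁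
  gs = map⁻ (++⁻ʳ (map (P₁ ⇛ᵃ_) P₂) fg)

  f-eq : evs (All.map (_·ᵃ a) fs) η ≡ apply P₁ Q₁ P₂ Q₂ (evs fg η) (++⁻ˡ P₁ (evs ad η))
  f-eq = trans
    (map-map {Q = λ κ → TTm Δ ⌊ κ ⌋} {R = λ κ → Val (P₁ ⇛ᵃ κ)} {S = Val} {f = _·ᵃ a} {g = ev}
      {f′ = λ f → ⟦ f ⟧ η} {g′ = _·ᵛ ++⁻ˡ P₁ (evs ad η)}
      (λ {κ} f → trans (⟦·ᵃ⟧ {κ = κ} f a η) (cong (⟦ f ⟧ η ·ᵛ_) a-eq)) fs)
    (cong (All.map (_·ᵛ ++⁻ˡ P₁ (evs ad η)))
      (trans (map-map⁻ ev (P₁ ⇛ᵃ_) (++⁻ˡ (map (P₁ ⇛ᵃ_) P₂) fg))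
             (cong map⁻ (map-++⁻ˡ ev (map (P₁ ⇛ᵃ_) P₂) fg))))

  g-eq : map⁻ {xs = Q₁} (evs (map⁺ (All.map (λ g → g ·ᵃ a ·ᵃ d) gs)) η) ≡
         counter P₁ Q₁ P₂ Q₂ (evs fg η) (++⁻ˡ P₁ (evs ad η)) (++⁻ʳ P₁ (evs ad η))
  g-eq = trans
    (trans (cong map⁻ (map-map⁺ ev _⋆ (All.map (λ g → g ·ᵃ a ·ᵃ d) gs)))
           (map⁻-map⁺ _))
    (trans
      (map-map {Q = λ κ → TTm Δ ⌊ κ ⋆ ⌋} {R = λ κ → Val (P₁ ⇛ᵃ (Q₂ ⇛ᵃ κ ⋆))} {S = λ κ → Val (κ ⋆)}
        {f = λ g → g ·ᵃ a ·ᵃ d} {g = λ t → ⟦ t ⟧ η}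
        {f′ = λ f → ⟦ f ⟧ η} {g′ = λ g → g ·ᵛ ++⁻ˡ P₁ (evs ad η) ·ᵛ ++⁻ʳ P₁ (evs ad η)}
        (λ {κ} g → trans (⟦·ᵃ⟧ {κ = κ ⋆} (g ·ᵃ a) d η)
           (cong₂ _·ᵛ_ (trans (⟦·ᵃ⟧ {κ = Q₂ ⇛ᵃ κ ⋆} g a η) (cong (⟦ g ⟧ η ·ᵛ_) a-eq)) d-eq)) gs)
      (cong (All.map (λ g → g ·ᵛ ++⁻ˡ P₁ (evs ad η) ·ᵛ ++⁻ʳ P₁ (evs ad η)))
        (trans (map-map⁻ ev _ (++⁻ʳ (map (P₁ ⇛ᵃ_) P₂) fg))
               (cong map⁻ (map-++⁻ʳ ev (map (P₁ ⇛ᵃ_) P₂) fg)))))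
⊨⟨⟩ (∀ᶠ {σ} p A) r a b η = Π-⇔ λ x →
  ≡⇒⇔ (cong₃ ⟪ A ⟫ (cong (_, renEnv r η) refl) (evs-wk σ a x η) (evs-wk σ b x η))
  ⇔-∘ ⊨⟨⟩ A (lift r) _ _ (x , η)
⊨⟨⟩ (∃ᶠ {σ} p A) r a b η = Σ-⇔ λ x →
  ≡⇒⇔ (cong₂ (λ bs a → ∀∈* (map⁻ bs) (⟪ A ⟫ _ a)) (evs-wk σ b x η) (evs-wk σ a x η))
  ⇔-∘ ⊨∀mon∈⟨⟩ A (lift r) _ _ (x , η)

-- Upward closure in the positive witnesses

·ᵛ*-≤ : ∀ ρs κs {fs gs : Vals (map (ρs ⇛ᵃ_) κs)} {as bs : Vals ρs} → fs ≤* gs → as ≤* bs →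
        All.map (_·ᵛ as) (map⁻ {xs = κs} fs) ≤* All.map (_·ᵛ bs) (map⁻ gs)
·ᵛ*-≤ ρs []       []       q = []
·ᵛ*-≤ ρs (κ ∷ κs) (p ∷ ps) q = ·ᵛ-≤ p q ∷ ·ᵛ*-≤ ρs κs ps q

·ᵛ*-⊑ : ∀ ρs κs {fs gs : Vals (map (ρs ⇛ᵃ_) κs)} {as : Vals ρs} → fs ⊑* gs → Mon* as →
        All.map (_·ᵛ as) (map⁻ {xs = κs} fs) ⊑* All.map (_·ᵛ as) (map⁻ gs)
·ᵛ*-⊑ ρs []       []       q = []
·ᵛ*-⊑ ρs (κ ∷ κs) (p ∷ ps) q = ·ᵛ-⊑ p q ∷ ·ᵛ*-⊑ ρs κs ps q

-- At type `κ ⋆` the order ⊑ is inclusion, so larger counterwitness functions yield larger sets.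
·ᵛ*-∈ : ∀ ρs κs′ κs {fs gs : Vals (map (λ κ → ρs ⇛ᵃ (κs′ ⇛ᵃ κ ⋆)) κs)} {as : Vals ρs} {ds : Vals κs′}
        {bs : Vals κs} → fs ⊑* gs → Mon* as → Mon* ds →
        bs ∈* All.map (λ g → g ·ᵛ as ·ᵛ ds) (map⁻ {xs = κs} fs) →
        bs ∈* All.map (λ g → g ·ᵛ as ·ᵛ ds) (map⁻ gs)
·ᵛ*-∈ ρs κs′ []       []       q r []       = []
·ᵛ*-∈ ρs κs′ (κ ∷ κs) (p ∷ ps) q r (i ∷ is) =
  ·ᵛ-⊑ {κ = κ ⋆} (·ᵛ-⊑ p q) r _ i ∷ ·ᵛ*-∈ ρs κs′ κs ps q r is

Upward : Int E → Set
Upward I = ∀ e a a′ b → Mon* a → Mon* a′ → Mon* b → a ⊑* a′ → holds I e a b → holds I e a′ b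

-- Larger counterwitness sets make the premise stronger, so the premise for `a′` yields the one for
-- `a`. The conclusion obtained with `a` is then carried to the larger witnesses of `J` by
-- `Upward J`.
⟶-upward : (I J : Int E) → Upward J → Upward (I ⟶ᴵ J)
⟶-upward I J up e a a′ b m m′ n s h g =
  up e _ _ _
    (·ᵛ*-≤ (P I) (P J) (++⁻ˡ-≤* {map (P I ⇛ᵃ_) (P J)} m) n₁)
    (·ᵛ*-≤ (P I) (P J) (++⁻ˡ-≤* {map (P I ⇛ᵃ_) (P J)} m′) n₁)
    n₂
    (·ᵛ*-⊑ (P I) (P J) (++⁻ˡ-⊑* {map (P I ⇛ᵃ_) (P J)} s) n₁)
    (h λ b k i → g b k (·ᵛ*-∈ (P I) (Q J) (Q I) (++⁻ʳ-⊑* {map (P I ⇛ᵃ_) (P J)} s) n₁ n₂ i))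
  where
  n₁ = ++⁻ˡ-≤* {P I} n
  n₂ = ++⁻ʳ-≤* {P I} n


upward : (A : Form l Γ) → Upward (form A)
upward (s ≐ t)  _ _ _ _ _ _ _ _ h = h
upward (𝓘 p t)  _ _ _ _ _ m′ _ s h = smaj-⊑ p h s m′
upward ⊥ᶠ       _ _ _ _ _ _ _ _ h = h
upward (A ∧ C)  e a a′ b m m′ n s (h , k) =
  upward A e _ _ _ (++⁻ˡ-≤* {pos 𝓘ᵐᵇ A} m) (++⁻ˡ-≤* {pos 𝓘ᵐᵇ A} m′) (++⁻ˡ-≤* {neg 𝓘ᵐᵇ A} n)
    (++⁻ˡ-⊑* {pos 𝓘ᵐᵇ A} s) h ,
  upward C e _ _ _ (++⁻ʳ-≤* {pos 𝓘ᵐᵇ A} m) (++⁻ʳ-≤* {pos 𝓘ᵐᵇ A} m′) (++⁻ʳ-≤* {neg 𝓘ᵐᵇ A} n)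
    (++⁻ʳ-⊑* {pos 𝓘ᵐᵇ A} s) k
upward (A ⟶ C)  = ⟶-upward (form A) (form C) (upward C)
upward (∀ᶠ p A) e a a′ b m m′ n s h x = upward A (x , e) a a′ b m m′ n s (h x)
upward (∃ᶠ p A) e a a′ b m m′ n s (x , h) =
  x , λ c k i → upward A (x , e) a a′ c m m′ k s (h c k i)

-- Invariance under equality, and equivalence of interpretations

⟦⟧-cong : (t : TTm Γ σ) {η θ : Env Γ} → Setoid._≈_ (𝒮* Γ) η θ →
          Setoid._≈_ (𝒮 σ) (⟦ t ⟧ η) (⟦ t ⟧ θ)
⟦⟧-cong (var i) e = Func.cong (lookupₛ i) e
⟦⟧-cong {σ = σ} (con c) e = Setoid.refl (𝒮 σ)
⟦⟧-cong (_·_ {σ} {τ} s t) {η} {θ} e =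
  app-cong {𝒮 σ} {𝒮 τ} {⟦ s ⟧ η} {⟦ s ⟧ θ} {⟦ t ⟧ η} {⟦ t ⟧ θ} (⟦⟧-cong s e) (⟦⟧-cong t e)

-- The semantic content of `≐-subst`: the relation respects the setoid equality of the parameters
-- while the witnesses stay fixed. In the premise of an implication the equality is used backwards.
⟪⟫-cong : (A : Form l Γ) {η θ : Env Γ} {a : Vals (pos 𝓘ᵐᵇ A)} {b : Vals (neg 𝓘ᵐᵇ A)} →
          Setoid._≈_ (𝒮* Γ) η θ → ⟪ A ⟫ η a b → ⟪ A ⟫ θ a b
⟪⟫-cong {Γ = Γ} (_≐_ {σ = σ} s t) {η} {θ} e h = Setoid.trans (𝒮 σ)
  (⟦⟧-cong (embed s) {θ} {η} (Setoid.sym (𝒮* Γ) {η} {θ} e))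
  (Setoid.trans (𝒮 σ) h (⟦⟧-cong (embed t) {η} {θ} e))
⟪⟫-cong (𝓘 p t)  {η} {θ} e h = smaj-cong p (⟦⟧-cong (embed t) {η} {θ} e) h
⟪⟫-cong ⊥ᶠ       e h = h
⟪⟫-cong (A ∧ C)  {η} {θ} e (h , k) = ⟪⟫-cong A {η} {θ} e h , ⟪⟫-cong C {η} {θ} e k
⟪⟫-cong {Γ = Γ} (A ⟶ C) {η} {θ} e h g =
  ⟪⟫-cong C {η} {θ} e (h λ b m i → ⟪⟫-cong A {θ} {η} (Setoid.sym (𝒮* Γ) {η} {θ} e) (g b m i))
⟪⟫-cong (∀ᶠ {σ} p A) {η} {θ} e h x = ⟪⟫-cong A {x , η} {x , θ} (Setoid.refl (𝒮 σ) , e) (h x)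
⟪⟫-cong (∃ᶠ {σ} p A) {η} {θ} e (x , h) =
  x , λ b m i → ⟪⟫-cong A {x , η} {x , θ} (Setoid.refl (𝒮 σ) , e) (h b m i)

-- Both sides share the lists of witness types. Matching on `mk≃` identifies these lists, so
-- realizers pass along ≃ unchanged, without transport.
data _≃_ {E : Set} : Int E → Int E → Set₁ where
  mk≃ : ∀ {ps qs} {R R′ : E → Vals ps → Vals qs → Set} →
        (∀ e a b → R e a b ⇔ R′ e a b) → int ps qs R ≃ int ps qs R′

≃-refl : {I : Int E} → I ≃ I
≃-refl = mk≃ λ _ _ _ → ⇔-id _

≃-trans : {I J K : Int E} → I ≃ J → J ≃ K → I ≃ K
≃-trans (mk≃ f) (mk≃ g) = mk≃ λ e a b → g e a b ⇔-∘ f e a b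

∧-≃ : {I I′ J J′ : Int E} → I ≃ I′ → J ≃ J′ → (I ∧ᴵ J) ≃ (I′ ∧ᴵ J′)
∧-≃ (mk≃ f) (mk≃ g) = mk≃ λ e a b → f e _ _ ×-⇔ g e _ _

⟶-≃ : {I I′ J J′ : Int E} → I ≃ I′ → J ≃ J′ → (I ⟶ᴵ J) ≃ (I′ ⟶ᴵ J′)
⟶-≃ (mk≃ f) (mk≃ g) = mk≃ λ e a b →
  →-⇔ (Π-⇔ λ c → Π-⇔ λ m → Π-⇔ λ i → f e _ c) (g e _ _)

∀-≃ : {X : Set} {I J : Int (X × E)} → I ≃ J → ∀ᴵ I ≃ ∀ᴵ J
∀-≃ (mk≃ f) = mk≃ λ e a b → Π-⇔ λ x → f (x , e) a b

∃-≃ : {X : Set} {I J : Int (X × E)} → I ≃ J → ∃ᴵ I ≃ ∃ᴵ J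
∃-≃ (mk≃ f) = mk≃ λ e a b → Σ-⇔ λ x → Π-⇔ λ c → Π-⇔ λ m → Π-⇔ λ i → f (x , e) a c

reindex-≃ : (I : Int E) {f g : E′ → E} → (∀ e → f e ≡ g e) → reindex f I ≃ reindex g I
reindex-≃ I h = mk≃ λ e a b → ≡⇒⇔ (cong (λ e′ → holds I e′ a b) (h e))

-- Substitution

subEnv : Sub HAConst Γ Δ → Env Δ → Env Γ
subEnv s η = tab (λ i → ⟦ embed (s i) ⟧ η)

embed-ren : (r : Ren Γ Δ) (t : HATm Γ σ) → embed (ren r t) ≡ ren r (embed t)
embed-ren r (var i) = refl
embed-ren r (con c) = refl
embed-ren r (s · t) = cong₂ _·_ (embed-ren r s) (embed-ren r t)

⟦embed-wk⟧ : ∀ τ (t : HATm Γ σ) (x : ∣ τ ∣) (η : Env Γ) →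
             ⟦ embed (wk {τ = τ} t) ⟧ (x , η) ≡ ⟦ embed t ⟧ η
⟦embed-wk⟧ τ t x η =
  trans (cong (λ u → ⟦ u ⟧ (x , η)) (embed-ren there t)) (⟦wk⟧ τ (embed t) x η)

⟦embed-sub⟧ : (s : Sub HAConst Γ Δ) (t : HATm Γ σ) (η : Env Δ) →
              ⟦ embed (subTm s t) ⟧ η ≡ ⟦ embed t ⟧ (subEnv s η)
⟦embed-sub⟧ s (var i) η = sym (lookup-tab (λ j → ⟦ embed (s j) ⟧ η) i)
⟦embed-sub⟧ s (con c) η = refl
⟦embed-sub⟧ s (t · u) η = cong₂ _⟨$⟩_ (⟦embed-sub⟧ s t η) (⟦embed-sub⟧ s u η)

subEnv-lift : ∀ σ (s : Sub HAConst Γ Δ) (e : ∣ σ ∣ × Env Δ) →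
              subEnv (liftSub {σ = σ} s) e ≡ (proj₁ e , subEnv s (proj₂ e))
subEnv-lift σ s (x , η) = cong (x ,_) (tab-cong (λ i → ⟦embed-wk⟧ σ (s i) x η))

-- A term enters the interpretation only through its value, and substitution does not affect the
-- types of the witnesses.
form-sub : (s : Sub HAConst Γ Δ) (A : Form l Γ) →
           form (sub s A) ≃ reindex (subEnv s) (form A)
form-sub s (_≐_ {σ = σ} t u) = mk≃ λ e _ _ →
  ≡⇒⇔ (cong₂ (Setoid._≈_ (𝒮 σ)) (⟦embed-sub⟧ s t e) (⟦embed-sub⟧ s u e))
form-sub s (𝓘 p t)  = mk≃ λ e a _ → ≡⇒⇔ (cong (λ x → smaj p x a) (⟦embed-sub⟧ s t e))
form-sub s ⊥ᶠ       = ≃-refl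
form-sub s (A ∧ C)  = ∧-≃ (form-sub s A) (form-sub s C)
form-sub s (A ⟶ C)  = ⟶-≃ (form-sub s A) (form-sub s C)
form-sub s (∀ᶠ {σ} p A) =
  ∀-≃ (≃-trans (form-sub (liftSub s) A) (reindex-≃ (form A) (subEnv-lift σ s)))
form-sub s (∃ᶠ {σ} p A) =
  ∃-≃ (≃-trans (form-sub (liftSub s) A) (reindex-≃ (form A) (subEnv-lift σ s)))

sub-^𝓘 : (s : Sub HAConst Γ Δ) (A : Form HA Γ) → sub s A ^𝓘 ≡ sub s (A ^𝓘)
sub-^𝓘 s (t ≐ u)  = refl
sub-^𝓘 s ⊥ᶠ       = refl
sub-^𝓘 s (A ∧ C)  = cong₂ _∧_ (sub-^𝓘 s A) (sub-^𝓘 s C)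
sub-^𝓘 s (A ⟶ C)  = cong₂ _⟶_ (sub-^𝓘 s A) (sub-^𝓘 s C)
sub-^𝓘 s (∀ᶠ p A) = cong (λ D → ∀ᶠ p (𝓘 p v₀ ⟶ D)) (sub-^𝓘 (liftSub s) A)
sub-^𝓘 s (∃ᶠ p A) = cong (λ D → ∃ᶠ p (𝓘 p v₀ ∧ D)) (sub-^𝓘 (liftSub s) A)

form-sub-^𝓘 : (s : Sub HAConst Γ Δ) (A : Form HA Γ) →
              form (sub s A ^𝓘) ≃ reindex (subEnv s) (form (A ^𝓘))
form-sub-^𝓘 s A =
  subst (λ D → form D ≃ reindex (subEnv s) (form (A ^𝓘))) (sym (sub-^𝓘 s A)) (form-sub s (A ^𝓘))

form-[] : (A : Form HA (σ ∷ Γ)) (t : HATm Γ σ) →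
          form ((A [ t ]) ^𝓘) ≃ reindex (λ η → ⟦ embed t ⟧ η , η) (form (A ^𝓘))
form-[] A t = ≃-trans (form-sub-^𝓘 (extend t var) A)
  (reindex-≃ (form (A ^𝓘)) λ η → cong (⟦ embed t ⟧ η ,_) (tab-lookup _ η))

-- Monotone combinatory terms

infixl 9 _∙_ _∙*_

-- A constant is any closed target term together with a proof of monotonicity. Thus derived
-- operators such as `iterᵗ` may be constants although their parts are not monotone.
data MTm (M : List ATy) : ATy → Set where
  var : ρ ∈ M → MTm M ρ
  con : (t : TTm [] ⌊ ρ ⌋) → Mon ρ (⟦ t ⟧ tt) → MTm M ρ
  _∙_ : MTm M (ρ ⇒ κ) → MTm M ρ → MTm M κ

MTms : List ATy → List ATy → Set
MTms M = All (MTm M)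

⟦_⟧₀ : ∀ {σ} → TTm [] σ → ∣ σ ∣
⟦ t ⟧₀ = ⟦ t ⟧ tt

eval : MTm M ρ → Vals M → Val ρ
eval (var i)   m = All.lookup m i
eval (con t _) m = ⟦ t ⟧ tt
eval (s ∙ t)   m = eval s m ⟨$⟩ eval t m

evals : MTms M ρs → Vals M → Vals ρs
evals ts m = All.map (λ t → eval t m) ts

eval-mono : (t : MTm M ρ) {m m′ : Vals M} → m ≤* m′ → eval t m ≤[ ρ ] eval t m′
eval-mono (var i)   p = ≤*-lookup p i
eval-mono (con t q) p = q
eval-mono (s ∙ t)   p = proj₁ (eval-mono s p _ _ (eval-mono t p))

evals-mono : (ts : MTms M ρs) {m m′ : Vals M} → m ≤* m′ → evals ts m ≤* evals ts m′
evals-mono []       p = []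
evals-mono (t ∷ ts) p = eval-mono t p ∷ evals-mono ts p

compile : MTm [] ρ → TTm [] ⌊ ρ ⌋
compile (con t _) = t
compile (s ∙ t)   = compile s · compile t

⟦compile⟧ : (t : MTm [] ρ) → ⟦ compile t ⟧ tt ≡ eval t []
⟦compile⟧ (con t _) = refl
⟦compile⟧ (s ∙ t)   = cong₂ _⟨$⟩_ (⟦compile⟧ s) (⟦compile⟧ t)

_∙*_ : MTm M (ρs ⇛ᵃ κ) → MTms M ρs → MTm M κ
t ∙* []       = t
t ∙* (s ∷ ss) = (t ∙ s) ∙* ss

eval-∙* : ∀ κ (t : MTm M (ρs ⇛ᵃ κ)) (ss : MTms M ρs) (m : Vals M) →
          eval (_∙*_ {κ = κ} t ss) m ≡ eval t m ·ᵛ evals ss m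
eval-∙* κ t []       m = refl
eval-∙* κ t (s ∷ ss) m = eval-∙* κ (t ∙ s) ss m

renᵐ : (∀ {κ} → κ ∈ M → κ ∈ M′) → MTm M ρ → MTm M′ ρ
renᵐ r (var i)   = var (r i)
renᵐ r (con t p) = con t p
renᵐ r (s ∙ t)   = renᵐ r s ∙ renᵐ r t

eval-ren : (r : ∀ {κ} → κ ∈ M → κ ∈ M′) (m : Vals M) (m′ : Vals M′) →
           (∀ {κ} (i : κ ∈ M) → All.lookup m′ (r i) ≡ All.lookup m i) →
           (t : MTm M ρ) → eval (renᵐ r t) m′ ≡ eval t m
eval-ren r m m′ h (var i)   = h i
eval-ren r m m′ h (con t p) = refl
eval-ren r m m′ h (s ∙ t)   = cong₂ _⟨$⟩_ (eval-ren r m m′ h s) (eval-ren r m m′ h t)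

infixl 6 _▹_ _▹ᵛ_

_▹_ : List ATy → List ATy → List ATy
M ▹ []       = M
M ▹ (ρ ∷ ρs) = (ρ ∷ M) ▹ ρs

_▹ᵛ_ : Vals M → Vals ρs → Vals (M ▹ ρs)
m ▹ᵛ []       = m
m ▹ᵛ (x ∷ xs) = (x ∷ m) ▹ᵛ xs

▹-≤* : {m m′ : Vals M} {a a′ : Vals ρs} → m ≤* m′ → a ≤* a′ → (m ▹ᵛ a) ≤* (m′ ▹ᵛ a′)
▹-≤* p []       = p
▹-≤* p (q ∷ qs) = ▹-≤* (q ∷ p) qs

wk▹ : ∀ ρs → κ ∈ M → κ ∈ M ▹ ρs
wk▹ []       i = i
wk▹ (ρ ∷ ρs) i = wk▹ ρs (there i)

lookup-wk▹ : (i : κ ∈ M) (m : Vals M) (xs : Vals ρs) →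
             All.lookup (m ▹ᵛ xs) (wk▹ ρs i) ≡ All.lookup m i
lookup-wk▹ i m []       = refl
lookup-wk▹ i m (x ∷ xs) = lookup-wk▹ (there i) (x ∷ m) xs

↑ : ∀ ρs → MTm M κ → MTm (M ▹ ρs) κ
↑ ρs = renᵐ (wk▹ ρs)

↑* : ∀ ρs → MTms M κs → MTms (M ▹ ρs) κs
↑* ρs = All.map (↑ ρs)

eval-↑ : (t : MTm M κ) (m : Vals M) (xs : Vals ρs) → eval (↑ ρs t) (m ▹ᵛ xs) ≡ eval t m
eval-↑ t m xs = eval-ren _ m _ (λ i → lookup-wk▹ i m xs) t

evals-↑ : (ts : MTms M κs) (m : Vals M) (xs : Vals ρs) → evals (↑* ρs ts) (m ▹ᵛ xs) ≡ evals ts m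
evals-↑ []       m xs = refl
evals-↑ (t ∷ ts) m xs = cong₂ _∷_ (eval-↑ t m xs) (evals-↑ ts m xs)

vars : ∀ ρs → MTms (M ▹ ρs) ρs
vars []       = []
vars (ρ ∷ ρs) = var (wk▹ ρs (here refl)) ∷ vars ρs

evals-vars : (m : Vals M) (xs : Vals ρs) → evals (vars ρs) (m ▹ᵛ xs) ≡ xs
evals-vars m []       = refl
evals-vars m (x ∷ xs) = cong₂ _∷_ (lookup-wk▹ (here refl) (x ∷ m) xs) (evals-vars (x ∷ m) xs)

-- Bracket abstraction

-- When `c` is compared with itself, both conjuncts of ≤ᴮ coincide at the first argument. In `mon₂`
-- and `mon₃` the second conjunct at a later argument is the instance in which the earlier arguments
-- are equal, and these majorize themselves by `≤-monʳ`.
mon₁ : (c : Val (ρ ⇒ κ)) → (∀ x y → x ≤[ ρ ] y → (c ⟨$⟩ x) ≤[ κ ] (c ⟨$⟩ y)) → Mon (ρ ⇒ κ) c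
mon₁ c h x y p = h x y p , h x y p

mon₂ : (c : Val (ρ ⇒ κ ⇒ υ)) →
       (∀ x y z w → x ≤[ ρ ] y → z ≤[ κ ] w → ((c ⟨$⟩ x) ⟨$⟩ z) ≤[ υ ] ((c ⟨$⟩ y) ⟨$⟩ w)) →
       Mon (ρ ⇒ κ ⇒ υ) c
mon₂ {ρ} c h = mon₁ c λ x y p z w q → h x y z w p q , h y y z w (≤-monʳ ρ p) q

mon₃ : ∀ {τ} (c : Val (ρ ⇒ κ ⇒ υ ⇒ τ)) →
       (∀ x y z w u v → x ≤[ ρ ] y → z ≤[ κ ] w → u ≤[ υ ] v →
         (((c ⟨$⟩ x) ⟨$⟩ z) ⟨$⟩ u) ≤[ τ ] (((c ⟨$⟩ y) ⟨$⟩ w) ⟨$⟩ v)) →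
       Mon (ρ ⇒ κ ⇒ υ ⇒ τ) c
mon₃ {κ = κ} c h = mon₂ c λ x y z w p q u v r →
  h x y z w u v p q r , h y y w w u v (≤-monʳ _ p) (≤-monʳ κ q) r

Kᵗ : TTm [] (σ ⇒ τ ⇒ σ)
Kᵗ = con (base (Πᶜ tt tt))

Sᵗ : ∀ {σ τ ρ} → TTm [] ((σ ⇒ τ ⇒ ρ) ⇒ (σ ⇒ τ) ⇒ σ ⇒ ρ)
Sᵗ = con (base (Σᶜ tt tt tt))

Kᵐ : MTm M (ρ ⇒ κ ⇒ ρ)
Kᵐ {ρ = ρ} {κ} = con Kᵗ (mon₂ {ρ} {κ} {ρ} (⟦ Kᵗ {⌊ ρ ⌋} {⌊ κ ⌋} ⟧₀) λ _ _ _ _ p _ → p)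

Sᵐ : MTm M ((ρ ⇒ κ ⇒ υ) ⇒ (ρ ⇒ κ) ⇒ ρ ⇒ υ)
Sᵐ {ρ = ρ} {κ} {υ} = con Sᵗ (mon₃
  {ρ = ρ ⇒ κ ⇒ υ} {κ = ρ ⇒ κ} {υ = ρ} (⟦ Sᵗ {⌊ ρ ⌋} {⌊ κ ⌋} {⌊ υ ⌋} ⟧₀) λ x y z w u v p q r →
    proj₁ (proj₁ (p u v r) _ _ (proj₁ (q u v r))))

lam : MTm (ρ ∷ M) κ → MTm M (ρ ⇒ κ)
lam {ρ} (var (here refl)) = Sᵐ ∙ Kᵐ ∙ Kᵐ {κ = ρ}
lam (var (there i))       = Kᵐ ∙ var i
lam (con t p)             = Kᵐ ∙ con t p
lam (s ∙ t)               = Sᵐ ∙ lam s ∙ lam t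

eval-lam : (t : MTm (ρ ∷ M) κ) (m : Vals M) (x : Val ρ) → eval (lam t) m ⟨$⟩ x ≡ eval t (x ∷ m)
eval-lam (var (here refl)) m x = refl
eval-lam (var (there i))   m x = refl
eval-lam (con t p)         m x = refl
eval-lam (s ∙ t)           m x = cong₂ _⟨$⟩_ (eval-lam s m x) (eval-lam t m x)

lam* : ∀ ρs → MTm (M ▹ ρs) κ → MTm M (ρs ⇛ᵃ κ)
lam* []       t = t
lam* (ρ ∷ ρs) t = lam (lam* ρs t)

eval-lam* : ∀ κ (t : MTm (M ▹ ρs) κ) (m : Vals M) (xs : Vals ρs) →
            eval (lam* ρs t) m ·ᵛ xs ≡ eval t (m ▹ᵛ xs)
eval-lam* κ t m [] = refl
eval-lam* {ρs = ρ ∷ ρs} κ t m (x ∷ xs) =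
  trans (cong (_·ᵛ xs) (eval-lam (lam* ρs t) m x)) (eval-lam* κ t (x ∷ m) xs)

-- Monotone constants for numbers and finite sets

zeroᵐ : MTm M N
zeroᵐ = con (con (base 0ᴺ)) z≤n

sucᵐ : MTm M (N ⇒ N)
sucᵐ = con (con (base Sᴺ)) (mon₁ {N} {N} (⟦ base Sᴺ ⟧ᵀ) λ _ _ → s≤s)

-- Membership is taken up to the equality of the setoid, so an element of a singleton is known only
-- up to this equality.
le-cong : ∀ ρ {x x′ y y′ : Val ρ} → Setoid._≈_ (𝒮 ⌊ ρ ⌋) x x′ → Setoid._≈_ (𝒮 ⌊ ρ ⌋) y y′ →
          x ≤[ ρ ] y → x′ ≤[ ρ ] y′
le-cong N       refl refl p = p
le-cong (ρ ⇒ κ) e e′ p x y q =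
  le-cong κ (e x) (e′ y) (proj₁ (p x y q)) , le-cong κ (e′ x) (e′ y) (proj₂ (p x y q))
le-cong (ρ ⋆) (_ , e) (e′ , e″) (p , q) =
  (λ u i → let v , j , r = p u (e i) in v , e′ j , r) , (λ v j → q v (e″ j))

∈-sing : ∀ ρ (x : Val ρ) → x ∈[ ρ ] (x List⁺.∷ [])
∈-sing ρ x = here (Setoid.refl (𝒮 ⌊ ρ ⌋))

singᵐ : MTm M (ρ ⇒ ρ ⋆)
singᵐ {ρ = ρ} = con (con sing) (mon₁ {ρ} {ρ ⋆} (⟦ sing {⌊ ρ ⌋} ⟧ᵀ) λ x y p →
  (λ { u (here e) → y , ∈-sing ρ y , le-cong ρ (≈-sym e) ≈-refl p }) ,
  (λ { v (here e) → le-cong ρ (≈-sym e) (≈-sym e) (≤-monʳ ρ p) }))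
  where open Setoid (𝒮 ⌊ ρ ⌋) using () renaming (sym to ≈-sym; refl to ≈-refl)

module _ (ρ : ATy) (a b : Val (ρ ⋆)) where

  ∪ᵛ : Val (ρ ⋆)
  ∪ᵛ = a List⁺.⁺++⁺ b

  ∈-∪ˡ : ∀ {u} → u ∈[ ρ ] a → u ∈[ ρ ] ∪ᵛ
  ∈-∪ˡ = Anyₚ.++⁺ˡ

  ∈-∪ʳ : ∀ {u} → u ∈[ ρ ] b → u ∈[ ρ ] ∪ᵛ
  ∈-∪ʳ = Anyₚ.++⁺ʳ (toList a)

∪ᵐ : MTm M (ρ ⋆ ⇒ ρ ⋆ ⇒ ρ ⋆)
∪ᵐ {ρ = ρ} = con (con ∪ᶜ) (mon₂ {ρ ⋆} {ρ ⋆} {ρ ⋆} (⟦ ∪ᶜ {⌊ ρ ⌋} ⟧ᵀ) λ a a′ b b′ p q →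
  (λ u i → case Anyₚ.++⁻ (toList a) i of λ
    { (inj₁ j) → let v , k , r = proj₁ p u j in v , ∈-∪ˡ ρ a′ b′ k , r
    ; (inj₂ j) → let v , k , r = proj₁ q u j in v , ∈-∪ʳ ρ a′ b′ k , r }) ,
  (λ v i → case Anyₚ.++⁻ (toList a′) i of λ
    { (inj₁ j) → proj₂ p v j
    ; (inj₂ j) → proj₂ q v j }))

module _ (ρ κ : ATy) (a : Val (ρ ⋆)) (q : Val (ρ ⇒ κ ⋆)) where

  ⋃ᵛ : Val (κ ⋆)
  ⋃ᵛ = List⁺.concatMap (Func.to q) a

  ∈-⋃⁺ : ∀ x y → x ∈[ ρ ] a → y ∈[ κ ] (q ⟨$⟩ x) → y ∈[ κ ] ⋃ᵛ
  ∈-⋃⁺ x y i j = Any⇒∈-concatMap (𝒮 ⌊ ρ ⌋) (𝒮 ⌊ κ ⌋) (Func.to q) a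
    (Any.map (λ e → proj₁ (Func.cong q e) j) i)

  ∈-⋃⁻ : ∀ y → y ∈[ κ ] ⋃ᵛ → ∃ λ x → x ∈[ ρ ] a × y ∈[ κ ] (q ⟨$⟩ x)
  ∈-⋃⁻ y j = SetoidMembership.find (𝒮 ⌊ ρ ⌋) (∈-concatMap⇒Any (𝒮 ⌊ ρ ⌋) (𝒮 ⌊ κ ⌋) (Func.to q) a j)

⋃ᵐ : MTm M (ρ ⋆ ⇒ (ρ ⇒ κ ⋆) ⇒ κ ⋆)
⋃ᵐ {ρ = ρ} {κ} = con (con ⋃ᶜ) (mon₂ {ρ ⋆} {ρ ⇒ κ ⋆} {κ ⋆}
  (⟦ ⋃ᶜ {⌊ ρ ⌋} {⌊ κ ⌋} ⟧ᵀ) λ a a′ q q′ p r →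
  (λ y i →
    let x , j , k  = ∈-⋃⁻ ρ κ a q y i
        x′ , j′ , s = proj₁ p x j
        y′ , k′ , t = proj₁ (proj₁ (r x x′ s)) y k
    in y′ , ∈-⋃⁺ ρ κ a′ q′ x′ y′ j′ k′ , t) ,
  (λ y i →
    let x , j , k = ∈-⋃⁻ ρ κ a′ q′ y i
    -- An element `x` of `a′` majorizes itself, so `r` may be used at the pair `x`, `x`.
    in proj₂ (proj₁ (r x x (proj₂ p x j))) y k))

-- Unions over tuples of sets

SetTms : List ATy → List ATy → Set
SetTms M = All (λ ρ → MTm M (ρ ⋆))

evalSets : SetTms M ρs → Vals M → Sets ρs
evalSets ts m = All.map (λ t → eval t m) ts

evalSets-↑ : (ts : SetTms M ρs) (m : Vals M) (xs : Vals κs) →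
             evalSets (All.map (↑ κs) ts) (m ▹ᵛ xs) ≡ evalSets ts m
evalSets-↑ []       m xs = refl
evalSets-↑ (t ∷ ts) m xs = cong₂ _∷_ (eval-↑ t m xs) (evalSets-↑ ts m xs)

-- Without product types, a union over a product of sets becomes a nest of unions, one for each
-- component.
⋃* : SetTms M ρs → MTm M (ρs ⇛ᵃ κ ⋆) → MTm M (κ ⋆)
⋃* []                   t = t
⋃* (_∷_ {x = ρ} b bs) t =
  ⋃ᵐ ∙ b ∙ lam (⋃* (All.map (↑ (ρ ∷ [])) bs) (↑ (ρ ∷ []) t ∙ var (here refl)))

∈-⋃* : ∀ κ (bs : SetTms M ρs) (t : MTm M (ρs ⇛ᵃ κ ⋆)) (m : Vals M) (xs : Vals ρs) (y : Val κ) →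
       xs ∈* evalSets bs m → y ∈[ κ ] _·ᵛ_ {κ = κ ⋆} (eval t m) xs → y ∈[ κ ] eval (⋃* bs t) m
∈-⋃* κ []                   t m []       y []       j = j
∈-⋃* κ (_∷_ {x = ρ} b bs) t m (x ∷ xs) y (i ∷ is) j =
  ∈-⋃⁺ ρ κ (eval b m) (eval (lam body) m) x y i
    (subst (mem κ y) (sym (eval-lam body m x))
      (∈-⋃* κ (All.map (↑ (ρ ∷ [])) bs) (↑ (ρ ∷ []) t ∙ var (here refl)) (x ∷ m) xs y
        (subst (xs ∈*_) (sym (evalSets-↑ bs m (x ∷ []))) is)
        (subst (λ f → y ∈[ κ ] _·ᵛ_ {κ = κ ⋆} (f ⟨$⟩ x) xs) (sym (eval-↑ t m (x ∷ []))) j)))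
  where body = ⋃* (All.map (↑ (ρ ∷ [])) bs) (↑ (ρ ∷ []) t ∙ var (here refl))

-- The maximum of `a` is attained, hence lies below some element of `b` and so below the maximum of
-- `b`.
maxᵐ : MTm M (N ⋆ ⇒ N)
maxᵐ = con (con maxᶜ) (mon₁ {N ⋆} {N} (⟦ maxᶜ ⟧ᵀ) λ a b p →
  let v , j , r = proj₁ p _ (max⁺-∈ (List⁺.head a) (List⁺.tail a))
  in ≤-trans r (max⁺-upper b j))

-- Joins

join : ∀ ρ → MTm M ρ → MTm M ρ → MTm M ρ
-- The language has maxima of finite sets only, so the larger of two numbers is the maximum of their
-- pair.
join N       s t = maxᵐ ∙ (∪ᵐ ∙ (singᵐ ∙ s) ∙ (singᵐ ∙ t))
join (ρ ⇒ κ) s t = lam (join κ (↑ (ρ ∷ []) s ∙ var (here refl)) (↑ (ρ ∷ []) t ∙ var (here refl)))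
join (ρ ⋆)   s t = ∪ᵐ ∙ s ∙ t

join-⊑ˡ : ∀ ρ (s t : MTm M ρ) (m : Vals M) → eval s m ⊑[ ρ ] eval (join ρ s t) m
join-⊑ˡ N       s t m = m≤m⊔n _ _
join-⊑ˡ (ρ ⇒ κ) s t m x _ = subst₂ (sq κ)
  (cong (_⟨$⟩ x) (eval-↑ s m (x ∷ []))) (sym (eval-lam (join κ _ _) m x)) (join-⊑ˡ κ _ _ (x ∷ m))
join-⊑ˡ (ρ ⋆)   s t m u = ∈-∪ˡ ρ (eval s m) (eval t m)

join-⊑ʳ : ∀ ρ (s t : MTm M ρ) (m : Vals M) → eval t m ⊑[ ρ ] eval (join ρ s t) m
join-⊑ʳ N       s t m = m≤n⊔m (eval s m) _
join-⊑ʳ (ρ ⇒ κ) s t m x _ = subst₂ (sq κ)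
  (cong (_⟨$⟩ x) (eval-↑ t m (x ∷ []))) (sym (eval-lam (join κ _ _) m x)) (join-⊑ʳ κ _ _ (x ∷ m))
join-⊑ʳ (ρ ⋆)   s t m u = ∈-∪ʳ ρ (eval s m) (eval t m)

join* : MTms M ρs → MTms M ρs → MTms M ρs
join* []                   []       = []
join* (_∷_ {x = ρ} s ss) (t ∷ ts) = join ρ s t ∷ join* ss ts

join*-⊑ˡ : (ss ts : MTms M ρs) (m : Vals M) → evals ss m ⊑* evals (join* ss ts) m
join*-⊑ˡ []                   []       m = []
join*-⊑ˡ (_∷_ {x = ρ} s ss) (t ∷ ts) m = join-⊑ˡ ρ s t m ∷ join*-⊑ˡ ss ts m

join*-⊑ʳ : (ss ts : MTms M ρs) (m : Vals M) → evals ts m ⊑* evals (join* ss ts) m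
join*-⊑ʳ []                   []       m = []
join*-⊑ʳ (_∷_ {x = ρ} s ss) (t ∷ ts) m = join-⊑ʳ ρ s t m ∷ join*-⊑ʳ ss ts m

-- Monotone iteration

module _ (ρ : ATy) where

  inflate : MTm (ρ ∷ N ∷ (ρ ⇒ ρ) ∷ []) ρ
  inflate = join ρ (var (here refl)) (var (there (there (here refl))) ∙ var (here refl))

  stepᵐ : MTm [] ((ρ ⇒ ρ) ⇒ N ⇒ ρ ⇒ ρ)
  stepᵐ = lam (lam (lam inflate))

  recᶜ : TTm [] (N ⇒ ⌊ ρ ⌋ ⇒ (N ⇒ ⌊ ρ ⌋ ⇒ ⌊ ρ ⌋) ⇒ ⌊ ρ ⌋)
  recᶜ = con (base (Rᶜ {σs = ⌊ ρ ⌋ ∷ []} (tt ∷ []) (here refl)))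

  -- λ n w f → R n w (λ k v → v ⊔ f v); unlike R itself, it is monotone in n.
  iterᵗ : TTm [] (N ⇒ ⌊ ρ ⌋ ⇒ (⌊ ρ ⌋ ⇒ ⌊ ρ ⌋) ⇒ ⌊ ρ ⌋)
  iterᵗ = Sᵗ · (Kᵗ · (Sᵗ · (Kᵗ · precompose))) · recᶜ
    -- This is `λ r f → r (stepᵐ f)`. Since `recᶜ` is not monotone, it cannot occur in an `MTm`, and
    -- the abstraction is done by hand with the combinators of the target language.
    where precompose = Sᵗ · (Sᵗ · (Kᵗ · Sᵗ) · Kᵗ) · (Kᵗ · compile stepᵐ)

  iterᵛ : ℕ → Val ρ → Val (ρ ⇒ ρ) → Val ρ
  iterᵛ n w f = ((⟦ iterᵗ ⟧₀ ⟨$⟩ n) ⟨$⟩ w) ⟨$⟩ f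

  iterᵛ-suc : ∀ n w f → iterᵛ (suc n) w f ≡ eval inflate (iterᵛ n w f ∷ n ∷ f ∷ [])
  iterᵛ-suc n w f =
    trans (cong (λ s → ((s ⟨$⟩ f) ⟨$⟩ n) ⟨$⟩ v) (⟦compile⟧ stepᵐ))
    (trans (cong (λ s → (s ⟨$⟩ n) ⟨$⟩ v) (eval-lam (lam (lam inflate)) [] f))
    (trans (cong (_⟨$⟩ v) (eval-lam (lam inflate) (f ∷ []) n))
           (eval-lam inflate (n ∷ f ∷ []) v)))
    where v = iterᵛ n w f

  iterᵛ-⊑ : ∀ n w f → iterᵛ n w f ⊑[ ρ ] iterᵛ (suc n) w f
  iterᵛ-⊑ n w f = subst (sq ρ _) (sym (iterᵛ-suc n w f)) (join-⊑ˡ ρ _ _ (iterᵛ n w f ∷ n ∷ f ∷ []))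

  iterᵛ-step : ∀ n w f → (f ⟨$⟩ iterᵛ n w f) ⊑[ ρ ] iterᵛ (suc n) w f
  iterᵛ-step n w f = subst (sq ρ _) (sym (iterᵛ-suc n w f))
    (join-⊑ʳ ρ (var (here refl)) (var (there (there (here refl))) ∙ var (here refl))
      (iterᵛ n w f ∷ n ∷ f ∷ []))

  -- For equal counters this is monotonicity of `inflate`. If the left counter is exhausted first,
  -- each remaining step on the right enlarges the value in ⊑ because of the join; this is the case
  -- that fails for `R`.
  iterᵛ-mono : ∀ n n′ w w′ f f′ → n ≤ n′ → w ≤[ ρ ] w′ → f ≤[ ρ ⇒ ρ ] f′ →
               iterᵛ n w f ≤[ ρ ] iterᵛ n′ w′ f′
  iterᵛ-mono zero    zero     w w′ f f′ p       q r = q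
  iterᵛ-mono (suc n) (suc n′) w w′ f f′ (s≤s p) q r = subst₂ (le ρ)
    (sym (iterᵛ-suc n w f)) (sym (iterᵛ-suc n′ w′ f′))
    (eval-mono inflate (iterᵛ-mono n n′ w w′ f f′ p q r ∷ p ∷ r ∷ []))
  iterᵛ-mono zero    (suc n′) w w′ f f′ z≤n     q r =
    ≤-⊑-trans ρ ih (iterᵛ-⊑ n′ w′ f′) (subst (λ v → Mon ρ v) (sym (iterᵛ-suc n′ w′ f′))
      (eval-mono inflate (≤-monʳ ρ ih ∷ ≤-refl ∷ ≤-monʳ (ρ ⇒ ρ) {f} {f′} r ∷ [])))
    where ih = iterᵛ-mono zero n′ w w′ f f′ z≤n q r

  iterᵐ : MTm M (N ⇒ ρ ⇒ (ρ ⇒ ρ) ⇒ ρ)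
  iterᵐ = con iterᵗ (mon₃ {N} {ρ} {ρ ⇒ ρ} (⟦ iterᵗ ⟧₀) iterᵛ-mono)

-- Abstraction of witnesses for implications

module _ (ρs κs ρs′ κs′ : List ATy) where

  abstract-⟶ : MTms (M ▹ ρs) ρs′ → SetTms (M ▹ ρs ▹ κs′) κs → MTms M (⟶-pos ρs κs ρs′ κs′)
  abstract-⟶ fs gs = ++⁺ (map⁺ (All.map (lam* ρs) fs))
                         (map⁺ (All.map (λ g → lam* ρs (lam* κs′ g)) gs))

  private
    counterTy : ATy → ATy
    counterTy ρ = ρs ⇛ᵃ (κs′ ⇛ᵃ ρ ⋆)

    lams : ∀ {κs} → MTms (M ▹ ρs) κs → Vals M → All (λ κ → Val (ρs ⇛ᵃ κ)) κs
    lams fs m = All.map (λ f → eval (lam* ρs f) m) fs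

    lams² : ∀ {κs} → SetTms (M ▹ ρs ▹ κs′) κs → Vals M → All (λ κ → Val (counterTy κ)) κs
    lams² gs m = All.map (λ g → eval (lam* ρs (lam* κs′ g)) m) gs

    evals-lams : ∀ {κs} (fs : MTms (M ▹ ρs) κs) (m : Vals M) →
                 evals (map⁺ {f = ρs ⇛ᵃ_} (All.map (lam* ρs) fs)) m ≡
                 map⁺ {P = Val} {f = ρs ⇛ᵃ_} (lams fs m)
    evals-lams []       m = refl
    evals-lams (f ∷ fs) m = cong (_ ∷_) (evals-lams fs m)

    evals-lams² : ∀ {κs} (gs : SetTms (M ▹ ρs ▹ κs′) κs) (m : Vals M) →
                  evals (map⁺ {f = counterTy} (All.map (λ g → lam* ρs (lam* κs′ g)) gs)) m ≡
                  map⁺ {P = Val} {f = counterTy} (lams² gs m)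
    evals-lams² []       m = refl
    evals-lams² (g ∷ gs) m = cong (_ ∷_) (evals-lams² gs m)

    evals-abstract-⟶ : (fs : MTms (M ▹ ρs) ρs′) (gs : SetTms (M ▹ ρs ▹ κs′) κs) (m : Vals M) →
                       evals (abstract-⟶ fs gs) m ≡
                       ++⁺ (map⁺ {P = Val} {f = ρs ⇛ᵃ_} (lams fs m))
                           (map⁺ {P = Val} {f = counterTy} (lams² gs m))
    evals-abstract-⟶ fs gs m =
      trans (map-++⁺ (λ t → eval t m) (map⁺ (All.map (lam* ρs) fs))
                      (map⁺ (All.map (λ g → lam* ρs (lam* κs′ g)) gs)))
            (cong₂ ++⁺ (evals-lams fs m) (evals-lams² gs m))

    β : ∀ {κs} (fs : MTms (M ▹ ρs) κs) (m : Vals M) (a : Vals ρs) →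
        All.map {Q = Val} (_·ᵛ a) (lams fs m) ≡ evals fs (m ▹ᵛ a)
    β []                   m a = refl
    β (_∷_ {x = κ} f fs) m a = cong₂ _∷_ (eval-lam* κ f m a) (β fs m a)

    β² : ∀ {κs} (gs : SetTms (M ▹ ρs ▹ κs′) κs) (m : Vals M) (a : Vals ρs) (d : Vals κs′) →
         All.map {Q = λ κ → Val (κ ⋆)} (λ g → g ·ᵛ a ·ᵛ d) (lams² gs m) ≡ evalSets gs (m ▹ᵛ a ▹ᵛ d)
    β² []                   m a d = refl
    β² (_∷_ {x = κ} g gs) m a d = cong₂ _∷_
      (trans (cong (_·ᵛ d) (eval-lam* (κs′ ⇛ᵃ κ ⋆) (lam* κs′ g) m a)) (eval-lam* (κ ⋆) g (m ▹ᵛ a) d))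
      (β² gs m a d)

  apply-abstract-⟶ : (fs : MTms (M ▹ ρs) ρs′) (gs : SetTms (M ▹ ρs ▹ κs′) κs) (m : Vals M) (a : Vals ρs) →
                     apply ρs κs ρs′ κs′ (evals (abstract-⟶ fs gs) m) a ≡ evals fs (m ▹ᵛ a)
  apply-abstract-⟶ fs gs m a =
    trans (cong (λ v → apply ρs κs ρs′ κs′ v a) (evals-abstract-⟶ fs gs m))
    (trans (cong (λ v → All.map {Q = Val} (_·ᵛ a) (map⁻ {f = ρs ⇛ᵃ_} v))
                 (++⁻ˡ-++⁺ (map⁺ {P = Val} {f = ρs ⇛ᵃ_} (lams fs m))
                           (map⁺ {P = Val} {f = counterTy} (lams² gs m))))
    (trans (cong (All.map {Q = Val} (_·ᵛ a)) (map⁻-map⁺ {P = Val} {g = ρs ⇛ᵃ_} (lams fs m)))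
           (β fs m a)))

  counter-abstract-⟶ : (fs : MTms (M ▹ ρs) ρs′) (gs : SetTms (M ▹ ρs ▹ κs′) κs) (m : Vals M)
                       (a : Vals ρs) (d : Vals κs′) →
                       counter ρs κs ρs′ κs′ (evals (abstract-⟶ fs gs) m) a d ≡ evalSets gs (m ▹ᵛ a ▹ᵛ d)
  counter-abstract-⟶ fs gs m a d =
    trans (cong (λ v → counter ρs κs ρs′ κs′ v a d) (evals-abstract-⟶ fs gs m))
    (trans (cong (λ v → All.map {Q = λ κ → Val (κ ⋆)} (λ g → g ·ᵛ a ·ᵛ d) (map⁻ {f = counterTy} v))
                 (++⁻ʳ-++⁺ (map⁺ {P = Val} {f = ρs ⇛ᵃ_} (lams fs m))
                           (map⁺ {P = Val} {f = counterTy} (lams² gs m))))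
    (trans (cong (All.map {Q = λ κ → Val (κ ⋆)} (λ g → g ·ᵛ a ·ᵛ d))
                 (map⁻-map⁺ {P = Val} {g = counterTy} (lams² gs m)))
           (β² gs m a d)))

-- M lists the types of the witnesses assumed, and H says for which values of the
-- free variables they are assumed to be good.

record Real {E : Set} (M : List ATy) (H : E → Vals M → Set) (I : Int E) : Set where
  constructor real
  field
    wit : MTms M (P I)
    sat : ∀ e m → Mon* m → H e m → ∀ b → Mon* b → holds I e (evals wit m) b

open Real public

private variable
  H : E → Vals M → Set


real-≃ : {I J : Int E} → I ≃ J → Real M H J → Real M H I
real-≃ (mk≃ f) (real w s) = real w λ e m n h b k → from (f e _ b) (s e m n h b k)

real-atom : {φ : E → Set} → (∀ e → φ e) → Real M H (atom φ)
real-atom h = real [] λ e _ _ _ _ _ → h e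

-- The quantified `x` is no argument of the witnesses, so the same terms serve every `x`;
-- accordingly the hypotheses may speak only of the remaining parameters.
real-∀ : {X : Set} {I : Int (X × E)} → Real M (H ∘ proj₂) I → Real M H (∀ᴵ I)
real-∀ (real w s) = real w λ e m n h b k x → s (x , e) m n h b k

real-⟶ : (I J : Int E) (fs : MTms (M ▹ P I) (P J)) (gs : SetTms (M ▹ P I ▹ Q J) (Q I)) →
         (∀ e m a d → Mon* m → H e m → Mon* a → Mon* d →
           ∀∈* (evalSets gs (m ▹ᵛ a ▹ᵛ d)) (holds I e a) → holds J e (evals fs (m ▹ᵛ a)) d) →
         Real M H (I ⟶ᴵ J)
real-⟶ I J fs gs h = real (abstract-⟶ (P I) (Q I) (P J) (Q J) fs gs) λ e m n k ad l g →
  let a = ++⁻ˡ (P I) ad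
      d = ++⁻ʳ (P I) ad
  in subst (λ f → holds J e f d) (sym (apply-abstract-⟶ (P I) (Q I) (P J) (Q J) fs gs m a))
       (h e m a d n k (++⁻ˡ-≤* {P I} l) (++⁻ʳ-≤* {P I} l)
         (subst (λ bs → ∀∈* bs (holds I e a)) (counter-abstract-⟶ (P I) (Q I) (P J) (Q J) fs gs m a d) g))

-- Adds to the assumptions a premise that has no counterwitnesses. Indexing by `m ▹ᵛ a` lets a match
-- on `ext` recover the splitting of the tuple.
data Ext {M ps : List ATy} (H : E → Vals M → Set) (R : E → Vals ps → Vals [] → Set) (e : E) :
         Vals (M ▹ ps) → Set where
  ext : ∀ m a → Mon* m → Mon* a → H e m → R e a [] → Ext H R e (m ▹ᵛ a)

real-⟶∅ : ∀ {ps} {R : E → Vals ps → Vals [] → Set} {J : Int E} →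
          Real (M ▹ ps) (Ext H R) J → Real M H (int ps [] R ⟶ᴵ J)
real-⟶∅ {ps = ps} {R} {J} (real w s) = real-⟶ (int ps [] R) J w [] λ e m a d n k l o g →
  s e (m ▹ᵛ a) (▹-≤* n l) (ext m a n l k (g [] [] [])) d o

-- Singleton counterwitness sets, substitution and case distinction

[]∈* : (bs : Sets []) → [] ∈* bs
[]∈* [] = []

sings : MTms M ρs → SetTms M ρs
sings = All.map (singᵐ ∙_)

∈*-sings : (ts : MTms M ρs) (m : Vals M) → evals ts m ∈* evalSets (sings ts) m
∈*-sings []                   m = []
∈*-sings (_∷_ {x = ρ} t ts) m = ∈-sing ρ (eval t m) ∷ ∈*-sings ts m

++-∈* : {xs : Vals ρs} {ys : Vals κs} {as : Sets ρs} {bs : Sets κs} →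
        xs ∈* as → ys ∈* bs → ++⁺ xs ys ∈* ++⁺ as bs
++-∈* []       js = js
++-∈* (i ∷ is) js = i ∷ ++-∈* is js

++-≤* : {xs xs′ : Vals ρs} {ys ys′ : Vals κs} → xs ≤* xs′ → ys ≤* ys′ → ++⁺ xs ys ≤* ++⁺ xs′ ys′
++-≤* []       js = js
++-≤* (i ∷ is) js = i ∷ ++-≤* is js

evalSets-++ : (ss : SetTms M ρs) (ts : SetTms M κs) (m : Vals M) →
              evalSets (++⁺ ss ts) m ≡ ++⁺ (evalSets ss m) (evalSets ts m)
evalSets-++ ss ts m = map-++⁺ (λ t → eval t m) ss ts

-- Realized by the identity: `a` is passed on, and the premise is asked only at the singleton of
-- `d`. Under the hypothesis that two terms are equal, this realizes `≐-subst`.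
real-reindex-⟶ : {F : Set} (I : Int F) (f g : E → F) →
                  (∀ e m → H e m → ∀ a b → holds I (f e) a b → holds I (g e) a b) →
                  Real M H (reindex f I ⟶ᴵ reindex g I)
real-reindex-⟶ I f g h = real-⟶ (reindex f I) (reindex g I) (vars (P I)) (sings (vars (Q I)))
  λ e m a d n k l o p → subst (λ a → holds I (g e) a d) (sym (evals-vars m a))
    (h e m k a d (p d o (subst (_∈* evalSets (sings (vars (Q I))) (m ▹ᵛ a ▹ᵛ d))
      (evals-vars (m ▹ᵛ a) d) (∈*-sings (vars (Q I)) (m ▹ᵛ a ▹ᵛ d)))))

-- Booleans have no witnesses, so the realizer cannot depend on the case. The join of both given
-- witnesses serves either case by `Upward I`, and the premise is asked only at the pair formed by
-- `d` and `d`.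
real-cases : (I : Int (Bool × E)) → Upward I →
             Real M H (reindex (false ,_) I ∧ᴵ reindex (true ,_) I ⟶ᴵ ∀ᴵ (𝓘ᴵ B proj₁ ⟶ᴵ I))
real-cases {M = M} I up = real-⟶ (reindex (false ,_) I ∧ᴵ reindex (true ,_) I) (∀ᴵ (𝓘ᴵ B proj₁ ⟶ᴵ I))
  (abstract-⟶ [] [] (P I) (Q I) js [])
  (++⁺ ss ss)
  λ e m ac d n k l o p x _ →
    let a   = ++⁻ˡ (P I) ac
        c   = ++⁻ʳ (P I) ac
        mac = m ▹ᵛ ac
        d∈  = subst (_∈* evalSets ss (mac ▹ᵛ d)) (evals-vars mac d) (∈*-sings (vars (Q I)) (mac ▹ᵛ d))
        h   = p (++⁺ d d) (++-≤* o o)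
                (subst (++⁺ d d ∈*_) (sym (evalSets-++ ss ss (mac ▹ᵛ d))) (++-∈* d∈ d∈))
        a≡  = trans (map-++⁻ˡ (λ t → eval t mac) (P I) vs) (cong (++⁻ˡ (P I)) (evals-vars m ac))
        c≡  = trans (map-++⁻ʳ (λ t → eval t mac) (P I) vs) (cong (++⁻ʳ (P I)) (evals-vars m ac))
        mj  = evals-mono js (▹-≤* n l)
    in subst (λ w → holds I (x , e) w d) (sym (apply-abstract-⟶ [] [] (P I) (Q I) js [] mac []))
         (case x returning (λ x → holds I (x , e) (evals js mac) d) of λ
           { false → up (false , e) a _ d (++⁻ˡ-≤* {P I} l) mj o
                       (subst (_⊑* evals js mac) a≡ (join*-⊑ˡ as cs mac))
                       (subst (holds I (false , e) a) (++⁻ˡ-++⁺ d d) (proj₁ h))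
           ; true  → up (true , e) c _ d (++⁻ʳ-≤* {P I} l) mj o
                       (subst (_⊑* evals js mac) c≡ (join*-⊑ʳ as cs mac))
                       (subst (holds I (true , e) c) (++⁻ʳ-++⁺ d d) (proj₂ h)) })
  where
  vs : MTms (M ▹ (P I ++ P I)) (P I ++ P I)
  vs = vars (P I ++ P I)

  as cs js : MTms (M ▹ (P I ++ P I)) (P I)
  as = ++⁻ˡ (P I) vs
  cs = ++⁻ʳ (P I) vs
  js = join* as cs

  ss : SetTms (M ▹ (P I ++ P I) ▹ Q I) (Q I)
  ss = sings (vars (Q I))

-- As there are no product types, an operator Φ on tuples is iterated through the
-- functions h ∘ Φʲ, which have a single type.

FnTms : List ATy → List ATy → List ATy → Set
FnTms K ρs = All (λ κ → MTm K (ρs ⇛ᵃ κ))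

apps : FnTms K ρs κs → MTms K ρs → MTms K κs
apps fs as = All.map (_∙* as) fs

evals-apps : (fs : FnTms K ρs κs) (as : MTms K ρs) (m : Vals K) →
             evals (apps fs as) m ≡ All.map {Q = Val} (λ f → eval f m ·ᵛ evals as m) fs
evals-apps []                   as m = refl
evals-apps (_∷_ {x = κ} f fs) as m = cong₂ _∷_ (eval-∙* κ f as m) (evals-apps fs as m)

appsᵛ : FnTms K ρs κs → Vals K → Vals ρs → Vals κs
appsᵛ fs m a = All.map {Q = Val} (λ f → eval f m ·ᵛ a) fs

appsᵛ-mon : (fs : FnTms K ρs κs) {m : Vals K} {a : Vals ρs} → Mon* m → Mon* a → Mon* (appsᵛ fs m a)
appsᵛ-mon []       p q = []
appsᵛ-mon (f ∷ fs) p q = ·ᵛ-≤ (eval-mono f p) q ∷ appsᵛ-mon fs p q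

appsᵛ-↑ : ∀ υs (fs : FnTms K ρs κs) (m : Vals K) (xs : Vals υs) (a : Vals ρs) →
          appsᵛ (All.map (↑ υs) fs) (m ▹ᵛ xs) a ≡ appsᵛ fs m a
appsᵛ-↑ υs []       m xs a = refl
appsᵛ-↑ υs (f ∷ fs) m xs a = cong₂ _∷_ (cong (_·ᵛ a) (eval-↑ f m xs)) (appsᵛ-↑ υs fs m xs a)

pow : {A : Set} → (A → A) → ℕ → A → A
pow f zero    a = a
pow f (suc n) a = f (pow f n a)

-- `pow` applies `f` on the outside, whereas the functions h ∘ Φʲ are built by composing on the
-- inside.
pow-shift : {A : Set} (f : A → A) (n : ℕ) (a : A) → pow f (suc n) a ≡ pow f n (f a)
pow-shift f zero    a = refl
pow-shift f (suc n) a = cong f (pow-shift f n a)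

module _ (n : MTm K N) (fs : FnTms K ρs ρs) where

  pow-mon : {m : Vals K} {a : Vals ρs} → Mon* m → Mon* a → ∀ j → Mon* (pow (appsᵛ fs m) j a)
  pow-mon p q zero    = q
  pow-mon p q (suc j) = appsᵛ-mon fs p (pow-mon p q j)

  module _ (κ : ATy) where

    private
      fnTy : ATy
      fnTy = ρs ⇛ᵃ κ

      fs′ : FnTms ((fnTy ∷ K) ▹ ρs) ρs ρs
      fs′ = All.map (↑ ρs) (All.map (↑ (fnTy ∷ [])) fs)

    precompose : MTm (fnTy ∷ K) fnTy
    precompose = lam* ρs (↑ ρs (var (here refl)) ∙* apps fs′ (vars ρs))

    eval-precompose : (m : Vals K) (e : Val fnTy) (a : Vals ρs) →
                      _·ᵛ_ {κ = κ} (eval (lam precompose) m ⟨$⟩ e) a ≡ e ·ᵛ appsᵛ fs m a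
    eval-precompose m e a =
      trans (cong (λ f → _·ᵛ_ {κ = κ} f a) (eval-lam precompose m e))
      (trans (eval-lam* κ (↑ ρs (var (here refl)) ∙* apps fs′ (vars ρs)) (e ∷ m) a)
      (trans (eval-∙* κ (↑ ρs (var (here refl))) (apps fs′ (vars ρs)) m₁)
      (cong₂ (_·ᵛ_ {κ = κ}) (eval-↑ {κ = fnTy} (var (here refl)) (e ∷ m) a)
        (trans (evals-apps fs′ (vars ρs) m₁)
        (trans (cong (appsᵛ fs′ m₁) (evals-vars (e ∷ m) a))
        (trans (appsᵛ-↑ ρs (All.map (↑ (fnTy ∷ [])) fs) (e ∷ m) a a)
               (appsᵛ-↑ (fnTy ∷ []) fs m (e ∷ []) a)))))))
      where
      m₁ : Vals ((fnTy ∷ K) ▹ ρs)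
      m₁ = (e ∷ m) ▹ᵛ a

    iterate : MTm K (ρs ⇛ᵃ κ) → MTm K (ρs ⇛ᵃ κ)
    iterate h = iterᵐ (ρs ⇛ᵃ κ) ∙ n ∙ h ∙ lam precompose

    -- Induction on the counter `k`. What has been reached persists by `iterᵛ-⊑`; for `suc j`, the
    -- hypothesis is used at Φ a, and `iterᵛ-step` shows that the precomposed function is included
    -- in the next join.
    iterate-⊑ : (h : MTm K (ρs ⇛ᵃ κ)) (m : Vals K) → Mon* m → ∀ j → j ≤ eval n m → ∀ a → Mon* a →
                (eval h m ·ᵛ pow (appsᵛ fs m) j a) ⊑[ κ ] (eval (iterate h) m ·ᵛ a)
    iterate-⊑ h m p = go (eval n m)
      where
      it : ℕ → Val (ρs ⇛ᵃ κ)
      it k = iterᵛ (ρs ⇛ᵃ κ) k (eval h m) (eval (lam precompose) m)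

      go : ∀ k j → j ≤ k → ∀ a → Mon* a →
           (eval h m ·ᵛ pow (appsᵛ fs m) j a) ⊑[ κ ] (it k ·ᵛ a)
      go zero    zero    _       a q = ⊑-refl κ
      go (suc k) zero    _       a q = ⊑-trans κ (go k zero z≤n a q)
        (·ᵛ-⊑ (iterᵛ-⊑ (ρs ⇛ᵃ κ) k (eval h m) (eval (lam precompose) m)) q)
      go (suc k) (suc j) (s≤s r) a q = ⊑-trans κ
        (subst₂ (sq κ) (cong (eval h m ·ᵛ_) (sym (pow-shift (appsᵛ fs m) j a)))
                (sym (eval-precompose m (it k) a))
                (go k j r (appsᵛ fs m a) (appsᵛ-mon fs p q)))
        (·ᵛ-⊑ (iterᵛ-step (ρs ⇛ᵃ κ) k (eval h m) (eval (lam precompose) m)) q)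

  iterates : MTms (K ▹ ρs) κs → MTms K ρs → MTms K κs
  iterates ts as = All.map (λ {κ} t → iterate κ (lam* ρs t) ∙* as) ts

  iterates-⊑ : (ts : MTms (K ▹ ρs) κs) (as : MTms K ρs) (m : Vals K) → Mon* m → ∀ j → j ≤ eval n m →
               evals ts (m ▹ᵛ pow (appsᵛ fs m) j (evals as m)) ⊑* evals (iterates ts as) m
  iterates-⊑ []                   as m p j r = []
  iterates-⊑ (_∷_ {x = κ} t ts) as m p j r =
    subst₂ (sq κ) (eval-lam* {ρs = ρs} κ t m (pow (appsᵛ fs m) j (evals as m)))
      (sym (eval-∙* κ (iterate κ (lam* ρs t)) as m))
      (iterate-⊑ κ (lam* ρs t) m p j r (evals as m) (evals-mono as p)) ∷
    iterates-⊑ ts as m p j r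

  -- On set types the join is the union, so iterating from a singleton collects all the iterates in
  -- one set.
  iterateSets : MTms (K ▹ ρs) κs → MTms K ρs → SetTms K κs
  iterateSets ts as = All.map (λ {κ} t → iterate (κ ⋆) (lam* ρs (singᵐ ∙ t)) ∙* as) ts

  iterateSets-∈ : (ts : MTms (K ▹ ρs) κs) (as : MTms K ρs) (m : Vals K) → Mon* m → ∀ j → j ≤ eval n m →
                  evals ts (m ▹ᵛ pow (appsᵛ fs m) j (evals as m)) ∈* evalSets (iterateSets ts as) m
  iterateSets-∈ []                   as m p j r = []
  iterateSets-∈ (_∷_ {x = κ} t ts) as m p j r =
    subst₂ (sq (κ ⋆)) (eval-lam* {ρs = ρs} (κ ⋆) (singᵐ ∙ t) m (pow (appsᵛ fs m) j (evals as m)))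
      (sym (eval-∙* (κ ⋆) (iterate (κ ⋆) (lam* ρs (singᵐ ∙ t))) as m))
      (iterate-⊑ (κ ⋆) (lam* ρs (singᵐ ∙ t)) m p j r (evals as m) (evals-mono as p))
      _ (∈-sing κ (eval t _)) ∷
    iterateSets-∈ ts as m p j r

CounterTms : List ATy → List ATy → List ATy → List ATy → Set
CounterTms K ρs κs = All (λ ρ → MTm K (ρs ⇛ᵃ (κs ⇛ᵃ ρ ⋆)))

counters : ∀ {υs} → CounterTms K ρs κs υs → MTms K ρs → MTms K κs → SetTms K υs
counters gs as ds = All.map (λ {κ} g → _∙*_ {κ = κ ⋆} (g ∙* as) ds) gs

countersᵛ : ∀ {υs} → CounterTms K ρs κs υs → Vals K → Vals ρs → Vals κs → Sets υs
countersᵛ gs m a d = All.map {Q = λ κ → Val (κ ⋆)} (λ g → eval g m ·ᵛ a ·ᵛ d) gs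

evalSets-counters : ∀ {υs} (gs : CounterTms K ρs κs υs) (as : MTms K ρs) (ds : MTms K κs) (m : Vals K) →
                    evalSets (counters gs as ds) m ≡ countersᵛ gs m (evals as m) (evals ds m)
evalSets-counters []                   as ds m = refl
evalSets-counters {κs = κs} (_∷_ {x = κ} g gs) as ds m = cong₂ _∷_
  (trans (eval-∙* (κ ⋆) (g ∙* as) ds m) (cong (_·ᵛ evals ds m) (eval-∙* (κs ⇛ᵃ κ ⋆) g as m)))
  (evalSets-counters gs as ds m)

countersᵛ-↑ : ∀ {υs} τs (gs : CounterTms K ρs κs υs) (m : Vals K) (xs : Vals τs)
              (a : Vals ρs) (d : Vals κs) →
              countersᵛ (All.map (↑ τs) gs) (m ▹ᵛ xs) a d ≡ countersᵛ gs m a d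
countersᵛ-↑ τs []       m xs a d = refl
countersᵛ-↑ τs (g ∷ gs) m xs a d =
  cong₂ _∷_ (cong (λ f → f ·ᵛ a ·ᵛ d) (eval-↑ g m xs)) (countersᵛ-↑ τs gs m xs a d)

-- The sets of counterwitnesses reached from d by repeatedly passing to the
-- elements of g a d with a ∈ rs.
module _ (n : MTm K N) (rs : SetTms K ρs) (gs : CounterTms K ρs κs κs) where

  module _ (κ : ATy) where

    private
      υ′ : ATy
      υ′ = κs ⇛ᵃ κ ⋆

    -- `descend` maps `e` to the function sending `d` to the union of `e d′` over all `a` in `rs`
    -- and all `d′` in the counterwitness sets at `a` and `d`. Here `inner` is the union over `d′`,
    -- and `outer` the one over `a`.
    inner : MTm ((υ′ ∷ K) ▹ κs ▹ ρs) (κ ⋆)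
    inner = ⋃* (counters (All.map (↑ ρs) (All.map (↑ κs) (All.map (↑ (υ′ ∷ [])) gs)))
                         (vars ρs) (↑* ρs (vars κs)))
               (↑ ρs (↑ κs (var (here refl))))

    outer : MTm ((υ′ ∷ K) ▹ κs) (κ ⋆)
    outer = ⋃* (All.map (↑ κs) (All.map (↑ (υ′ ∷ [])) rs)) (lam* ρs inner)

    descend : MTm (υ′ ∷ K) υ′
    descend = lam* κs outer

    ∈-descend : (m : Vals K) (e : Val υ′) (a : Vals ρs) (d d′ : Vals κs) (y : Val κ) →
                a ∈* evalSets rs m → d′ ∈* countersᵛ gs m a d → y ∈[ κ ] _·ᵛ_ {κ = κ ⋆} e d′ →
                y ∈[ κ ] _·ᵛ_ {κ = κ ⋆} (eval (lam descend) m ⟨$⟩ e) d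
    ∈-descend m e a d d′ y i j k =
      subst (mem κ y) (sym (trans (cong (λ f → _·ᵛ_ {κ = κ ⋆} f d) (eval-lam descend m e))
                                (eval-lam* (κ ⋆) outer (e ∷ m) d)))
        (∈-⋃* κ _ (lam* ρs inner) m₁ a y
          (subst (a ∈*_) (sym (trans (evalSets-↑ _ (e ∷ m) d) (evalSets-↑ rs m (e ∷ [])))) i)
          (subst (mem κ y) (sym (eval-lam* (κ ⋆) inner m₁ a))
            (∈-⋃* κ _ (↑ ρs (↑ κs (var (here refl)))) (m₁ ▹ᵛ a) d′ y
              (subst (d′ ∈*_) (sym gs≡) j)
              (subst (λ f → y ∈[ κ ] _·ᵛ_ {κ = κ ⋆} f d′)
                (sym (trans (eval-↑ (↑ κs (var (here refl))) m₁ a) (lookup-wk▹ (here refl) (e ∷ m) d))) k))))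
      where
      m₁ : Vals ((υ′ ∷ K) ▹ κs)
      m₁ = (e ∷ m) ▹ᵛ d

      gs≡ : evalSets (counters (All.map (↑ ρs) (All.map (↑ κs) (All.map (↑ (υ′ ∷ [])) gs)))
                               (vars ρs) (↑* ρs (vars κs))) (m₁ ▹ᵛ a) ≡ countersᵛ gs m a d
      gs≡ = trans (evalSets-counters _ (vars ρs) (↑* ρs (vars κs)) (m₁ ▹ᵛ a))
        (trans (cong₂ (countersᵛ _ (m₁ ▹ᵛ a)) (evals-vars m₁ a)
                 (trans (evals-↑ (vars κs) m₁ a) (evals-vars (e ∷ m) d)))
        (trans (countersᵛ-↑ ρs _ m₁ a a d)
        (trans (countersᵛ-↑ κs _ (e ∷ m) d a d) (countersᵛ-↑ (υ′ ∷ []) gs m (e ∷ []) a d))))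

  -- Used with `ts` the variables for `d`; a general `ts` allows induction on components. Each
  -- component is collected separately, so the product of the sets may contain further tuples, which
  -- only strengthens what is assumed of a premise.
  reachTm : ∀ {υs} → MTms (K ▹ κs) υs → All (λ κ → MTm K (κs ⇛ᵃ κ ⋆)) υs
  reachTm ts = All.map (λ {κ} t → iterᵐ (κs ⇛ᵃ κ ⋆) ∙ n ∙ lam* κs (singᵐ ∙ t) ∙ lam (descend κ)) ts

  reach : Vals K → ∀ {υs} → ℕ → Vals κs → MTms (K ▹ κs) υs → Sets υs
  reach m j d ts = All.map {Q = λ κ → Val (κ ⋆)}
    (λ {κ} t → iterᵛ (κs ⇛ᵃ κ ⋆) j (eval (lam* κs (singᵐ ∙ t)) m) (eval (lam (descend κ)) m) ·ᵛ d) ts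

  reach-refl : ∀ m {υs} j d (ts : MTms (K ▹ κs) υs) → Mon* d → evals ts (m ▹ᵛ d) ∈* reach m j d ts
  reach-refl m j d []                   p = []
  reach-refl m j d (_∷_ {x = κ} t ts) p = go j ∷ reach-refl m j d ts p
    where
    go : ∀ j → eval t (m ▹ᵛ d) ∈[ κ ]
               _·ᵛ_ {κ = κ ⋆}
                 (iterᵛ (κs ⇛ᵃ κ ⋆) j (eval (lam* κs (singᵐ ∙ t)) m) (eval (lam (descend κ)) m)) d
    go zero    = subst (mem κ _) (sym (eval-lam* (κ ⋆) (singᵐ ∙ t) m d)) (∈-sing κ _)
    go (suc j) = ·ᵛ-⊑ {κ = κ ⋆}
      (iterᵛ-⊑ (κs ⇛ᵃ κ ⋆) j (eval (lam* κs (singᵐ ∙ t)) m) (eval (lam (descend κ)) m)) p _ (go j)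

  -- The tuples `d′` are among those over which `descend` takes its union, so one more iteration
  -- covers all that is reached from them.
  reach-step : ∀ m {υs} j a d d′ (ts : MTms (K ▹ κs) υs) (xs : Vals υs) → Mon* d →
               a ∈* evalSets rs m → d′ ∈* countersᵛ gs m a d →
               xs ∈* reach m j d′ ts → xs ∈* reach m (suc j) d ts
  reach-step m j a d d′ []                   []       p q r []       = []
  reach-step m j a d d′ (_∷_ {x = κ} t ts) (x ∷ xs) p q r (i ∷ is) =
    ·ᵛ-⊑ {κ = κ ⋆} (iterᵛ-step (κs ⇛ᵃ κ ⋆) j (eval (lam* κs (singᵐ ∙ t)) m) (eval (lam (descend κ)) m)) p x
      (∈-descend κ m _ a d d′ x q r i) ∷
    reach-step m j a d d′ ts xs p q r is

-- The induction axiom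

module _ {E : Set} {M : List ATy} {H : E → Vals M → Set} (I : Int (ℕ × E)) (up : Upward I) where

  private
    P₀ Q₀ SP PP : List ATy
    P₀ = P I
    Q₀ = Q I
    SP = ⟶-pos P₀ Q₀ P₀ Q₀
    PP = P₀ ++ ⟶-pos (N ∷ []) [] SP (P₀ ++ Q₀)

    K₀ K₁ : List ATy
    K₀ = M ▹ PP
    K₁ = N ∷ K₀

    next : ℕ × E → ℕ × E
    next (n , e) = suc n , e

    premise conclusion : Int E
    premise    = reindex (zero ,_) I ∧ᴵ ∀ᴵ (𝓘ᴵ N proj₁ ⟶ᴵ (I ⟶ᴵ reindex next I))
    conclusion = ∀ᴵ (𝓘ᴵ N proj₁ ⟶ᴵ I)

    bound : MTm K₁ N
    bound = var (here refl)

    start : MTms K₁ P₀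
    start = ↑* (N ∷ []) (++⁻ˡ P₀ (vars PP))

    steps′ : All (λ κ → MTm K₀ (N ⇒ κ)) SP
    steps′ = map⁻ (++⁻ˡ (map ((N ∷ []) ⇛ᵃ_) SP) (++⁻ʳ P₀ (vars PP)))

    -- The witnesses of the step expect a bound of the number. Giving them the bound of the
    -- conclusion each time makes every step the same operator.
    steps : MTms K₁ SP
    steps = All.map (λ f → ↑ (N ∷ []) f ∙ bound) steps′

    fs : FnTms K₁ P₀ P₀
    fs = map⁻ (++⁻ˡ (map (P₀ ⇛ᵃ_) P₀) steps)

    gs : CounterTms K₁ P₀ Q₀ Q₀
    gs = map⁻ (++⁻ʳ (map (P₀ ⇛ᵃ_) P₀) steps)

    result : MTms K₁ P₀
    result = iterates bound fs (vars P₀) start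

    visited : SetTms K₁ P₀
    visited = iterateSets bound fs (vars P₀) start

    reached : SetTms (K₁ ▹ Q₀) Q₀
    reached = All.map (λ {κ} f → _∙*_ {κ = κ ⋆} (↑ Q₀ f) (vars Q₀)) (reachTm bound visited gs (vars Q₀))

    -- The base is asked at the reached counterwitnesses; the step is asked at the bound, at the
    -- visited iterates and again at the reached counterwitnesses.
    counterSets : SetTms (K₁ ▹ Q₀) (Q premise)
    counterSets = ++⁺ reached ((singᵐ ∙ ↑ Q₀ bound) ∷ ++⁺ (All.map (↑ Q₀) visited) reached)

    -- Expresses the terms above through `apply` and `counter`, in which the assumed premise is
    -- formulated.
    module Values (m : Vals M) (ac : Vals PP) (k : ℕ) where

      m₁ : Vals K₁
      m₁ = k ∷ (m ▹ᵛ ac)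

      FG : Vals SP
      FG = apply (N ∷ []) [] SP (P₀ ++ Q₀) (++⁻ʳ P₀ ac) (k ∷ [])

      start≡ : evals start m₁ ≡ ++⁻ˡ P₀ ac
      start≡ = trans (evals-↑ (++⁻ˡ P₀ (vars PP)) (m ▹ᵛ ac) (k ∷ []))
        (trans (map-++⁻ˡ (λ t → eval t (m ▹ᵛ ac)) P₀ (vars PP)) (cong (++⁻ˡ P₀) (evals-vars m ac)))

      steps≡ : evals steps m₁ ≡ FG
      steps≡ = trans (β steps′)
        (cong (All.map {Q = Val} (_⟨$⟩ k))
          (trans (map-map⁻ {P = MTm K₀} {Q = Val} (λ t → eval t (m ▹ᵛ ac)) ((N ∷ []) ⇛ᵃ_)
                   (++⁻ˡ (map ((N ∷ []) ⇛ᵃ_) SP) (++⁻ʳ P₀ (vars PP))))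
          (cong (map⁻ {f = (N ∷ []) ⇛ᵃ_})
            (trans (map-++⁻ˡ (λ t → eval t (m ▹ᵛ ac)) (map ((N ∷ []) ⇛ᵃ_) SP) (++⁻ʳ P₀ (vars PP)))
          (cong (++⁻ˡ (map ((N ∷ []) ⇛ᵃ_) SP)) (trans (map-++⁻ʳ (λ t → eval t (m ▹ᵛ ac)) P₀ (vars PP))
          (cong (++⁻ʳ P₀) (evals-vars m ac))))))))
        where
        β : ∀ {κs} (ts : All (λ κ → MTm K₀ (N ⇒ κ)) κs) →
            evals (All.map (λ f → ↑ (N ∷ []) f ∙ bound) ts) m₁ ≡
            All.map {Q = Val} (_⟨$⟩ k) (All.map {Q = λ κ → Val (N ⇒ κ)} (λ t → eval t (m ▹ᵛ ac)) ts)
        β []       = refl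
        β (t ∷ ts) = cong₂ _∷_ (cong (_⟨$⟩ k) (eval-↑ t (m ▹ᵛ ac) (k ∷ []))) (β ts)

      apply≡ : ∀ a → appsᵛ fs m₁ a ≡ apply P₀ Q₀ P₀ Q₀ FG a
      apply≡ a = trans (go (++⁻ˡ (map (P₀ ⇛ᵃ_) P₀) steps))
        (cong (λ v → All.map {Q = Val} (_·ᵛ a) (map⁻ {f = P₀ ⇛ᵃ_} v))
          (trans (map-++⁻ˡ (λ t → eval t m₁) (map (P₀ ⇛ᵃ_) P₀) steps)
                 (cong (++⁻ˡ (map (P₀ ⇛ᵃ_) P₀)) steps≡)))
        where
        go : ∀ {κs} (ts : MTms K₁ (map (P₀ ⇛ᵃ_) κs)) →
             appsᵛ (map⁻ {xs = κs} ts) m₁ a ≡ All.map {Q = Val} (_·ᵛ a) (map⁻ {f = P₀ ⇛ᵃ_} (evals ts m₁))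
        go {[]}     []       = refl
        go {κ ∷ κs} (t ∷ ts) = cong (_ ∷_) (go ts)

      counter≡ : ∀ a d → countersᵛ gs m₁ a d ≡ counter P₀ Q₀ P₀ Q₀ FG a d
      counter≡ a d = trans (go (++⁻ʳ (map (P₀ ⇛ᵃ_) P₀) steps))
        (cong (λ v → All.map {Q = λ κ → Val (κ ⋆)} (λ g → g ·ᵛ a ·ᵛ d) (map⁻ {f = cTy} v))
          (trans (map-++⁻ʳ (λ t → eval t m₁) (map (P₀ ⇛ᵃ_) P₀) steps)
                 (cong (++⁻ʳ (map (P₀ ⇛ᵃ_) P₀)) steps≡)))
        where
        cTy : ATy → ATy
        cTy ρ = P₀ ⇛ᵃ (Q₀ ⇛ᵃ ρ ⋆)

        go : ∀ {κs} (ts : MTms K₁ (map cTy κs)) →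
             countersᵛ (map⁻ {xs = κs} ts) m₁ a d ≡
             All.map {Q = λ κ → Val (κ ⋆)} (λ g → g ·ᵛ a ·ᵛ d) (map⁻ {f = cTy} (evals ts m₁))
        go {[]}     []       = refl
        go {κ ∷ κs} (t ∷ ts) = cong (_ ∷_) (go ts)

      reach₁ : ℕ → Vals Q₀ → Sets Q₀
      reach₁ j d = reach bound visited gs m₁ j d (vars Q₀)

      reached≡ : ∀ b → evalSets reached (m₁ ▹ᵛ b) ≡ reach₁ k b
      reached≡ b = go (vars Q₀)
        where
        go : ∀ {κs} (ts : MTms (K₁ ▹ Q₀) κs) →
             evalSets (All.map (λ {κ} f → _∙*_ {κ = κ ⋆} (↑ Q₀ f) (vars Q₀)) (reachTm bound visited gs ts))
                      (m₁ ▹ᵛ b) ≡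
             reach bound visited gs m₁ k b ts
        go []                   = refl
        go (_∷_ {x = κ} t ts) = cong₂ _∷_
          (trans (eval-∙* (κ ⋆) (↑ Q₀ f) (vars Q₀) (m₁ ▹ᵛ b))
            (cong₂ (_·ᵛ_ {κ = κ ⋆}) (eval-↑ f m₁ b) (evals-vars m₁ b))) (go ts)
          where f = iterᵐ (Q₀ ⇛ᵃ κ ⋆) ∙ bound ∙ lam* Q₀ (singᵐ ∙ t) ∙ lam (descend bound visited gs κ)

      counterSets≡ : ∀ b → evalSets counterSets (m₁ ▹ᵛ b) ≡
                     ++⁺ (reach₁ k b) ((k List⁺.∷ []) ∷ ++⁺ (evalSets visited m₁) (reach₁ k b))
      counterSets≡ b = trans (evalSets-++ reached _ (m₁ ▹ᵛ b)) (cong₂ ++⁺ (reached≡ b)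
        (cong₂ _∷_ (cong (List⁺._∷ []) (eval-↑ bound m₁ b))
          (trans (evalSets-++ (All.map (↑ Q₀) visited) reached (m₁ ▹ᵛ b))
            (cong₂ ++⁺ (evalSets-↑ visited m₁ b) (reached≡ b)))))

  real-ind : Real M H (premise ⟶ᴵ conclusion)
  real-ind = real-⟶ premise conclusion (abstract-⟶ (N ∷ []) [] P₀ Q₀ result []) counterSets sound
    where
    sound : ∀ e m ac kb → Mon* m → H e m → Mon* ac → Mon* kb →
            ∀∈* (evalSets counterSets (m ▹ᵛ ac ▹ᵛ kb)) (holds premise e ac) →
            holds conclusion e (evals (abstract-⟶ (N ∷ []) [] P₀ Q₀ result []) (m ▹ᵛ ac)) kb
    sound e m ac (k ∷ b) mm _ mac (mk ∷ mb) hyp n n≤k =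
      subst (λ a → holds I (n , e) a b)
        (sym (apply-abstract-⟶ (N ∷ []) [] P₀ Q₀ result [] (m ▹ᵛ ac) (k ∷ [])))
        -- By `claim` the `n`-th iterate realizes the instance at `n`; upward closure then allows
        -- the join of all iterates, which does not depend on `n`.
        (up (n , e) (a n) _ b (a-mon n) (evals-mono result mm₁) mb
          (subst (_⊑* evals result m₁) (evals-vars m₁ (a n))
            (iterates-⊑ bound fs (vars P₀) start m₁ mm₁ n n≤k′))
          (claim k b mb (λ _ i → i) n n≤k′ n≤k′))
      where
      open Values m ac k

      n≤k′ : n ≤ k
      n≤k′ = n≤k [] [] ([]∈* _)

      mm₁ : Mon* m₁
      mm₁ = mk ∷ ▹-≤* mm mac

      a : ℕ → Vals P₀
      a j = pow (appsᵛ fs m₁) j (evals start m₁)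

      a-mon : ∀ j → Mon* (a j)
      a-mon = pow-mon bound fs mm₁ (evals-mono start mm₁)

      a∈visited : ∀ j → j ≤ k → a j ∈* evalSets visited m₁
      a∈visited j r = subst (_∈* evalSets visited m₁) (evals-vars m₁ (a j))
        (iterateSets-∈ bound fs (vars P₀) start m₁ mm₁ j r)

      ∈-reach : ∀ j d → Mon* d → d ∈* reach₁ j d
      ∈-reach j d p = subst (_∈* reach₁ j d) (evals-vars m₁ d)
        (reach-refl bound visited gs m₁ j d (vars Q₀) p)

      -- One instance of the premise, with `d` as counterwitness of the base and `k`, `c`, `d` as
      -- those of the step, gives both parts for all `l` up to `k`.
      use : ∀ c d → Mon* c → Mon* d → c ∈* evalSets visited m₁ → d ∈* reach₁ k b →
            holds I (zero , e) (evals start m₁) d ×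
            (∀ l → l ≤ k → ∀∈* (countersᵛ gs m₁ c d) (holds I (l , e) c) →
              holds I (suc l , e) (appsᵛ fs m₁ c) d)
      use c d p q i j =
        subst₂ (holds I (zero , e)) (sym start≡) (++⁻ˡ-++⁺ d (k ∷ ++⁺ c d)) (proj₁ h) ,
        λ l r f → subst₂ (holds I (suc l , e)) 
          (sym (trans (cong (appsᵛ fs m₁) (sym (++⁻ˡ-++⁺ c d))) (apply≡ (++⁻ˡ P₀ (++⁺ c d)))))
          (++⁻ʳ-++⁺ c d)
          (h₂ l (λ _ _ _ → r) (subst₂ (λ bs a → ∀∈* bs (holds I (l , e) a))
            (trans (counter≡ c d) (sym (cong₂ (counter P₀ Q₀ P₀ Q₀ FG) (++⁻ˡ-++⁺ c d) (++⁻ʳ-++⁺ c d))))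
            (sym (++⁻ˡ-++⁺ c d)) f))
        where
        h : holds premise e ac (++⁺ d (k ∷ ++⁺ c d))
        h = hyp _ (++-≤* q (mk ∷ ++-≤* p q))
          (subst (++⁺ d (k ∷ ++⁺ c d) ∈*_) (sym (counterSets≡ b)) (++-∈* j (∈-sing N k ∷ ++-∈* i j)))

        h₂ : holds (∀ᴵ (𝓘ᴵ N proj₁ ⟶ᴵ (I ⟶ᴵ reindex next I))) e (++⁻ʳ P₀ ac) (k ∷ ++⁺ c d)
        h₂ = subst (holds (∀ᴵ (𝓘ᴵ N proj₁ ⟶ᴵ (I ⟶ᴵ reindex next I))) e (++⁻ʳ P₀ ac))
               (++⁻ʳ-++⁺ d (k ∷ ++⁺ c d)) (proj₂ h)

      -- Here `j` counts the steps still available from `d`, and the inclusion keeps everything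
      -- reachable from `d` within what is reachable from `b`. Proving the instance at `suc l` needs
      -- the instance at `l` for the tuples `d′` one step further, at the cost of one unit of `j`.
      claim : ∀ j d → Mon* d → (∀ xs → xs ∈* reach₁ j d → xs ∈* reach₁ k b) →
              ∀ l → l ≤ j → l ≤ k → holds I (l , e) (a l) d
      claim j d p s zero _ _ =
        proj₁ (use (a zero) d (a-mon zero) p (a∈visited zero z≤n) (s d (∈-reach j d p)))
      claim (suc j) d p s (suc l) (s≤s q) r =
        proj₂ (use (a l) d (a-mon l) p (a∈visited l l≤k) (s d (∈-reach (suc j) d p))) l l≤k λ d′ p′ i →
          claim j d′ p′
            (λ xs t → s xs (reach-step bound visited gs m₁ j (a l) d d′ (vars Q₀) xs p (a∈visited l l≤k) i t))
            l q l≤k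
        where
        l≤k : l ≤ k
        l≤k = ≤-trans (n≤1+n l) r

-- Hypotheses, weakening and projections

real-hyp : {R : E → Vals ρs → Vals [] → Set} → Real (M ▹ ρs) (Ext H R) (int ρs [] R)
real-hyp {ρs = ρs} {R = R} = real (vars ρs) λ { e _ _ (ext m a _ _ _ r) [] _ →
  subst (λ a → R e a []) (sym (evals-vars m a)) r }

real-wk : {R : E × X → Vals ρs → Vals [] → Set} {I : Int E} → Real M H I →
          Real (M ▹ ρs) (Ext (H ∘ proj₁) R) (reindex proj₁ I)
real-wk {ρs = ρs} {I = I} (real w s) = real (↑* ρs w) λ { e _ _ (ext m a n _ h _) b k →
  subst (λ w → holds I (proj₁ e) w b) (sym (evals-↑ w m a)) (s (proj₁ e) m n h b k) }

Pos : {ρs : List ATy} → (E → Vals ρs → Set) → Int E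
Pos {ρs = ρs} R = int ρs [] (λ e a _ → R e a)

real-++ˡ : {R : E → Vals (ρs ++ κs) → Set} {S : E → Vals ρs → Set} →
           (∀ e a → R e a → S e (++⁻ˡ ρs a)) → Real M H (Pos R) → Real M H (Pos S)
real-++ˡ {ρs = ρs} {S = S} h (real w s) = real (++⁻ˡ ρs w) λ { e m n k [] l →
  subst (S e) (sym (map-++⁻ˡ (λ t → eval t m) ρs w)) (h e _ (s e m n k [] l)) }

real-++ʳ : {R : E → Vals (ρs ++ κs) → Set} {S : E → Vals κs → Set} →
           (∀ e a → R e a → S e (++⁻ʳ ρs a)) → Real M H (Pos R) → Real M H (Pos S)
real-++ʳ {ρs = ρs} {S = S} h (real w s) = real (++⁻ʳ ρs w) λ { e m n k [] l →
  subst (S e) (sym (map-++⁻ʳ (λ t → eval t m) ρs w)) (h e _ (s e m n k [] l)) }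

real-𝓘-≡ : (p : Finite σ) {x y : E → ∣ σ ∣} → (∀ e → x e ≡ y e) → Real M H (𝓘ᴵ p x) → Real M H (𝓘ᴵ p y)
real-𝓘-≡ p h (real w s) = real w λ e m n k b l →
  subst (λ x → smaj p x (evals w m)) (h e) (s e m n k b l)

-- Abstraction and application for majorants

smaj⇒-trivial : ∀ σ τ m n (R : SMaj σ m) (S : SMaj τ n) → m ⇒† n ≡ nothing → ∀ f a → smaj⇒ σ τ m n R S f a
smaj⇒-trivial σ τ nothing  nothing  R S _ f a = tt
smaj⇒-trivial σ τ (just α) nothing  R S _ f a = tt
smaj⇒-trivial σ τ nothing  (just β) R S ()
smaj⇒-trivial σ τ (just α) (just β) R S ()

smaj-trivial : (p : Finite σ) → p † ≡ nothing → ∀ x a → smaj p x a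
smaj-trivial N ()
smaj-trivial B _ x a = tt
smaj-trivial (_⇒_ {σ} {τ} p q) = smaj⇒-trivial σ τ (p †) (q †) (smaj p) (smaj q)

-- If the domain is bounded, its elements carry no majorant, and one bound of all values majorizes
-- the function; if the codomain is bounded, there is nothing to provide.
lam† : ∀ m n → MTms (M ▹ posᵐᵇ m) (posᵐᵇ n) → MTms M (posᵐᵇ (m ⇒† n))
lam† nothing  nothing  _        = []
lam† (just α) nothing  _        = []
lam† nothing  (just β) ts       = ts
lam† (just α) (just β) (t ∷ []) = lam t ∷ []

-- The monotonicity clause comes from `eval-mono`. For a bounded domain every `x` satisfies `R`, so
-- the bound is uniform.
lam†-sound : ∀ σ τ m n (R : SMaj σ m) (S : SMaj τ n) →
             (m ≡ nothing → ∀ x a → R x a) → (∀ x a → R x a → Mon* a) →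
             (ts : MTms (M ▹ posᵐᵇ m) (posᵐᵇ n)) (f : ∣ σ ⇒ τ ∣) (v : Vals M) → Mon* v →
             (∀ x a → R x a → S (f ⟨$⟩ x) (evals ts (v ▹ᵛ a))) →
             smaj⇒ σ τ m n R S f (evals (lam† m n ts) v)
lam†-sound σ τ nothing  nothing  R S _ _ ts f v k h = tt
lam†-sound σ τ (just α) nothing  R S _ _ ts f v k h = tt
lam†-sound σ τ nothing  (just β) R S r _ (t ∷ []) f v k h = (λ x → h x [] (r refl x [])) , eval-mono t k
lam†-sound σ τ (just α) (just β) R S _ _ (t ∷ []) f v k h =
  (λ x a r → subst (λ c → S (f ⟨$⟩ x) (c ∷ [])) (sym (eval-lam t v a)) (h x (a ∷ []) r)) ,
  λ z a p → subst₂ (le β) (sym (eval-lam t v z)) (sym (eval-lam t v a)) (eval-mono t (p ∷ k))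

app† : ∀ m n → MTms M (posᵐᵇ (m ⇒† n)) → MTms M (posᵐᵇ m) → MTms M (posᵐᵇ n)
app† nothing  nothing  _        _        = []
app† (just α) nothing  _        _        = []
app† nothing  (just β) ts       _        = ts
app† (just α) (just β) (t ∷ []) (s ∷ []) = t ∙ s ∷ []

app†-sound : ∀ σ τ m n (R : SMaj σ m) (S : SMaj τ n) → (n ≡ nothing → ∀ x a → S x a) →
             (ts : MTms M (posᵐᵇ (m ⇒† n))) (ss : MTms M (posᵐᵇ m))
             (f : ∣ σ ⇒ τ ∣) (x : ∣ σ ∣) (v : Vals M) →
             smaj⇒ σ τ m n R S f (evals ts v) → R x (evals ss v) → S (f ⟨$⟩ x) (evals (app† m n ts ss) v)
app†-sound σ τ nothing  nothing  R S r ts ss f x v h k = r refl _ _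
app†-sound σ τ (just α) nothing  R S r ts ss f x v h k = r refl _ _
app†-sound σ τ nothing  (just β) R S r (t ∷ []) [] f x v h k = proj₁ h x
app†-sound σ τ (just α) (just β) R S r (t ∷ []) (s ∷ []) f x v h k = proj₁ h x _ k

Under : (p : Finite σ) (H : E → Vals M → Set) → E × ∣ σ ∣ → Vals (M ▹ posᵐᵇ (p †)) → Set
Under {σ = σ} {E = E} p H = Ext {E = E × ∣ σ ∣} (H ∘ proj₁) (λ e a _ → smaj p (proj₂ e) a)

real-lam : (p : Finite σ) (q : Finite τ) (f : E → ∣ σ ⇒ τ ∣) →
           Real (M ▹ posᵐᵇ (p †)) (Under p H) (𝓘ᴵ q (λ e → f (proj₁ e) ⟨$⟩ proj₂ e)) →
           Real M H (𝓘ᴵ (p ⇒ q) f)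
real-lam {σ} {τ} p q f (real w s) = real (lam† (p †) (q †) w) λ e m n h b l →
  lam†-sound σ τ (p †) (q †) (smaj p) (smaj q) (smaj-trivial p) (λ x a → smaj-mon p {x} {a}) w (f e) m n
    λ x a r → s (e , x) (m ▹ᵛ a) (▹-≤* n (smaj-mon p {x} r)) (ext m a n (smaj-mon p {x} r) h r) [] []

real-app : (p : Finite σ) (q : Finite τ) {f : E → ∣ σ ⇒ τ ∣} {x : E → ∣ σ ∣} →
           Real M H (𝓘ᴵ (p ⇒ q) f) → Real M H (𝓘ᴵ p x) → Real M H (𝓘ᴵ q (λ e → f e ⟨$⟩ x e))
real-app {σ} {τ} p q {f} {x} (real w s) (real w′ s′) = real (app† (p †) (q †) w w′) λ e m n h b l →
  app†-sound σ τ (p †) (q †) (smaj p) (smaj q) (smaj-trivial q) w w′ (f e) (x e) m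
    (s e m n h [] []) (s′ e m n h [] [])

-- For `Condᶜ`: the witnesses do not see which of the two values is chosen, so both are majorized at
-- once.
real-join : (p : Finite σ) {x y z : E → ∣ σ ∣} → (∀ e → z e ≡ x e ⊎ z e ≡ y e) →
            Real M H (𝓘ᴵ p x) → Real M H (𝓘ᴵ p y) → Real M H (𝓘ᴵ p z)
real-join p {x} {y} {z} c (real w s) (real w′ s′) = real (join* w w′) λ e m n h b l →
  case c e of λ
    { (inj₁ eq) → subst (λ u → smaj p u _) (sym eq)
        (smaj-⊑ p (s e m n h [] []) (join*-⊑ˡ w w′ m) (evals-mono (join* w w′) n))
    ; (inj₂ eq) → subst (λ u → smaj p u _) (sym eq)
        (smaj-⊑ p (s′ e m n h [] []) (join*-⊑ʳ w w′ m) (evals-mono (join* w w′) n)) }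

-- Majorants of tuples and simultaneous recursion

dag : All Finite σs → List ATy
dag []       = []
dag (p ∷ ps) = posᵐᵇ (p †) ++ dag ps

smaj* : (ps : All Finite σs) → Env σs → Vals (dag ps) → Set
smaj* []       _       _ = ⊤
smaj* (p ∷ ps) (x , η) a = smaj p x (++⁻ˡ (posᵐᵇ (p †)) a) × smaj* ps η (++⁻ʳ (posᵐᵇ (p †)) a)

𝓘* : (ps : All Finite σs) → (E → Env σs) → Int E
𝓘* ps x = Pos (λ e a → smaj* ps (x e) a)

smaj*-mon : (ps : All Finite σs) (η : Env σs) (a : Vals (dag ps)) → smaj* ps η a → Mon* a
smaj*-mon []       _       []  _       = []
smaj*-mon (p ∷ ps) (x , η) a   (h , k) =
  subst Mon* (++⁺-++⁻ (posᵐᵇ (p †)) a) (++-≤* (smaj-mon p h) (smaj*-mon ps η _ k))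
  where
  ++⁺-++⁻ : ∀ xs {ys} (a : Vals (xs ++ ys)) → ++⁺ (++⁻ˡ xs a) (++⁻ʳ xs a) ≡ a
  ++⁺-++⁻ []       a       = refl
  ++⁺-++⁻ (x ∷ xs) (y ∷ a) = cong (y ∷_) (++⁺-++⁻ xs a)

smaj*-⊑ : (ps : All Finite σs) (η : Env σs) (a b : Vals (dag ps)) →
          smaj* ps η a → a ⊑* b → Mon* b → smaj* ps η b
smaj*-⊑ []       _       a b _       _ _ = tt
smaj*-⊑ (p ∷ ps) (x , η) a b (h , k) s m =
  smaj-⊑ p h (++⁻ˡ-⊑* {posᵐᵇ (p †)} s) (++⁻ˡ-≤* {posᵐᵇ (p †)} m) ,
  smaj*-⊑ ps η _ _ k (++⁻ʳ-⊑* {posᵐᵇ (p †)} s) (++⁻ʳ-≤* {posᵐᵇ (p †)} m)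

real-[] : {x : E → Env []} → Real M H (𝓘* [] x)
real-[] = real [] λ _ _ _ _ _ _ → tt

real-∷ : (p : Finite σ) (ps : All Finite σs) {x : E → ∣ σ ∣} {y : E → Env σs} →
         Real M H (𝓘ᴵ p x) → Real M H (𝓘* ps y) → Real M H (𝓘* (p ∷ ps) (λ e → x e , y e))
real-∷ p ps {x} {y} (real w s) (real w′ s′) = real (++⁺ w w′) λ e m n h b l →
  let ev = map-++⁺ (λ t → eval t m) w w′ in
  subst (smaj p (x e)) (sym (trans (cong (++⁻ˡ (posᵐᵇ (p †))) ev) (++⁻ˡ-++⁺ _ (evals w′ m))))
    (s e m n h [] []) ,
  subst (smaj* ps (y e)) (sym (trans (cong (++⁻ʳ (posᵐᵇ (p †))) ev) (++⁻ʳ-++⁺ (evals w m) _)))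
    (s′ e m n h [] [])

real-head : (p : Finite σ) (ps : All Finite σs) {x : E → Env (σ ∷ σs)} →
            Real M H (𝓘* (p ∷ ps) x) → Real M H (𝓘ᴵ p (proj₁ ∘ x))
real-head p ps {x} = real-++ˡ {S = λ e a → smaj p (proj₁ (x e)) a} (λ _ _ → proj₁)

real-tail : (p : Finite σ) (ps : All Finite σs) {x : E → Env (σ ∷ σs)} →
            Real M H (𝓘* (p ∷ ps) x) → Real M H (𝓘* ps (proj₂ ∘ x))
real-tail p ps {x} = real-++ʳ {ρs = posᵐᵇ (p †)} {S = λ e a → smaj* ps (proj₂ (x e)) a} (λ _ _ → proj₂)

real-lookup : (ps : All Finite σs) (i : σ ∈ σs) {x : E → Env σs} →
              Real M H (𝓘* ps x) → Real M H (𝓘ᴵ (All.lookup ps i) (λ e → lookupₛ i ⟨$⟩ x e))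
real-lookup (p ∷ ps) (here refl) r = real-head p ps r
real-lookup (p ∷ ps) (there i)   r = real-lookup ps i (real-tail p ps r)

fin⇛ : All Finite σs → Finite τ → Finite (σs ⇛ τ)
fin⇛ []       q = q
fin⇛ (p ∷ ps) q = p ⇒ fin⇛ ps q

real-app* : (ps : All Finite σs) (q : Finite τ) {f : E → ∣ σs ⇛ τ ∣} {x : E → Env σs} →
            Real M H (𝓘ᴵ (fin⇛ ps q) f) → Real M H (𝓘* ps x) → Real M H (𝓘ᴵ q (λ e → app* σs (f e) (x e)))
real-app* []       q r s = r
real-app* (p ∷ ps) q r s = real-app* ps q (real-app p (fin⇛ ps q) r (real-head p ps s)) (real-tail p ps s)

Under* : (ps : All Finite σs) (H : E → Vals M → Set) → E × Env σs → Vals (M ▹ dag ps) → Set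
Under* {σs = σs} {E = E} ps H = Ext {E = E × Env σs} (H ∘ proj₁) (λ e a _ → smaj* ps (proj₂ e) a)

-- The two contexts become definitionally equal once it is known whether `m` is empty, so the terms
-- stay as they are.
regroup : ∀ m → MTms (M ▹ (posᵐᵇ m ++ ρs)) κs → MTms (M ▹ posᵐᵇ m ▹ ρs) κs
regroup nothing  ts = ts
regroup (just α) ts = ts

evals-regroup : ∀ m (ts : MTms (M ▹ (posᵐᵇ m ++ ρs)) κs) (v : Vals M) (a : Vals (posᵐᵇ m)) (b : Vals ρs) →
                evals (regroup m ts) (v ▹ᵛ a ▹ᵛ b) ≡ evals ts (v ▹ᵛ ++⁺ a b)
evals-regroup nothing  ts v []       b = refl
evals-regroup (just α) ts v (x ∷ []) b = refl

real-lam* : (ps : All Finite σs) (q : Finite τ) (f : E → ∣ σs ⇛ τ ∣) →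
            Real (M ▹ dag ps) (Under* ps H) (𝓘ᴵ q (λ e → app* σs (f (proj₁ e)) (proj₂ e))) →
            Real M H (𝓘ᴵ (fin⇛ ps q) f)
real-lam* [] q f (real w s) = real w λ e m n h b l → s (e , tt) m n (ext m [] n [] h tt) b l
real-lam* {σs = σ ∷ σs} (p ∷ ps) q f (real w s) = real-lam p (fin⇛ ps q) f
  (real-lam* ps q (λ e → f (proj₁ e) ⟨$⟩ proj₂ e) (real (regroup (p †) w)
    λ { ((e , x) , η) _ _ (ext _ b _ l (ext m a n k h r) r′) _ _ →
      subst (smaj q (app* σs (f e ⟨$⟩ x) η)) (sym (evals-regroup (p †) w m a b))
        (s (e , x , η) (m ▹ᵛ ++⁺ a b) (▹-≤* n (++-≤* k l))
          (ext m (++⁺ a b) n (++-≤* k l) h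
            ( subst (smaj p x) (sym (++⁻ˡ-++⁺ a b)) r
            , subst (smaj* ps η) (sym (++⁻ʳ-++⁺ a b)) r′)) [] []) }))

stepFin : All Finite σs → All Finite τs → All Finite (map (StepTy σs) τs)
stepFin ps []       = []
stepFin ps (q ∷ qs) = (N ⇒ fin⇛ ps q) ∷ stepFin ps qs

real-step : (ps : All Finite σs) (qs : All Finite τs)
            {f : E → Env (map (StepTy σs) τs)} {k : E → ℕ} {x : E → Env σs} →
            Real M H (𝓘* (stepFin ps qs) f) → Real M H (𝓘ᴵ N k) → Real M H (𝓘* ps x) →
            Real M H (𝓘* qs (λ e → step σs τs (f e) (k e) (x e)))
real-step ps []       r s t = real-[]
real-step ps (q ∷ qs) r s t =
  real-∷ q qs (real-app* ps q (real-app N (fin⇛ ps q) (real-head (N ⇒ fin⇛ ps q) (stepFin ps qs) r) s) t)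
              (real-step ps qs (real-tail (N ⇒ fin⇛ ps q) (stepFin ps qs) r) s t)

appsᵛ-lam* : (ts : MTms (K ▹ ρs) κs) (m : Vals K) (a : Vals ρs) →
             appsᵛ (All.map (lam* ρs) ts) m a ≡ evals ts (m ▹ᵛ a)
appsᵛ-lam* []                   m a = refl
appsᵛ-lam* (_∷_ {x = κ} t ts) m a = cong₂ _∷_ (eval-lam* κ t m a) (appsᵛ-lam* ts m a)

module _ {E : Set} {M : List ATy} {H : E → Vals M → Set} (ps : All Finite σs)
         {n : E → ℕ} {ws : E → Env σs} {fs : E → Env (map (StepTy σs) σs)}
         (rn : Real M H (𝓘ᴵ N n)) (rws : Real M H (𝓘* ps ws)) (rfs : Real M H (𝓘* (stepFin ps ps) fs)) where

  private
    recBound : MTm M N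
    recBound = All.head (wit rn)

    -- Assuming that the index lies below the bound makes the fixed term `recBound` a majorant of
    -- every index that occurs in the recursion.
    Below : E × ℕ → Vals M → Set
    Below (e , k) m = H e m × k ≤ eval recBound m

    index : Real M Below (𝓘ᴵ N proj₂)
    index = real (recBound ∷ []) λ _ _ _ h _ _ → proj₂ h

    recSteps : Real M Below (𝓘* (stepFin ps ps) (fs ∘ proj₁))
    recSteps = real (wit rfs) λ e m k h → sat rfs (proj₁ e) m k (proj₁ h)

    recBody : Real (M ▹ dag ps) (Under* ps Below)
                   (𝓘* ps (λ e → step σs σs (fs (proj₁ (proj₁ e))) (proj₂ (proj₁ e)) (proj₂ e)))
    recBody = real-step ps ps (real-wk recSteps) (real-wk index) real-hyp

    recΦ : FnTms M (dag ps) (dag ps)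
    recΦ = All.map (lam* (dag ps)) (wit recBody)

  -- With each step f k replaced by f at a bound of n, the recursion becomes an
  -- iteration of a fixed operator.
  real-rec : Real M H (𝓘* ps (λ e → simRec σs (n e) (ws e) (fs e)))
  real-rec = real (iterates recBound recΦ (vars (dag ps)) (wit rws)) sound
    where
    sound : ∀ e m → Mon* m → H e m → ∀ b → Mon* b →
            smaj* ps (simRec σs (n e) (ws e) (fs e))
              (evals (iterates recBound recΦ (vars (dag ps)) (wit rws)) m)
    -- Stage `j` of the recursion is majorized by the `j`-th iterate. Since only a bound of `n e` is
    -- available as a term, the join of the iterates up to this bound is taken.
    sound e m k h _ _ = smaj*-⊑ ps _ _ _ (go (n e) n≤)
      (subst (_⊑* evals (iterates recBound recΦ (vars (dag ps)) (wit rws)) m) (evals-vars m (a (n e)))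
        (iterates-⊑ recBound recΦ (vars (dag ps)) (wit rws) m k (n e) n≤))
      (evals-mono (iterates recBound recΦ (vars (dag ps)) (wit rws)) k)
      where
      a : ℕ → Vals (dag ps)
      a j = pow (appsᵛ recΦ m) j (evals (wit rws) m)

      n≤ : n e ≤ eval recBound m
      n≤ with wit rn | sat rn e m k h [] []
      ... | t ∷ [] | r = r

      go : ∀ j → j ≤ eval recBound m → smaj* ps (simRec σs j (ws e) (fs e)) (a j)
      go zero    _ = sat rws e m k h [] []
      go (suc j) l = subst (smaj* ps (simRec σs (suc j) (ws e) (fs e)))
        (sym (appsᵛ-lam* (wit recBody) m (a j)))
        (sat recBody ((e , j) , simRec σs j (ws e) (fs e)) (m ▹ᵛ a j) (▹-≤* k mon)
          (ext m (a j) k mon (h , j≤) ih) [] [])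
        where
        j≤ : j ≤ eval recBound m
        j≤ = ≤-trans (n≤1+n j) l

        ih : smaj* ps (simRec σs j (ws e) (fs e)) (a j)
        ih = go j j≤

        mon : Mon* (a j)
        mon = smaj*-mon ps _ _ ih

-- The constants of HAω

-- Allows an arbitrary derivation that the type of a constant is finite to be replaced by
-- `constFin`.
Finite-irrelevant : (p q : Finite σ) → p ≡ q
Finite-irrelevant N       N         = refl
Finite-irrelevant B       B         = refl
Finite-irrelevant (p ⇒ q) (p′ ⇒ q′) = cong₂ _⇒_ (Finite-irrelevant p p′) (Finite-irrelevant q q′)

constFin : HAConst σ → Finite σ
constFin (Πᶜ p q)   = p ⇒ q ⇒ p
constFin (Σᶜ p q r) = (p ⇒ q ⇒ r) ⇒ (p ⇒ q) ⇒ p ⇒ r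
constFin 0ᴺ         = N
constFin Sᴺ         = N ⇒ N
constFin (Rᶜ ps i)  = N ⇒ fin⇛ ps (fin⇛ (stepFin ps ps) (All.lookup ps i))
constFin 0ᴮ         = B
constFin 1ᴮ         = B
constFin (Condᶜ p)  = B ⇒ p ⇒ p ⇒ p

app*-curry* : (Y : Setoid 0ℓ 0ℓ) (σs : List Ty) (f : Func (Y ×ₛ 𝒮* σs) (𝒮 τ))
              (y : Setoid.Carrier Y) (η : Env σs) →
              app* {τ} σs (curry*ₛ {τ} Y σs f ⟨$⟩ y) η ≡ f ⟨$⟩ (y , η)
app*-curry* Y []       f y tt      = refl
app*-curry* Y (σ ∷ σs) f y (x , η) = app*-curry* (Y ×ₛ 𝒮 σ) σs _ (y , x) η

app*-Rᶜ : ∀ {P} {σs : List Ty} (ps : All P σs) (i : σ ∈ σs) (n : ℕ) (ws : Env σs)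
          (fs : Env (map (StepTy σs) σs)) →
          app* {σ} (map (StepTy σs) σs) (app* σs (⟦ Rᶜ ps i ⟧ᶜ ⟨$⟩ n) ws) fs ≡ lookupₛ i ⟨$⟩ simRec σs n ws fs
app*-Rᶜ {σ} {σs = σs} ps i n ws fs =
  trans (cong (λ g → app* {σ} (map (StepTy σs) σs) g fs)
              (app*-curry* {map (StepTy σs) σs ⇛ σ} (𝒮 N) σs _ n ws))
        (app*-curry* {σ} (𝒮 N ×ₛ 𝒮* σs) (map (StepTy σs) σs) _ (n , ws) fs)

real-const : (c : HAConst σ) → Real M H (𝓘ᴵ {E = E} (constFin c) (λ _ → ⟦ embedConst c ⟧ᵀ))
real-const {E = E} (Πᶜ p q) = real-lam p (q ⇒ p) (λ _ → ⟦ embedConst (Πᶜ p q) ⟧ᵀ)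
  (real-lam q p (λ e → ⟦ embedConst (Πᶜ p q) ⟧ᵀ ⟨$⟩ proj₂ e) (real-wk real-hyp))
real-const (Σᶜ p q r) = real-lam (p ⇒ q ⇒ r) ((p ⇒ q) ⇒ p ⇒ r) (λ _ → c)
  (real-lam (p ⇒ q) (p ⇒ r) (λ e → c ⟨$⟩ proj₂ e)
  (real-lam p r (λ e → (c ⟨$⟩ proj₂ (proj₁ e)) ⟨$⟩ proj₂ e)
  (real-app q r (real-app p (q ⇒ r) (real-wk (real-wk real-hyp)) real-hyp)
                (real-app p q (real-wk real-hyp) real-hyp))))
  where c = ⟦ embedConst (Σᶜ p q r) ⟧ᵀ
real-const 0ᴺ = real (zeroᵐ ∷ []) λ _ _ _ _ _ _ → z≤n
real-const Sᴺ = real-lam N N (λ _ → ⟦ embedConst Sᴺ ⟧ᵀ)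
  (real (sucᵐ ∙ var (here refl) ∷ []) λ { e _ _ (ext m (a ∷ []) _ _ _ p) _ _ → s≤s p })
real-const 0ᴮ = real [] λ _ _ _ _ _ _ → tt
real-const 1ᴮ = real [] λ _ _ _ _ _ _ → tt
real-const {E = E} (Condᶜ {σ} p) = real-lam B (p ⇒ p ⇒ p) (λ _ → c)
  (real-lam p (p ⇒ p) (λ e → c ⟨$⟩ proj₂ e)
  (real-lam p p (λ e → (c ⟨$⟩ proj₂ (proj₁ e)) ⟨$⟩ proj₂ e)
  (real-join p cases (real-wk real-hyp) real-hyp)))
  where
  c : ∣ B ⇒ σ ⇒ σ ⇒ σ ∣
  c = ⟦ embedConst (Condᶜ p) ⟧ᵀ

  cases : (e : ((E × Bool) × ∣ σ ∣) × ∣ σ ∣) → let ((_ , b) , x) , y = e in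
          ((c ⟨$⟩ b) ⟨$⟩ x) ⟨$⟩ y ≡ x ⊎ ((c ⟨$⟩ b) ⟨$⟩ x) ⟨$⟩ y ≡ y
  cases (((_ , false) , _) , _) = inj₁ refl
  cases (((_ , true)  , _) , _) = inj₂ refl
real-const (Rᶜ {σs = σs} ps i) =
  real-lam N (fin⇛ ps (fin⇛ (stepFin ps ps) q)) (λ _ → c)
  (real-lam* ps (fin⇛ (stepFin ps ps) q) (λ e → c ⟨$⟩ proj₂ e)
  (real-lam* (stepFin ps ps) q (λ e → app* σs (c ⟨$⟩ proj₂ (proj₁ e)) (proj₂ e))
  (real-𝓘-≡ q (λ { (((_ , n) , ws) , fs) → sym (app*-Rᶜ (All.map (λ _ → tt) ps) i n ws fs) })
  (real-lookup ps i (real-rec ps (real-wk (real-wk real-hyp)) (real-wk real-hyp) real-hyp)))))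
  where
  q = All.lookup ps i
  c = ⟦ embedConst (Rᶜ ps i) ⟧ᵀ

-- The axioms of HAω

module _ (η : Env Γ) where

  values : All (HATm Γ) σs → Env σs
  values []       = tt
  values (t ∷ ts) = ⟦ embed t ⟧ η , values ts

  ⟦embed-·*⟧ : (t : HATm Γ (σs ⇛ τ)) (ts : All (HATm Γ) σs) →
               ⟦ embed (t ·* ts) ⟧ η ≡ app* σs (⟦ embed t ⟧ η) (values ts)
  ⟦embed-·*⟧ t []       = refl
  ⟦embed-·*⟧ t (s ∷ ss) = ⟦embed-·*⟧ (t · s) ss

  ⟦recᵗ⟧ : (ps : All Finite σs) (i : σ ∈ σs) (n : HATm Γ N) (ws : All (HATm Γ) σs)
           (fs : All (HATm Γ) (map (StepTy σs) σs)) →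
           ⟦ embed (recᵗ ps i n ws fs) ⟧ η ≡
           lookupₛ i ⟨$⟩ simRec σs (⟦ embed n ⟧ η) (values ws) (values fs)
  ⟦recᵗ⟧ {σs = σs} ps i n ws fs =
    trans (⟦embed-·*⟧ {σs = map (StepTy σs) σs} ((con (Rᶜ ps i) · n) ·* ws) fs)
    (trans (cong (λ g → app* (map (StepTy σs) σs) g (values fs)) (⟦embed-·*⟧ (con (Rᶜ ps i) · n) ws))
           (app*-Rᶜ (All.map (λ _ → tt) ps) i (⟦ embed n ⟧ η) (values ws) (values fs)))

  lookup-values : (ts : All (HATm Γ) σs) (i : σ ∈ σs) →
                  lookupₛ i ⟨$⟩ values ts ≡ ⟦ embed (All.lookup ts i) ⟧ η
  lookup-values (t ∷ ts) (here refl) = refl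
  lookup-values (t ∷ ts) (there i)   = lookup-values ts i

  values-tabulate : (ts : ∀ {σ} → σ ∈ σs → HATm Γ σ) →
                    values (All.tabulate ts) ≡ tab (λ i → ⟦ embed (ts i) ⟧ η)
  values-tabulate {[]}     ts = refl
  values-tabulate {σ ∷ σs} ts = cong (⟦ embed (ts (here refl)) ⟧ η ,_) (values-tabulate (λ i → ts (there i)))

  lookup-step : (fs : All (HATm Γ) (map (StepTy σs) τs)) (i : τ ∈ τs) (n : ℕ) (xs : Env σs) →
                lookupₛ i ⟨$⟩ step σs τs (values fs) n xs ≡
                app* σs (⟦ embed (All.lookup (map⁻ {xs = τs} fs) i) ⟧ η ⟨$⟩ n) xs
  lookup-step {τs = τ ∷ τs} (f ∷ fs) (here refl) n xs = refl
  lookup-step {τs = τ ∷ τs} (f ∷ fs) (there i)   n xs = lookup-step fs i n xs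

  ⟦recᵗ⟧-suc : (ps : All Finite σs) (i : σ ∈ σs) (n : HATm Γ N) (ws : All (HATm Γ) σs)
               (fs : All (HATm Γ) (map (StepTy σs) σs)) →
               ⟦ embed (recᵗ ps i (sucᵗ n) ws fs) ⟧ η ≡
               ⟦ embed ((All.lookup (map⁻ fs) i · n) ·* All.tabulate (λ j → recᵗ ps j n ws fs)) ⟧ η
  ⟦recᵗ⟧-suc {σs = σs} ps i n ws fs =
    trans (⟦recᵗ⟧ ps i (sucᵗ n) ws fs)
    (trans (lookup-step fs i (⟦ embed n ⟧ η) prev)
    (trans (cong (app* σs (⟦ embed (All.lookup (map⁻ fs) i) ⟧ η ⟨$⟩ ⟦ embed n ⟧ η)) (sym tuple))
           (sym (⟦embed-·*⟧ (All.lookup (map⁻ fs) i · n) (All.tabulate (λ j → recᵗ ps j n ws fs))))))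
    where
    prev : Env σs
    prev = simRec σs (⟦ embed n ⟧ η) (values ws) (values fs)

    tuple : values (All.tabulate (λ j → recᵗ ps j n ws fs)) ≡ prev
    tuple = trans (values-tabulate (λ j → recᵗ ps j n ws fs))
      (trans (tab-cong (λ j → ⟦recᵗ⟧ ps j n ws fs)) (tab-lookup σs prev))

real-≡ : (s t : HATm Γ σ) → (∀ η → ⟦ embed s ⟧ η ≡ ⟦ embed t ⟧ η) → Real M H (form {l = HA+𝓘} (s ≐ t))
real-≡ {σ = σ} s t h = real-atom λ η → Setoid.reflexive (𝒮 σ) (h η)

real-≐⟶ : (s t : HATm Γ σ) {C : Form HA+𝓘 Γ} →
          Real M (Ext H ⟪ _≐_ {l = HA+𝓘} s t ⟫) (form C) → Real M H (form (s ≐ t ⟶ C))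
real-≐⟶ s t {C} = real-⟶∅ {ps = []} {R = ⟪ _≐_ {l = HA+𝓘} s t ⟫} {J = form C}

real-𝓘⟶ : (p : Finite σ) (t : HATm Γ σ) {C : Form HA+𝓘 Γ} →
          Real (M ▹ posᵐᵇ (p †)) (Ext H ⟪ 𝓘 p t ⟫) (form C) → Real M H (form (𝓘 p t ⟶ C))
real-𝓘⟶ p t {C} = real-⟶∅ {ps = posᵐᵇ (p †)} {R = ⟪ 𝓘 p t ⟫} {J = form C}

real-axiom : {A : Form HA Γ} → Axiom A → Real M H (form (A ^𝓘))
real-axiom (≐-refl t) = real-≡ t t λ _ → refl
real-axiom {Γ = Γ} (≐-subst t u A) = real-≃
  -- Both instances of `A` become reindexings of one interpretation, as `real-reindex-⟶` requires.
  (⟶-≃ (≃-refl {I = form {l = HA+𝓘} (t ≐ u)}) (⟶-≃ (form-[] A t) (form-[] A u)))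
  (real-⟶∅ {R = ⟪ _≐_ {l = HA+𝓘} t u ⟫} (real-reindex-⟶ (form (A ^𝓘)) _ _
    λ { e _ (ext _ _ _ _ _ t≈u) a b → ⟪⟫-cong (A ^𝓘) {_ , e} {_ , e} (t≈u , Setoid.refl (𝒮* Γ)) }))
real-axiom (Π-ax p q x y) = real-≡ (con (Πᶜ p q) · x · y) x λ _ → refl
real-axiom (Σ-ax p q r x y z) = real-≡ (con (Σᶜ p q r) · x · y · z) (x · z · (y · z)) λ _ → refl
real-axiom (S-inj s t) = real-≐⟶ (sucᵗ s) (sucᵗ t) {s ≐ t}
  (real [] λ { _ _ _ (ext _ _ _ _ _ h) _ _ → suc-injective h })
real-axiom (S≢0 t) = real-≐⟶ (sucᵗ t) zeroᵗ {⊥ᶠ} (real [] λ { _ _ _ (ext _ _ _ _ _ ()) })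
real-axiom (R-zero ps i ws fs) = real-≡ (recᵗ ps i zeroᵗ ws fs) (All.lookup ws i)
  λ η → trans (⟦recᵗ⟧ η ps i zeroᵗ ws fs) (lookup-values η ws i)
real-axiom (R-suc ps i n ws fs) =
  real-≡ (recᵗ ps i (sucᵗ n) ws fs) ((All.lookup (map⁻ fs) i · n) ·* All.tabulate (λ j → recᵗ ps j n ws fs))
    λ η → ⟦recᵗ⟧-suc η ps i n ws fs
real-axiom {Γ = Γ} 0≢1 = real-≐⟶ {Γ = Γ} (con 0ᴮ) (con 1ᴮ) {⊥ᶠ} (real [] λ { _ _ _ (ext _ _ _ _ _ ()) })
real-axiom {Γ = Γ} (B-cases D) =
  real-≃ (⟶-≃ (∧-≃ (form-[] D (con 0ᴮ)) (form-[] D (con 1ᴮ)))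
              (≃-refl {I = form {Γ = Γ} (∀ᶠ B (𝓘 B v₀ ⟶ D ^𝓘))}))
    (real-cases (form (D ^𝓘)) (upward (D ^𝓘)))
real-axiom (Cond-0 p x y) = real-≡ (con (Condᶜ p) · con 0ᴮ · x · y) x λ _ → refl
real-axiom (Cond-1 p x y) = real-≡ (con (Condᶜ p) · con 1ᴮ · x · y) y λ _ → refl
real-axiom {Γ = Γ} (ind A) =
  real-≃ (⟶-≃ (∧-≃ (form-[] A zeroᵗ)
                   (∀-≃ (⟶-≃ (≃-refl {I = form {Γ = N ∷ Γ} (𝓘 N v₀)}) (⟶-≃ (≃-refl {I = form (A ^𝓘)}) next))))
              (≃-refl {I = form {Γ = Γ} (∀ᶠ N (𝓘 N v₀ ⟶ A ^𝓘))}))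
    (real-ind (form (A ^𝓘)) (upward (A ^𝓘)))
  where
  s : Sub HAConst (N ∷ Γ) (N ∷ Γ)
  s = extend (sucᵗ v₀) (λ i → var (there i))

  next : form (sub s A ^𝓘) ≃ reindex (λ e → suc (proj₁ e) , proj₂ e) (form (A ^𝓘))
  next = ≃-trans (form-sub-^𝓘 s A)
    (reindex-≃ (form (A ^𝓘)) λ e → cong (suc (proj₁ e) ,_) (tab-lookup Γ (proj₂ e)))

-- From realizers to closed witnessing terms

interpretable : (A : Form l []) → Real {E = Env []} [] (λ _ _ → ⊤) (form A) → UInterpretable 𝓘ᵐᵇ A
interpretable A (real w s) = record
  { witnesses = ts
  ; monotone  = from (⊨Monotone* ts tt) (subst Mon* (sym ev) (evals-mono w []))
  ; holds     = from (⊨∀mon (neg 𝓘ᵐᵇ A) tt) λ b k →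
      from (⊨⟨⟩ A (wk▷ (neg 𝓘ᵐᵇ A)) (renTms (λ ()) ts) (vars▷ (neg 𝓘ᵐᵇ A)) (push [] tt b))
        (subst₂ (⟪ A ⟫ tt) (sym (trans (evs-ren (λ ()) ts (push [] tt b)) ev))
                         (sym (evs-vars▷ {Γ = []} tt b))
          (s tt [] [] tt b k))
  }
  where
  ts : Tms [] (pos 𝓘ᵐᵇ A)
  ts = All.map compile w

  compiled : (w : MTms [] ρs) → evs (All.map compile w) tt ≡ evals w []
  compiled []      = refl
  compiled (t ∷ w) = cong₂ _∷_ (⟦compile⟧ t) (compiled w)

  ev : evs ts tt ≡ evals w []
  ev = compiled w

-- Each free variable adds its majorant to `M` and the corresponding fact to `H`, so a realizer of
-- `A` is asked for at all `M` and `H`.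
real-∀𝓘 : (ps : All Finite Γ) (A : Form HA+𝓘 Γ) →
          (∀ {M} {H : Env Γ → Vals M → Set} → Real M H (form A)) →
          Real {E = Env []} [] (λ _ _ → ⊤) (form (∀𝓘 ps A))
real-∀𝓘 []       A r = r
real-∀𝓘 (p ∷ ps) A r = real-∀𝓘 ps _ (real-∀ {I = form (𝓘 p v₀ ⟶ A)} (real-𝓘⟶ p v₀ {A} r))

theorem8p14 : SoundTypeInformative 𝓘ᵐᵇ
theorem8p14 = record
  { constants   = λ p c → interpretable (𝓘 p (con c))
      (subst (λ p → Real [] _ (𝓘ᴵ p (λ _ → ⟦ embedConst c ⟧ᵀ))) (Finite-irrelevant (constFin c) p)
             (real-const c))
  ; application = λ p q → interpretable (∀ᶠ p (∀ᶠ (p ⇒ q) (𝓘 p v₁ ∧ 𝓘 (p ⇒ q) v₀ ⟶ 𝓘 q (v₀ · v₁))))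
      (real-∀ (real-∀ (real-⟶∅ (real-app p q
        (real-++ʳ {ρs = posᵐᵇ (p †)} {S = λ e a → smaj (p ⇒ q) (proj₁ e) a} (λ _ _ → proj₂) real-hyp)
        (real-++ˡ {S = λ e a → smaj p (proj₁ (proj₂ e)) a} (λ _ _ → proj₁) real-hyp)))))
  ; axioms      = λ ps {A} ax → interpretable (∀𝓘 ps (A ^𝓘)) (real-∀𝓘 ps (A ^𝓘) (real-axiom ax))
  }
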